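{- For all $n\ge1$ and all $\sigma\in S_n(321)$, $(\mathrm{fp},\mathrm{exc},\mathrm{crs})(\Theta(\sigma))=(\mathrm{fp},\mathrm{exc},\mathrm{crs})(\sigma)$; i.e. $\Theta$ preserves the number of fixed points, of excedances and of crossings.
   Context: $S_n(\tau)$: permutations of $[n]$ avoiding the pattern $\tau$. For $\sigma\in S_n$: $\mathrm{fp}(\sigma)=|\{i:\sigma(i)=i\}|$, $\mathrm{exc}(\sigma)=|\{i:\sigma(i)>i\}|$; a crossing is a pair $(i,j)$ with $i<j<\sigma(i)<\sigma(j)$ or $\sigma(i)<\sigma(j)\le i<j$, and $\mathrm{crs}(\sigma)$ is their number. Definition of $\Theta$: for $\sigma\in S_n(321)$ let $(P,Q)$ be the insertion and recording tableaux of the RSK correspondence applied to $\sigma$ (at most two rows). $\Psi(\sigma)$ is the path of $2n$ steps $u=(1,1)$, $d=(1,-1)$ whose first $n$ steps are, for $i=1,\dots,n$, $u$ if $i$ is in the first row of $P$ and $d$ if in the second, and whose last $n$ steps are, for $j=n,\dots,1$, $u$ if $j$ is in the second row of $Q$ and $d$ if in the first; it is a Dyck path. Each up-step is matched with the first later down-step ending at the height where the up-step starts. Labelling up-steps left to right $n,\dots,1$ and down-steps left to right $1,\dots,n$, $\Phi^{ -1}(D)$ sends each up-step label to the label of its matched down-step; it is a bijection onto $S_n(132)$. $\Theta=\Phi^{ -1}\circ\Psi$. -}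

module Defs where

open import Data.Nat using (ℕ; zero; suc; _+_; _∸_; _<_; _≤_; _<ᵇ_; _≡ᵇ_)
open import Data.Bool using (Bool; true; false; if_then_else_; _∧_; _∨_; not)
open import Data.List using (List; []; _∷_; _++_; map; length; upTo; reverse; concatMap; foldr)
open import Data.Maybe using (Maybe; just; nothing)
open import Data.Product using (_×_; _,_; proj₁; proj₂)
open import Data.List.Relation.Binary.Permutation.Propositional using (_↭_)
open import Relation.Nullary using (¬_)

-- Permutations of [n] = {1,…,n} in one-line notation: σ = [σ(1), …, σ(n)].

range : ℕ → List ℕ
range n = map suc (upTo n)

IsPerm : ℕ → List ℕ → Set
IsPerm n σ = σ ↭ range n

-- 1-indexed lookup σ(i); returns 0 outside 1..length σ
at : List ℕ → ℕ → ℕ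
at [] _ = 0
at (x ∷ xs) zero = 0
at (x ∷ xs) (suc zero) = x
at (x ∷ xs) (suc (suc i)) = at xs (suc i)

Avoids321 : ℕ → List ℕ → Set
Avoids321 n σ = ∀ i j k → 1 ≤ i → i < j → j < k → k ≤ n →
  ¬ ((at σ j < at σ i) × (at σ k < at σ j))

count : {A : Set} → (A → Bool) → List A → ℕ
count p [] = 0
count p (x ∷ xs) = if p x then suc (count p xs) else count p xs

_≤ᵇ'_ : ℕ → ℕ → Bool
m ≤ᵇ' n = m <ᵇ suc n

fp : List ℕ → ℕ
fp σ = count (λ i → at σ i ≡ᵇ i) (range (length σ))

exc : List ℕ → ℕ
exc σ = count (λ i → i <ᵇ at σ i) (range (length σ))

pairs : ℕ → List (ℕ × ℕ)
pairs n = concatMap (λ i → map (λ j → (i , j)) (range n)) (range n)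

isCrossing : List ℕ → ℕ × ℕ → Bool
isCrossing σ (i , j) =
  ((i <ᵇ j) ∧ (j <ᵇ at σ i) ∧ (at σ i <ᵇ at σ j))
  ∨ ((at σ i <ᵇ at σ j) ∧ (at σ j ≤ᵇ' i) ∧ (i <ᵇ j))

crs : List ℕ → ℕ
crs σ = count (isCrossing σ) (pairs (length σ))

-- RSK (row insertion, Schensted).  Tableaux are lists of rows (top row first),
-- each row an increasing list.

rowInsert : ℕ → List ℕ → List ℕ × Maybe ℕ
rowInsert x [] = (x ∷ [] , nothing)
rowInsert x (y ∷ ys) with x <ᵇ y
... | true = (x ∷ ys , just y)
... | false with rowInsert x ys
...   | (ys' , b) = (y ∷ ys' , b)

-- insert into tableau; also return the (0-based) index of the row where
-- the new box is created
insertT : ℕ → List (List ℕ) → List (List ℕ) × ℕ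
insertT x [] = ((x ∷ []) ∷ [] , 0)
insertT x (r ∷ rs) with rowInsert x r
... | (r' , nothing) = (r' ∷ rs , 0)
... | (r' , just y) with insertT y rs
...   | (rs' , k) = (r' ∷ rs' , suc k)

addAt : ℕ → ℕ → List (List ℕ) → List (List ℕ)
addAt i _ [] = (i ∷ []) ∷ []
addAt i zero (r ∷ rs) = (r ++ (i ∷ [])) ∷ rs
addAt i (suc k) (r ∷ rs) = r ∷ addAt i k rs

rskFrom : ℕ → List ℕ → List (List ℕ) × List (List ℕ) → List (List ℕ) × List (List ℕ)
rskFrom i [] PQ = PQ
rskFrom i (x ∷ xs) (P , Q) with insertT x P
... | (P' , k) = rskFrom (suc i) xs (P' , addAt i k Q)

rsk : List ℕ → List (List ℕ) × List (List ℕ)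
rsk σ = rskFrom 1 σ ([] , [])

row : ℕ → List (List ℕ) → List ℕ
row _ [] = []
row zero (r ∷ rs) = r
row (suc k) (r ∷ rs) = row k rs

elem : ℕ → List ℕ → Bool
elem x [] = false
elem x (y ∷ ys) = (x ≡ᵇ y) ∨ (elem x ys)

-- Ψ : paths encoded as List Bool, true = u = (1,1), false = d = (1,-1)

Ψ : List ℕ → List Bool
Ψ σ = map (λ i → elem i (row 0 P)) (range n)
      ++ map (λ j → elem j (row 1 Q)) (reverse (range n))
  where
  n = length σ
  P = proj₁ (rsk σ)
  Q = proj₂ (rsk σ)

-- Φ⁻¹ : Dyck path ↦ permutation.  Up-steps labelled n,…,1 left to right,
-- down-steps labelled 1,…,n left to right; each up-step is matched with the
-- first later down-step returning to its starting height (stack matching);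
-- the permutation sends the up label to the matched down label.

-- state: ups seen a, downs seen b, stack of open up labels, assignments
matchFrom : ℕ → ℕ → ℕ → List ℕ → List (ℕ × ℕ) → List Bool → List (ℕ × ℕ)
matchFrom n a b st acc [] = acc
matchFrom n a b st acc (true ∷ p) = matchFrom n (suc a) b ((n ∸ a) ∷ st) acc p
matchFrom n a b [] acc (false ∷ p) = matchFrom n a (suc b) [] acc p
matchFrom n a b (L ∷ st) acc (false ∷ p) = matchFrom n a (suc b) st ((L , suc b) ∷ acc) p

assoc : ℕ → List (ℕ × ℕ) → ℕ
assoc x [] = 0
assoc x ((k , v) ∷ kvs) = if x ≡ᵇ k then v else assoc x kvs

Φinv : ℕ → List Bool → List ℕ
Φinv n D = map (λ i → assoc i (matchFrom n 0 0 [] [] D)) (range n)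

Θ : List ℕ → List ℕ
Θ σ = Φinv (length σ) (Ψ σ)

{-# OPTIONS --safe #-}
module Submission where

-- The centre of the Dyck path Ψ(σ) cuts it into two half-paths read off P and Q. Its tunnels are m on
-- either side (m the length of the second rows) and the through strands, which join the unmatched
-- positions i₁ < i₂ < … of P to those j₁ < j₂ < … of Q. Under Φ⁻¹ a tunnel with midpoint at, or
-- right of, the centre is a fixed point, or an excedance; so fp counts the s with i_s = j_s, exc is
-- m plus the number of s with i_s > j_s, and 2 (crs + exc) is the total length of the tunnels on
-- either side plus the sum of the |i_s − j_s|.
--
-- For σ avoiding 321, crs + exc is the sum over k of r k = #{i ≤ k : σ(i) > k}. Let p k and q k count the
-- entries ≤ k of the second rows of P and Q. Greediness of row insertion gives |p k − q k| ≤ r k,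
-- with equality when k + 1 is an excedance value that is never bumped, or a position that is no
-- excedance and bumps nothing. By downward induction on k this forces
-- #{s : i_s , j_s ≤ k} = k − p k − q k − r k, and the three statistics can be read off.

open import Defs
open import Data.Bool using (Bool; true; false; if_then_else_; _∧_; _∨_; not)
open import Data.Bool.Properties using (∧-zeroʳ; not-involutive)
open import Data.Empty using (⊥; ⊥-elim)
open import Data.List using (List; []; _∷_; _++_; map; length; upTo; applyUpTo; reverse; concatMap; drop; zip)
open import Data.List.Properties using
  (map-++; map-applyUpTo; upTo-∷ʳ; ++-assoc; ++-identityʳ; reverse-++; length-map; length-upTo)
open import Data.List.Membership.Propositional using (_∈_; _∉_)
open import Data.List.Membership.Propositional.Properties using (∈-++⁺ˡ; ∈-++⁺ʳ; ∈-++⁻; ∈-map⁻; ∈-map⁺)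
open import Data.List.Relation.Binary.Permutation.Propositional using (_↭_; ↭-refl; ↭-sym; ↭-trans)
import Data.List.Relation.Binary.Permutation.Propositional as Perm
open import Data.List.Relation.Binary.Permutation.Propositional.Properties using (↭-length; ∈-resp-↭; shift)
open import Data.List.Relation.Unary.Any using (here; there)
open import Data.Maybe using (Maybe; just; nothing)
open import Data.Nat
open import Data.Nat.Properties
open import Data.Nat.Tactic.RingSolver using (solve; solve-∀)
open import Data.Product using (_×_; _,_; proj₁; proj₂; ∃-syntax; map₁)
open import Data.Sum using (_⊎_; inj₁; inj₂)
open import Function using (_∘_; case_of_; id)
open import Relation.Binary using (tri<; tri≈; tri>)
open import Relation.Binary.PropositionalEquality hiding ([_]; J)
open import Relation.Nullary using (¬_)

-- The obstacle is that strands are paired by rank among all unmatched positions, so no local rule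
-- on `σ` tells where the s-th strand ends. What is local is a minimum: the unmatched positions
-- `≤ k` of a half-path number its least height between `k` and `n`, so the count of strands inside
-- [k] passes from `k + 1` down to `k`. Put `ν = k − p k − q k − r k`. The two heights at `k` are
-- `k − 2 p k` and `k − 2 q k`; they exceed `ν` by `q k + r k − p k` and `p k + r k − q k`. Both are
-- non-negative, so the count cannot fall below `ν`; and wherever `ν` changes, one of them vanishes
-- and forces the drop. Differences of these counts then locate the strands ending at `k + 1`, which
-- gives fixed points and excedances position by position. Crossings are reached only together with
-- excedances: a strand with `i_s > j_s` is charged one crossing less than half its length, and
-- among the arcs counted by `r k` for an excedance `k`, the arc of `k` itself is the one that gives
-- no crossing.

infixl 4 _+≤_

_+≤_ : ∀ {a b c d} → a ≤ b → c ≤ d → a + c ≤ b + d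
_+≤_ = +-mono-≤

-- Certificates for linear arithmetic: add up the hypotheses, then a semiring identity.
linear-≤ : ∀ {a b l r} → l ≤ r → ∀ s → a + r + s ≡ b + l → a ≤ b
linear-≤ {a} {b} {l} {r} le s e =
  +-cancelʳ-≤ l a b (≤-trans (+-monoʳ-≤ a le) (≤-trans (m≤m+n (a + r) s) (≤-reflexive e)))

linear-≡ : ∀ {a b l r} → l ≡ r → a + r ≡ b + l → a ≡ b
linear-≡ {a} {b} {l} refl e = +-cancelʳ-≡ l a b e

-- Boolean comparisons and indicators.

data LessThan (m n : ℕ) : Bool → Set where
  lt : m < n → LessThan m n true
  ge : n ≤ m → LessThan m n false

-- Abstracting `m <ᵇ n` together with `compare< m n` makes every indicator in the goal compute and
-- yields the inequality in the same match. Most termwise identities below are truth tables of this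
-- kind.
compare< : ∀ m n → LessThan m n (m <ᵇ n)
compare< m       zero    = ge z≤n
compare< zero    (suc n) = lt z<s
compare< (suc m) (suc n) with m <ᵇ n | compare< m n
... | true  | lt p = lt (s<s p)
... | false | ge p = ge (s≤s p)

data Equal (m n : ℕ) : Bool → Set where
  eq : m ≡ n → Equal m n true
  ne : m ≢ n → Equal m n false

compare≡ : ∀ m n → Equal m n (m ≡ᵇ n)
compare≡ zero    zero    = eq refl
compare≡ zero    (suc n) = ne λ ()
compare≡ (suc m) zero    = ne λ ()
compare≡ (suc m) (suc n) with m ≡ᵇ n | compare≡ m n
... | true  | eq p = eq (cong suc p)
... | false | ne p = ne (p ∘ suc-injective)

<⇒true : ∀ {m n} → m < n → (m <ᵇ n) ≡ true
<⇒true {m} {n} p with m <ᵇ n | compare< m n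
... | true  | _    = refl
... | false | ge q = ⊥-elim (<⇒≱ p q)

≥⇒false : ∀ {m n} → n ≤ m → (m <ᵇ n) ≡ false
≥⇒false {m} {n} p with m <ᵇ n | compare< m n
... | true  | lt q = ⊥-elim (<⇒≱ q p)
... | false | _    = refl

≡⇒true : ∀ {m n} → m ≡ n → (m ≡ᵇ n) ≡ true
≡⇒true {m} {n} p with m ≡ᵇ n | compare≡ m n
... | true  | _    = refl
... | false | ne q = ⊥-elim (q p)

≢⇒false : ∀ {m n} → m ≢ n → (m ≡ᵇ n) ≡ false
≢⇒false {m} {n} p with m ≡ᵇ n | compare≡ m n
... | true  | eq q = ⊥-elim (p q)
... | false | _    = refl

⟦_⟧ : Bool → ℕ
⟦ true ⟧  = 1
⟦ false ⟧ = 0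

⟦⟧-pos : ∀ b → 0 < ⟦ b ⟧ → b ≡ true
⟦⟧-pos true _ = refl

∧-true : ∀ {b c} → (b ∧ c) ≡ true → b ≡ true × c ≡ true
∧-true {true} {true} _ = refl , refl

true⇒< : ∀ {m n} → (m <ᵇ n) ≡ true → m < n
true⇒< {m} {n} e with m <ᵇ n | compare< m n
true⇒< refl | true | lt p = p

true⇒≡ : ∀ {m n} → (m ≡ᵇ n) ≡ true → m ≡ n
true⇒≡ {m} {n} e with m ≡ᵇ n | compare≡ m n
true⇒≡ refl | true | eq p = p

-- Finite sums over positions 1, ..., n and over lists.

∑ : ℕ → (ℕ → ℕ) → ℕ
∑ zero    f = 0
∑ (suc n) f = ∑ n f + f (suc n)

∑-cong : ∀ n {f g} → (∀ k → 1 ≤ k → k ≤ n → f k ≡ g k) → ∑ n f ≡ ∑ n g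
∑-cong zero    h = refl
∑-cong (suc n) h = cong₂ _+_ (∑-cong n (λ k p q → h k p (m≤n⇒m≤1+n q))) (h (suc n) z<s ≤-refl)

∑-mono : ∀ n {f g} → (∀ k → 1 ≤ k → k ≤ n → f k ≤ g k) → ∑ n f ≤ ∑ n g
∑-mono zero    h = z≤n
∑-mono (suc n) h = ∑-mono n (λ k p q → h k p (m≤n⇒m≤1+n q)) +≤ h (suc n) z<s ≤-refl

∑-0 : ∀ n {f} → (∀ k → 1 ≤ k → k ≤ n → f k ≡ 0) → ∑ n f ≡ 0
∑-0 zero    h = refl
∑-0 (suc n) h = cong₂ _+_ (∑-0 n (λ k p q → h k p (m≤n⇒m≤1+n q))) (h (suc n) z<s ≤-refl)

+-interchange : ∀ a b c d → (a + b) + (c + d) ≡ (a + c) + (b + d)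
+-interchange = solve-∀

∑-+ : ∀ n f g → ∑ n (λ k → f k + g k) ≡ ∑ n f + ∑ n g
∑-+ zero    f g = refl
∑-+ (suc n) f g = trans (cong (_+ (f (suc n) + g (suc n))) (∑-+ n f g))
                        (+-interchange (∑ n f) (∑ n g) (f (suc n)) (g (suc n)))

∑-swap : ∀ m n (f : ℕ → ℕ → ℕ) → ∑ m (λ i → ∑ n (f i)) ≡ ∑ n (λ j → ∑ m (λ i → f i j))
∑-swap zero    n f = sym (∑-0 n (λ _ _ _ → refl))
∑-swap (suc m) n f = trans (cong (_+ ∑ n (f (suc m))) (∑-swap m n f))
                           (sym (∑-+ n (λ j → ∑ m (λ i → f i j)) (f (suc m))))

∑-single : ∀ n {f} x → 1 ≤ x → x ≤ n → (∀ k → 1 ≤ k → k ≤ n → k ≢ x → f k ≡ 0) → ∑ n f ≡ f x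
∑-single zero    x 1≤x x≤n h = ⊥-elim (<⇒≱ 1≤x x≤n)
∑-single (suc n) {f} x 1≤x x≤n h with m≤n⇒m<n∨m≡n x≤n
... | inj₂ refl = cong (_+ f (suc n)) (∑-0 n (λ k p q → h k p (m≤n⇒m≤1+n q) (<⇒≢ (s≤s q))))
... | inj₁ x<n  = trans (cong₂ _+_ (∑-single n x 1≤x (s≤s⁻¹ x<n) (λ k p q → h k p (m≤n⇒m≤1+n q)))
                                   (h (suc n) z<s ≤-refl (λ e → <⇒≢ x<n (sym e))))
                        (+-identityʳ _)

∑-term : ∀ n {f} x → 1 ≤ x → x ≤ n → f x ≤ ∑ n f
∑-term zero    x 1≤x x≤n = ⊥-elim (<⇒≱ 1≤x x≤n)
∑-term (suc n) {f} x 1≤x x≤n with m≤n⇒m<n∨m≡n x≤n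
... | inj₂ refl = m≤n+m (f (suc n)) (∑ n f)
... | inj₁ x<n  = ≤-trans (∑-term n x 1≤x (s≤s⁻¹ x<n)) (m≤m+n _ _)

∑-two-terms : ∀ n {f} x y → 1 ≤ x → x < y → y ≤ n → f x + f y ≤ ∑ n f
∑-two-terms zero    x y 1≤x x<y y≤n = ⊥-elim (<⇒≱ (≤-<-trans z≤n x<y) y≤n)
∑-two-terms (suc n) {f} x y 1≤x x<y y≤n with m≤n⇒m<n∨m≡n y≤n
... | inj₂ refl = ∑-term n x 1≤x (s≤s⁻¹ x<y) +≤ ≤-refl
... | inj₁ y<n  = ≤-trans (∑-two-terms n x y 1≤x x<y (s≤s⁻¹ y<n)) (m≤m+n _ _)

∑-pos : ∀ n {f} → 0 < ∑ n f → ∃[ k ] (1 ≤ k × k ≤ n × 0 < f k)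
∑-pos (suc n) {f} p with f (suc n) in e
... | suc m = suc n , z<s , ≤-refl , subst (0 <_) (sym e) z<s
... | zero with ∑-pos n (subst (0 <_) (+-identityʳ _) p)
...   | k , a , b , c = k , a , m≤n⇒m≤1+n b , c

∑-≤ : ∀ n x → x ≤ n → ∑ n (λ k → ⟦ k <ᵇ suc x ⟧) ≡ x
∑-≤ zero    zero x≤n = refl
∑-≤ (suc n) x    x≤n with m≤n⇒m<n∨m≡n x≤n
... | inj₁ x<n rewrite ≥⇒false {suc n} {suc x} x<n = trans (+-identityʳ _) (∑-≤ n x (s≤s⁻¹ x<n))
... | inj₂ refl rewrite <⇒true {suc n} {suc (suc n)} ≤-refl =
  trans (cong (_+ 1) (trans (∑-cong n (λ k _ q → cong ⟦_⟧ (trans (<⇒true {k} (s≤s (m≤n⇒m≤1+n q)))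
                                                                  (sym (<⇒true {k} (s≤s q))))))
                            (∑-≤ n n ≤-refl)))
        (+-comm n 1)

∑L : {A : Set} → (A → ℕ) → List A → ℕ
∑L f []       = 0
∑L f (x ∷ xs) = f x + ∑L f xs

module _ {A : Set} where

  count≡∑L : ∀ (p : A → Bool) xs → count p xs ≡ ∑L (λ x → ⟦ p x ⟧) xs
  count≡∑L p [] = refl
  count≡∑L p (x ∷ xs) with p x
  ... | true  = cong suc (count≡∑L p xs)
  ... | false = count≡∑L p xs

  ∑L-++ : ∀ (f : A → ℕ) xs ys → ∑L f (xs ++ ys) ≡ ∑L f xs + ∑L f ys
  ∑L-++ f []       ys = refl
  ∑L-++ f (x ∷ xs) ys = trans (cong (f x +_) (∑L-++ f xs ys)) (sym (+-assoc (f x) _ _))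

  ∑L-cong : ∀ {f g : A → ℕ} xs → (∀ {x} → x ∈ xs → f x ≡ g x) → ∑L f xs ≡ ∑L g xs
  ∑L-cong []       h = refl
  ∑L-cong (x ∷ xs) h = cong₂ _+_ (h (here refl)) (∑L-cong xs (h ∘ there))

  ∑L-+ : ∀ (f g : A → ℕ) xs → ∑L (λ x → f x + g x) xs ≡ ∑L f xs + ∑L g xs
  ∑L-+ f g []       = refl
  ∑L-+ f g (x ∷ xs) = trans (cong (f x + g x +_) (∑L-+ f g xs)) (+-interchange (f x) (g x) _ _)

  ∑L-↭ : ∀ (f : A → ℕ) {xs ys} → xs ↭ ys → ∑L f xs ≡ ∑L f ys
  ∑L-↭ f Perm.refl         = refl
  ∑L-↭ f (Perm.prep x p)   = cong (f x +_) (∑L-↭ f p)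
  ∑L-↭ f (Perm.swap {xs} {ys} x y p) =
    trans (cong (λ s → f x + (f y + s)) (∑L-↭ f p)) (exchange (f x) (f y) (∑L f ys))
    where
    exchange : ∀ a b c → a + (b + c) ≡ b + (a + c)
    exchange = solve-∀
  ∑L-↭ f (Perm.trans p q)  = trans (∑L-↭ f p) (∑L-↭ f q)

  ∑L-∑ : ∀ n (f : A → ℕ → ℕ) xs → ∑ n (λ k → ∑L (λ x → f x k) xs) ≡ ∑L (λ x → ∑ n (f x)) xs
  ∑L-∑ n f []       = ∑-0 n (λ _ _ _ → refl)
  ∑L-∑ n f (x ∷ xs) = trans (∑-+ n (f x) (λ k → ∑L (λ y → f y k) xs)) (cong (∑ n (f x) +_) (∑L-∑ n f xs))

∑L-map : ∀ {A B : Set} (f : B → ℕ) (g : A → B) xs → ∑L f (map g xs) ≡ ∑L (f ∘ g) xs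
∑L-map f g []       = refl
∑L-map f g (x ∷ xs) = cong (f (g x) +_) (∑L-map f g xs)

range-suc : ∀ n → range (suc n) ≡ range n ++ (suc n ∷ [])
range-suc n = trans (cong (map suc) (sym (upTo-∷ʳ n))) (map-++ suc (upTo n) (n ∷ []))

length-range : ∀ n → length (range n) ≡ n
length-range n = trans (length-map suc (upTo n)) (length-upTo n)

∑L-range : ∀ (f : ℕ → ℕ) n → ∑L f (range n) ≡ ∑ n f
∑L-range f zero    = refl
∑L-range f (suc n) = trans (cong (∑L f) (range-suc n))
                    (trans (∑L-++ f (range n) (suc n ∷ []))
                           (cong₂ _+_ (∑L-range f n) (+-identityʳ _)))

count-range : ∀ p n → count p (range n) ≡ ∑ n (λ k → ⟦ p k ⟧)
count-range p n = trans (count≡∑L p (range n)) (∑L-range _ n)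

∑L-concatMap : ∀ {A B : Set} (f : B → ℕ) (g : A → List B) xs →
               ∑L f (concatMap g xs) ≡ ∑L (λ x → ∑L f (g x)) xs
∑L-concatMap f g []       = refl
∑L-concatMap f g (x ∷ xs) = trans (∑L-++ f (g x) (concatMap g xs)) (cong (∑L f (g x) +_) (∑L-concatMap f g xs))

count-pairs : ∀ p n → count p (pairs n) ≡ ∑ n (λ i → ∑ n (λ j → ⟦ p (i , j) ⟧))
count-pairs p n = begin
  count p (pairs n)
    ≡⟨ count≡∑L p (pairs n) ⟩
  ∑L (λ e → ⟦ p e ⟧) (pairs n)
    ≡⟨ ∑L-concatMap _ (λ i → map (λ j → (i , j)) (range n)) (range n) ⟩
  ∑L (λ i → ∑L (λ e → ⟦ p e ⟧) (map (λ j → (i , j)) (range n))) (range n)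
    ≡⟨ ∑L-range _ n ⟩
  ∑ n (λ i → ∑L (λ e → ⟦ p e ⟧) (map (λ j → (i , j)) (range n)))
    ≡⟨ ∑-cong n (λ i _ _ → trans (∑L-map (λ e → ⟦ p e ⟧) (λ j → (i , j)) (range n)) (∑L-range _ n)) ⟩
  ∑ n (λ i → ∑ n (λ j → ⟦ p (i , j) ⟧)) ∎
  where open ≡-Reasoning

∑L-at : ∀ (φ : ℕ → ℕ) xs → ∑L φ xs ≡ ∑ (length xs) (λ i → φ (at xs i))
∑L-at φ xs = go xs
  where
  ∑-shift : ∀ n g → ∑ (suc n) g ≡ g 1 + ∑ n (g ∘ suc)
  ∑-shift zero    g = +-comm 0 (g 1)
  ∑-shift (suc n) g = trans (cong (_+ g (suc (suc n))) (∑-shift n g)) (+-assoc (g 1) _ _)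
  go : ∀ xs → ∑L φ xs ≡ ∑ (length xs) (λ i → φ (at xs i))
  go []       = refl
  go (x ∷ xs) = trans (cong (φ x +_) (trans (go xs) (∑-cong (length xs) (λ { (suc i) _ _ → refl }))))
                      (sym (∑-shift (length xs) (λ i → φ (at (x ∷ xs) i))))

-- Linear identities between heights, ranks and step counts.

height-double : ∀ u d k l → l + d ≡ u → u + d ≡ k → u + u ≡ k + l
height-double u d k l h₁ h₂ = linear-≡ (cong₂ _+_ (sym h₁) h₂) (solve (u ∷ d ∷ k ∷ l ∷ []))

-- For an arc opened at `i` and closed at `suc k`, with `a` and `b` pushes up to `i` and `k`: the
-- stack has the same height `l` after `i` and after `k`, so between them lie `b ∸ a` pushes and as
-- many pops.
arc-length : ∀ {i k a b} l → i ≤ k → a ≤ b → a + a ≡ i + l → b + b ≡ k + l → suc k ∸ i ≡ suc ((b ∸ a) + (b ∸ a))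
arc-length {i} {k} {a} {b} l i≤k a≤b h₁ h₂ with m≤n⇒∃[o]m+o≡n i≤k | m≤n⇒∃[o]m+o≡n a≤b
... | d , refl | c , refl = begin
  suc (i + d) ∸ i                       ≡⟨ cong (_∸ i) (sym (+-suc i d)) ⟩
  i + suc d ∸ i                         ≡⟨ m+n∸m≡n i (suc d) ⟩
  suc d                                 ≡⟨ cong suc d≡c+c ⟩
  suc (c + c)                           ≡⟨ cong (λ x → suc (x + x)) (m+n∸m≡n a c) ⟨
  suc ((a + c ∸ a) + (a + c ∸ a))       ∎
  where
  open ≡-Reasoning
  d≡c+c : d ≡ c + c
  d≡c+c = linear-≡ (cong₂ _+_ h₁ (sym h₂)) (solve (i ∷ d ∷ a ∷ c ∷ l ∷ []))

push-heights : ∀ {t} ν δ s l → t ≡ (ν + ν) + δ + s → t + suc l ≡ (ν + ν) + δ + (1 + (l + s))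
push-heights {t} ν δ s l refl = solve (ν ∷ δ ∷ s ∷ l ∷ [])

pop-heights : ∀ {t x} ν δ s l c → t ≡ (ν + ν) + δ + (x + s) → x ≡ suc (c + c) →
              t + l ≡ ((c + ν) + (c + ν)) + suc δ + (l + s)
pop-heights ν δ s l c refl refl = solve (ν ∷ δ ∷ s ∷ l ∷ c ∷ [])

step-passive : ∀ {P Q e v p q r r′} → v ≡ P → Q + e ≡ 1 → r′ + v ≡ r + e → (p + P) + (q + Q) + r′ ≡ suc
      (p + q + r)
step-passive {P} {Q} {e} {v} {p} {q} {r} {r′} refl h₁ h₂ =
  linear-≡ (cong₂ _+_ h₂ h₁) (solve (P ∷ Q ∷ e ∷ p ∷ q ∷ r ∷ r′ ∷ []))

step-active : ∀ {P Q e v p q r r′} → v ≡ P + (Q + e) → r′ + v ≡ r + e → (p + P) + (q + Q) + r′ ≡ (p + q + r)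
step-active {P} {Q} {e} {v} {p} {q} {r} {r′} h₁ h₂ =
  linear-≡ (cong₂ _+_ h₂ (sym h₁)) (solve (P ∷ Q ∷ e ∷ v ∷ p ∷ q ∷ r ∷ r′ ∷ []))

-- Both sides of the equation are `k`, so `h` is the stack height `k − 2p` and `h − ν = q + r − p`
-- is the slack in the greedy bound. `tight` is the case of no slack; in `strict` the height is that
-- of the other stack, whose slack is then `2r`.
gap : ∀ {h p q r ν} → h + (p + p) ≡ ν + (p + q + r) → p ≤ q + r → ν ≤ h
gap {h} {p} {q} {r} {ν} e le = linear-≤ (≤-reflexive (sym e) +≤ le) 0 (solve (h ∷ p ∷ q ∷ r ∷ ν ∷ []))

tight : ∀ {h p q r ν} → h + (p + p) ≡ ν + (p + q + r) → p ≡ q + r → h ≡ ν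
tight {h} {p} {q} {r} {ν} e le = linear-≡ (cong₂ _+_ e (sym le)) (solve (h ∷ p ∷ q ∷ r ∷ ν ∷ []))

strict : ∀ {h p q r ν} → h + (q + q) ≡ ν + (p + q + r) → p ≡ q + r → 1 ≤ r → suc ν ≤ h
strict {h} {p} {q} {r} {ν} e le 1≤r = linear-≤ (≤-reflexive (sym e) +≤ ≤-reflexive (sym le) +≤ 1≤r) r
      (solve (h ∷ p ∷ q ∷ r ∷ ν ∷ []))

swap-pq : ∀ {h ν} p q r → h ≡ ν + (p + q + r) → h ≡ ν + (q + p + r)
swap-pq {h} {ν} p q r refl = solve (ν ∷ p ∷ q ∷ r ∷ [])

-- The two heights add up to `2k − 2p − 2q`, and `m = k − p − q − r` will be the number of strands
-- inside [k].
heights-balance : ∀ {a b m k} p q r → a + (p + p) ≡ k → b + (q + q) ≡ k → m + (p + q + r) ≡ k → a + b ≡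
      (r + r) + (m + m)
heights-balance {a} {b} {m} {k} p q r h₁ h₂ h₃ =
  linear-≡ (cong₂ _+_ (cong₂ _+_ h₁ h₂) (sym (cong₂ _+_ h₃ h₃))) (solve (a ∷ b ∷ m ∷ k ∷ p ∷ q ∷ r ∷ []))

-- The ends `i` and `j` of a strand sit at equal height, whence `i − j = 2 (a − b)` for the numbers
-- `a`, `b` of pushes up to them. Comparing positions, as `σ` does, and comparing push counts, as
-- the labels of Φ⁻¹ do, thus agree.
rank-< : ∀ {i j a b} → a + a + j ≡ b + b + i → b < a → j < i
rank-< {i} {j} {a} {b} e b<a = linear-≤ (≤-reflexive e +≤ b<a +≤ b<a) 1 (solve (i ∷ j ∷ a ∷ b ∷ []))

rank-≡ : ∀ {i j a b} → a + a + j ≡ b + b + i → a ≡ b → i ≡ j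
rank-≡ {i} {j} {a} e refl = sym (+-cancelˡ-≡ (a + a) j i e)

rank-zip : ∀ {i j a b l} → a + a ≡ i + l → b + b ≡ j + l → a + a + j ≡ b + b + i
rank-zip {i} {j} {a} {b} {l} h₁ h₂ = linear-≡ (cong₂ _+_ h₁ (sym h₂)) (solve (i ∷ j ∷ a ∷ b ∷ l ∷ []))

halve : ∀ {x y} → x + x ≡ y + y → x ≡ y
halve {x} {y} e = *-cancelˡ-≡ x y 2 (trans (cong (x +_) (+-identityʳ x))
      (trans e (cong (y +_) (sym (+-identityʳ y)))))

private
  distances-≤ : ∀ {n i j a b} → i ≤ j → j ≤ n → a + a + j ≡ b + b + i →
    (suc n ∸ i) + (suc n ∸ j) ≡ ((b ∸ a + (a ∸ b)) + (b ∸ a + (a ∸ b))) + ((suc n ∸ j) + (suc n ∸ j))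
  distances-≤ {i = i} {a = a} {b} i≤j j≤n e with m≤n⇒∃[o]m+o≡n i≤j
  ... | d , refl with m≤n⇒∃[o]m+o≡n j≤n
  ...   | m , refl with m≤n⇒∃[o]m+o≡n (≮⇒≥ {b} {a} (λ b<a → <⇒≱ (rank-< {i} {i + d} {a} {b} e b<a) (m≤m+n i d)))
  ...     | c , refl rewrite m≤n⇒m∸n≡0 (m≤m+n a c) | m+n∸m≡n a c | +-identityʳ c
                         | sym (+-suc (i + d) m) | m+n∸m≡n (i + d) (suc m) | +-assoc i d (suc m) | m+n∸m≡n i
                             (d + suc m) =
    trans (cong (λ x → x + suc m + suc m) d≡c+c) (+-assoc (c + c) (suc m) (suc m))
    where
    d≡c+c : d ≡ c + c
    d≡c+c = linear-≡ e (solve (i ∷ d ∷ a ∷ c ∷ []))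

-- The left side is `|i − j|` plus twice the distance from the larger of `i` and `j` to `n + 1`, and
-- `|i − j|` is `2 |a − b|` by the rank equation.
distances : ∀ {n i j a b} → i ≤ n → j ≤ n → a + a + j ≡ b + b + i →
  (suc n ∸ i) + (suc n ∸ j) ≡ ((b ∸ a + (a ∸ b)) + (b ∸ a + (a ∸ b))) + ((suc n ∸ (i ⊔ j)) + (suc n ∸ (i ⊔ j)))
distances {n} {i} {j} {a} {b} i≤n j≤n e with ≤-total i j
... | inj₁ i≤j rewrite m≤n⇒m⊔n≡n i≤j = distances-≤ {n} {i} {j} {a} {b} i≤j j≤n e
... | inj₂ j≤i rewrite m≥n⇒m⊔n≡m j≤i = trans (+-comm (suc n ∸ i) (suc n ∸ j))
        (trans (distances-≤ {n} {j} {i} {b} {a} j≤i i≤n (sym e))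
               (cong (λ x → x + x + ((suc n ∸ i) + (suc n ∸ i))) (+-comm (a ∸ b) (b ∸ a))))

regroup : ∀ {d d′ σ μ} a b i j → d ≡ d′ → i + j ≡ (σ + σ) + (μ + μ) →
  (a + a + d + i) + (b + b + d′ + j) ≡ ((a + b + d′ + σ) + (a + b + d′ + σ)) + (μ + μ)
regroup {d} {_} {σ} {μ} a b i j refl h = linear-≡ h (solve (d ∷ σ ∷ μ ∷ a ∷ b ∷ i ∷ j ∷ []))

collect : ∀ a c b d x → a + (c + b) + (d + x) ≡ a + b + d + (c + x)
collect a c b d x = solve (a ∷ c ∷ b ∷ d ∷ x ∷ [])

open import Data.List.Relation.Unary.All as All using (All; []; _∷_)
import Data.List.Relation.Unary.All.Properties as All
open import Data.List.Relation.Unary.AllPairs using (AllPairs; []; _∷_)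
import Data.List.Relation.Unary.AllPairs.Properties as AllPairs

-- Permutations avoiding 321

-- Bijectivity is encoded as invariance of every sum under `f`. Taking indicators for `φ` recovers
-- the range, injectivity and surjectivity, and the sums below are reindexed without naming an
-- inverse.
record Avoiding321 (n : ℕ) (f : ℕ → ℕ) : Set where
  field
    reindex : ∀ φ → ∑ n (φ ∘ f) ≡ ∑ n φ
    avoids  : ∀ {i j k} → 1 ≤ i → i < j → j < k → k ≤ n → f j < f i → f k < f j → ⊥

IsPerm⇒Avoiding321 : ∀ n σ → IsPerm n σ → Avoids321 n σ → Avoiding321 n (at σ)
IsPerm⇒Avoiding321 n σ perm av = record
  { reindex = λ φ → begin
      ∑ n (φ ∘ at σ)          ≡⟨ cong (λ m → ∑ m (φ ∘ at σ)) (sym len) ⟩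
      ∑ (length σ) (φ ∘ at σ) ≡⟨ ∑L-at φ σ ⟨
      ∑L φ σ                  ≡⟨ ∑L-↭ φ perm ⟩
      ∑L φ (range n)          ≡⟨ ∑L-range φ n ⟩
      ∑ n φ                   ∎
  ; avoids  = λ a b c d e g → av _ _ _ a b c d (e , g)
  }
  where
  open ≡-Reasoning
  len : length σ ≡ n
  len = trans (↭-length perm) (length-range n)

module Permutation {n : ℕ} {f : ℕ → ℕ} (av : Avoiding321 n f) where
  open Avoiding321 av

  private
    outside : ℕ → ℕ
    outside v = ⟦ (v ≡ᵇ 0) ∨ (n <ᵇ v) ⟧

    outside-0 : ∀ {i} → 1 ≤ i → i ≤ n → outside (f i) ≡ 0
    outside-0 {i} p q = n≤0⇒n≡0 (≤-trans (∑-term n {outside ∘ f} i p q)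
      (≤-reflexive (trans (reindex outside) (∑-0 n λ { (suc k) _ k≤n → cong ⟦_⟧ (≥⇒false k≤n) }))))

  f-≥1 : ∀ {i} → 1 ≤ i → i ≤ n → 1 ≤ f i
  f-≥1 {i} p q with f i | outside-0 p q
  ... | zero  | ()
  ... | suc _ | _ = z<s

  f-≤n : ∀ {i} → 1 ≤ i → i ≤ n → f i ≤ n
  f-≤n {i} p q with f i | outside-0 p q
  ... | zero  | ()
  ... | suc v | e with n <ᵇ suc v | compare< n (suc v)
  f-≤n {i} p q | suc v | () | true | _
  ...   | false | ge v≤n = v≤n

  private
    occurrences : ∀ {v} → 1 ≤ v → v ≤ n → ∑ n (λ i → ⟦ f i ≡ᵇ v ⟧) ≡ 1
    occurrences {v} p q = trans (reindex (λ u → ⟦ u ≡ᵇ v ⟧))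
      (trans (∑-single n v p q (λ k _ _ ne → cong ⟦_⟧ (≢⇒false ne))) (cong ⟦_⟧ (≡⇒true {v} refl)))

    distinct : ∀ {i j} → 1 ≤ i → i < j → j ≤ n → f i ≢ f j
    distinct {i} {j} p q r e = <⇒≱ {1} ≤-refl (≤-trans
      (subst₂ (λ b c → ⟦ b ⟧ + ⟦ c ⟧ ≤ ∑ n (λ l → ⟦ f l ≡ᵇ f j ⟧)) (≡⇒true e) (≡⇒true {f j} refl)
        (∑-two-terms n {λ l → ⟦ f l ≡ᵇ f j ⟧} i j p q r))
      (≤-reflexive (occurrences (f-≥1 (≤-trans p (<⇒≤ q)) r) (f-≤n (≤-trans p (<⇒≤ q)) r))))

  injective : ∀ {i j} → 1 ≤ i → i ≤ n → 1 ≤ j → j ≤ n → f i ≡ f j → i ≡ j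
  injective {i} {j} p q r s e with <-cmp i j
  ... | tri< l _ _ = ⊥-elim (distinct p l s e)
  ... | tri≈ _ l _ = l
  ... | tri> _ _ l = ⊥-elim (distinct r l q (sym e))

  surjective : ∀ {v} → 1 ≤ v → v ≤ n → ∃[ i ] (1 ≤ i × i ≤ n × f i ≡ v)
  surjective p q with ∑-pos n (subst (0 <_) (sym (occurrences p q)) z<s)
  ... | i , a , b , c = i , a , b , true⇒≡ (⟦⟧-pos _ c)

  rising falling : ℕ → ℕ
  rising  k = ∑ n (λ i → ⟦ (i <ᵇ suc k) ∧ (k <ᵇ f i) ⟧)
  falling k = ∑ n (λ i → ⟦ (k <ᵇ i) ∧ (f i <ᵇ suc k) ⟧)

  -- Both complete the arcs that stay inside [k] to `k`: the one among positions `≤ k`, the other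
  -- among values `≤ k`.
  rising≡falling : ∀ k → k ≤ n → rising k ≡ falling k
  rising≡falling k k≤n = +-cancelʳ-≡ (∑ n low) _ _ (trans left (sym right))
    where
    low : ℕ → ℕ
    low i = ⟦ (i <ᵇ suc k) ∧ (f i <ᵇ suc k) ⟧
    left : rising k + ∑ n low ≡ k
    left = trans (sym (∑-+ n _ low)) (trans (∑-cong n (λ i _ _ → split i)) (∑-≤ n k k≤n))
      where
      split : ∀ i → ⟦ (i <ᵇ suc k) ∧ (k <ᵇ f i) ⟧ + low i ≡ ⟦ i <ᵇ suc k ⟧
      split i with i <ᵇ suc k | k <ᵇ f i | compare< k (f i) | f i <ᵇ suc k | compare< (f i) (suc k)
      ... | false | _     | _    | _     | _    = refl
      ... | true  | true  | _    | false | _    = refl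
      ... | true  | false | _    | true  | _    = refl
      ... | true  | true  | lt p | true  | lt q = ⊥-elim (<⇒≱ p (s≤s⁻¹ q))
      ... | true  | false | ge p | false | ge q = ⊥-elim (<⇒≱ q p)
    right : falling k + ∑ n low ≡ k
    right = trans (sym (∑-+ n _ low)) (trans (∑-cong n (λ i _ _ → split i))
              (trans (reindex (λ v → ⟦ v <ᵇ suc k ⟧)) (∑-≤ n k k≤n)))
      where
      split : ∀ i → ⟦ (k <ᵇ i) ∧ (f i <ᵇ suc k) ⟧ + low i ≡ ⟦ f i <ᵇ suc k ⟧
      split i with f i <ᵇ suc k | k <ᵇ i | compare< k i | i <ᵇ suc k | compare< i (suc k)
      ... | false | true  | _    | true  | _    = refl
      ... | false | true  | _    | false | _    = refl
      ... | false | false | _    | true  | _    = refl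
      ... | false | false | _    | false | _    = refl
      ... | true  | true  | _    | false | _    = refl
      ... | true  | false | _    | true  | _    = refl
      ... | true  | true  | lt p | true  | lt q = ⊥-elim (<⇒≱ p (s≤s⁻¹ q))
      ... | true  | false | ge p | false | ge q = ⊥-elim (<⇒≱ q p)

  rising-witness : ∀ {k} → 0 < rising k → ∃[ i ] (1 ≤ i × i ≤ n × i ≤ k × k < f i)
  rising-witness p with ∑-pos n p
  ... | i , a , b , c with ∧-true (⟦⟧-pos _ c)
  ...   | d , e = i , a , b , s≤s⁻¹ (true⇒< d) , true⇒< e

  falling-witness : ∀ {k} → 0 < falling k → ∃[ j ] (1 ≤ j × j ≤ n × k < j × f j ≤ k)
  falling-witness p with ∑-pos n p
  ... | i , a , b , c with ∧-true (⟦⟧-pos _ c)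
  ...   | d , e = i , a , b , true⇒< d , s≤s⁻¹ (true⇒< e)

  rising-pos : ∀ {i k} → 1 ≤ i → i ≤ n → i ≤ k → k < f i → 0 < rising k
  rising-pos {i} {k} a b c d = ≤-trans
    (≤-reflexive (sym (cong₂ (λ x y → ⟦ x ∧ y ⟧) (<⇒true (s≤s c)) (<⇒true d))))
    (∑-term n i a b)

  falling-pos : ∀ {j k} → 1 ≤ j → j ≤ n → k < j → f j ≤ k → 0 < falling k
  falling-pos {i} {k} a b c d = ≤-trans
    (≤-reflexive (sym (cong₂ (λ x y → ⟦ x ∧ y ⟧) (<⇒true c) (<⇒true (s≤s d)))))
    (∑-term n i a b)

  exchange-down : ∀ {i k} → 1 ≤ i → i ≤ n → i ≤ k → k < f i → ∃[ j ] (1 ≤ j × j ≤ n × k < j × f j ≤ k)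
  exchange-down a b c d = falling-witness
    (subst (0 <_) (rising≡falling _ (<⇒≤ (<-≤-trans d (f-≤n a b)))) (rising-pos a b c d))

  exchange-up : ∀ {j k} → 1 ≤ j → j ≤ n → k < j → f j ≤ k → ∃[ i ] (1 ≤ i × i ≤ n × i ≤ k × k < f i)
  exchange-up a b c d = rising-witness
    (subst (0 <_) (sym (rising≡falling _ (<⇒≤ (<-≤-trans c b)))) (falling-pos a b c d))

  -- If `f i ≤ i`, the arc of `j` falls across the cut at `i`, so some arc `l` rises across it. Then
  -- `l < i < j` carries a 321 pattern.
  inversion-exceeds : ∀ {i j} → 1 ≤ i → i < j → j ≤ n → f j < f i → i < f i
  inversion-exceeds {i} {j} 1≤i i<j j≤n fj<fi with <-≤-connex i (f i)
  ... | inj₁ p = p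
  ... | inj₂ fi≤i with exchange-up (≤-trans 1≤i (<⇒≤ i<j)) j≤n i<j (≤-trans (<⇒≤ fj<fi) fi≤i)
  ...   | l , 1≤l , l≤n , l≤i , i<fl with m≤n⇒m<n∨m≡n l≤i
  ...     | inj₂ refl = ⊥-elim (<⇒≱ i<fl fi≤i)
  ...     | inj₁ l<i  = ⊥-elim (avoids 1≤l l<i i<j j≤n (≤-<-trans fi≤i i<fl) fj<fi)

  -- Mirror image, at the cut `f j`: if `j ≤ f j`, the arc of `i` rises across it, some arc `l`
  -- falls across it, and `i < j < l` carries a 321 pattern.
  inversion-recedes : ∀ {i j} → 1 ≤ i → i < j → j ≤ n → f j < f i → f j < j
  inversion-recedes {i} {j} 1≤i i<j j≤n fj<fi with <-≤-connex (f j) j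
  ... | inj₁ p = p
  ... | inj₂ j≤fj with exchange-down 1≤i (<⇒≤ (<-≤-trans i<j j≤n)) (≤-trans (<⇒≤ i<j) j≤fj) fj<fi
  ...   | l , 1≤l , l≤n , fj<l , fl≤fj with m≤n⇒m<n∨m≡n fl≤fj
  ...     | inj₁ q = ⊥-elim (avoids 1≤i i<j (≤-<-trans j≤fj fj<l) l≤n fj<fi q)
  ...     | inj₂ q = ⊥-elim (<⇒≱ (≤-<-trans j≤fj fj<l)
        (≤-reflexive (injective 1≤l l≤n (≤-trans 1≤i (<⇒≤ i<j)) j≤n q)))

-- Row insertion

-- The gap condition in `bumps` makes `y` the least entry above `x`; the last two conditions say
-- that `R′` is `R` with `y` replaced by `x`, as sets.
data Inserted (x : ℕ) (R : List ℕ) : List ℕ × Maybe ℕ → Set where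
  appends : All (_≤ x) R → Inserted x R (R ++ (x ∷ []) , nothing)
  bumps   : ∀ {R′ y} → y ∈ R → x < y → (∀ {r} → r ∈ R → r ≤ x ⊎ y ≤ r) → AllPairs _<_ R′ →
            x ∈ R′ → (∀ {v} → v ∈ R′ → v ≡ x ⊎ (v ∈ R × v ≢ y)) → (∀ {v} → v ∈ R → v ≡ y ⊎ v ∈ R′) →
            Inserted x R (R′ , just y)

rowInsert-spec : ∀ x R → AllPairs _<_ R → x ∉ R → Inserted x R (rowInsert x R)
rowInsert-spec x []       _              _   = appends []
rowInsert-spec x (y ∷ ys) (y<ys ∷ sorted) x∉R with x <ᵇ y | compare< x y
... | true  | lt x<y = bumps (here refl) x<y
  (λ { (here refl) → inj₂ ≤-refl ; (there r∈) → inj₂ (<⇒≤ (All.lookup y<ys r∈)) })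
  (All.map (<-trans x<y) y<ys ∷ sorted)
  (here refl)
  (λ { (here refl) → inj₁ refl ; (there v∈) → inj₂ (there v∈ , λ { refl → <-irrefl refl (All.lookup y<ys v∈) }) })
  (λ { (here refl) → inj₁ refl ; (there v∈) → inj₂ (there v∈) })
... | false | ge y≤x with rowInsert x ys | rowInsert-spec x ys sorted (x∉R ∘ there)
...   | _ , nothing | appends ys≤x = appends (y≤x ∷ ys≤x)
...   | R′ , just z | bumps z∈ x<z gap sorted′ x∈ sound complete = bumps (there z∈) x<z
  (λ { (here refl) → inj₁ y≤x ; (there r∈) → gap r∈ })
  (All.tabulate (λ v∈ → case sound v∈ of λ
    { (inj₁ refl) → ≤∧≢⇒< y≤x (λ e → x∉R (here (sym e)))
    ; (inj₂ (v∈ys , _)) → All.lookup y<ys v∈ys }) ∷ sorted′)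
  (there x∈)
  (λ { (here refl) → inj₂ (here refl , λ { refl → <-irrefl refl (All.lookup y<ys z∈) })
     ; (there v∈) → case sound v∈ of λ { (inj₁ e) → inj₁ e ; (inj₂ (a , b)) → inj₂ (there a , b) } })
  (λ { (here refl) → inj₂ (here refl)
     ; (there v∈) → case complete v∈ of λ { (inj₁ e) → inj₁ e ; (inj₂ a) → inj₂ (there a) } })

rowInsert-append : ∀ y S → All (_< y) S → rowInsert y S ≡ (S ++ (y ∷ []) , nothing)
rowInsert-append y []      []        = refl
rowInsert-append y (z ∷ S) (z<y ∷ p) with y <ᵇ z | compare< y z
... | true  | lt q = ⊥-elim (<⇒≱ z<y (<⇒≤ q))
... | false | _ rewrite rowInsert-append y S p = refl

∷ʳ-AllPairs : ∀ {A : Set} {R : A → A → Set} {xs x} → AllPairs R xs → (∀ {y} → y ∈ xs → R y x) → AllPairs R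
      (xs ++ (x ∷ []))
∷ʳ-AllPairs ap h = AllPairs.++⁺ ap ([] ∷ []) (All.tabulate (λ y∈ → h y∈ ∷ []))

∈-∷ʳ⁻ : ∀ {A : Set} {v x : A} xs → v ∈ xs ++ (x ∷ []) → v ∈ xs ⊎ v ≡ x
∈-∷ʳ⁻ xs v∈ with ∈-++⁻ xs v∈
... | inj₁ p         = inj₁ p
... | inj₂ (here e)  = inj₂ e

∷ʳ-∈ : ∀ {A : Set} {x : A} xs → x ∈ xs ++ (x ∷ [])
∷ʳ-∈ xs = ∈-++⁺ʳ xs (here refl)

DistinctBy : {A : Set} → (A → ℕ) → List A → Set
DistinctBy g = AllPairs (λ e e′ → g e ≢ g e′)

distinctBy-∈ : ∀ {A : Set} {g : A → ℕ} {xs e e′} → DistinctBy g xs → e ∈ xs → e′ ∈ xs → g e ≡ g e′ → e ≡ e′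
distinctBy-∈ (p ∷ ps) (here refl) (here refl) q = refl
distinctBy-∈ (p ∷ ps) (here refl) (there e′∈) q = ⊥-elim (All.lookup p e′∈ q)
distinctBy-∈ (p ∷ ps) (there e∈)  (here refl) q = ⊥-elim (All.lookup p e∈ (sym q))
distinctBy-∈ (p ∷ ps) (there e∈)  (there e′∈) q = distinctBy-∈ ps e∈ e′∈ q

module Insertion {n : ℕ} {f : ℕ → ℕ} (av : Avoiding321 n f) where
  open Avoiding321 av
  open Permutation av

  -- An entry (i , s) of a history records that the insertion of f s bumps f i from the first row.
  record Bumping (t : ℕ) (M : List (ℕ × ℕ)) : Set where
    field
      valid    : ∀ {i s} → (i , s) ∈ M → 1 ≤ i × i < s × s ≤ t × f s < f i
      bumped!  : DistinctBy proj₁ M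
      bumping! : DistinctBy proj₂ M
      -- When `f s` arrives, a larger earlier `f i` has already left the first row, or else it
      -- competes to be bumped, and the least larger entry wins.
      greedy   : ∀ {i s} → 1 ≤ i → i < s → s ≤ t → f s < f i →
                 (∃[ s′ ] ((i , s′) ∈ M × s′ < s)) ⊎ (∃[ i′ ] ((i′ , s) ∈ M × f i′ ≤ f i))

  record FirstRow (t : ℕ) (M : List (ℕ × ℕ)) (R : List ℕ) : Set where
    field
      sorted   : AllPairs _<_ R
      sound    : ∀ {v} → v ∈ R → ∃[ i ] (1 ≤ i × i ≤ t × f i ≡ v × (∀ s → (i , s) ∉ M))
      complete : ∀ {i} → 1 ≤ i → i ≤ t → (∃[ s ] (i , s) ∈ M) ⊎ f i ∈ R

  module Step {t M R} (t<n : t < n) (B : Bumping t M) (F : FirstRow t M R) where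
    open Bumping B
    open FirstRow F

    private
      x = f (suc t)

    fresh : x ∉ R
    fresh x∈ with sound x∈
    ... | i , a , b , c , _ = <⇒≢ (s≤s b) (injective a (≤-trans b (<⇒≤ t<n)) z<s t<n c)

    step-append : All (_≤ x) R → Bumping (suc t) M × FirstRow (suc t) M (R ++ (x ∷ []))
    step-append R≤x = record
      { valid    = λ e∈ → case valid e∈ of λ { (a , b , c , d) → a , b , m≤n⇒m≤1+n c , d }
      ; bumped!  = bumped!
      ; bumping! = bumping!
      ; greedy   = greedy′
      } , record
      { sorted   = ∷ʳ-AllPairs sorted (λ r∈ → ≤∧≢⇒< (All.lookup R≤x r∈) λ { refl → fresh r∈ })
      ; sound    = sound′
      ; complete = complete′
      }
      where
      greedy′ : ∀ {i s} → 1 ≤ i → i < s → s ≤ suc t → f s < f i →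
                (∃[ s′ ] ((i , s′) ∈ M × s′ < s)) ⊎ (∃[ i′ ] ((i′ , s) ∈ M × f i′ ≤ f i))
      greedy′ {i} 1≤i i<s s≤ fs<fi with m≤n⇒m<n∨m≡n s≤
      ... | inj₁ s<  = greedy 1≤i i<s (s≤s⁻¹ s<) fs<fi
      ... | inj₂ refl with complete 1≤i (s≤s⁻¹ i<s)
      ...   | inj₁ (s′ , e∈) = inj₁ (s′ , e∈ , s≤s (proj₁ (proj₂ (proj₂ (valid e∈)))))
      ...   | inj₂ fi∈       = ⊥-elim (<⇒≱ fs<fi (All.lookup R≤x fi∈))
      sound′ : ∀ {v} → v ∈ R ++ (x ∷ []) → ∃[ i ] (1 ≤ i × i ≤ suc t × f i ≡ v × (∀ s → (i , s) ∉ M))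
      sound′ v∈ with ∈-∷ʳ⁻ R v∈
      ... | inj₁ v∈R = case sound v∈R of λ { (i , a , b , c , d) → i , a , m≤n⇒m≤1+n b , c , d }
      ... | inj₂ refl = suc t , z<s , ≤-refl , refl ,
        λ s e∈ → case valid e∈ of λ { (_ , a , b , _) → <⇒≱ a (m≤n⇒m≤1+n b) }
      complete′ : ∀ {i} → 1 ≤ i → i ≤ suc t → (∃[ s ] (i , s) ∈ M) ⊎ f i ∈ R ++ (x ∷ [])
      complete′ 1≤i i≤ with m≤n⇒m<n∨m≡n i≤
      ... | inj₂ refl = inj₂ (∷ʳ-∈ R)
      ... | inj₁ i<   = case complete 1≤i (s≤s⁻¹ i<) of λ { (inj₁ a) → inj₁ a ; (inj₂ b) → inj₂ (∈-++⁺ˡ b) }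

    module _ {R′ y} (y∈ : y ∈ R) (x<y : x < y) (gap : ∀ {r} → r ∈ R → r ≤ x ⊎ y ≤ r)
             (sorted′ : AllPairs _<_ R′) (x∈ : x ∈ R′)
             (sound-R′ : ∀ {v} → v ∈ R′ → v ≡ x ⊎ (v ∈ R × v ≢ y))
             (complete-R′ : ∀ {v} → v ∈ R → v ≡ y ⊎ v ∈ R′) where
      private
        i₀ = proj₁ (sound y∈)
        1≤i₀ : 1 ≤ i₀
        1≤i₀ = proj₁ (proj₂ (sound y∈))
        i₀≤t : i₀ ≤ t
        i₀≤t = proj₁ (proj₂ (proj₂ (sound y∈)))
        fi₀ : f i₀ ≡ y
        fi₀ = proj₁ (proj₂ (proj₂ (proj₂ (sound y∈))))
        i₀∉ : ∀ {s} → (i₀ , s) ∉ M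
        i₀∉ {s} = proj₂ (proj₂ (proj₂ (proj₂ (sound y∈)))) s
        M′ = M ++ ((i₀ , suc t) ∷ [])
        x<fi₀ : x < f i₀
        x<fi₀ = subst (x <_) (sym fi₀) x<y
        t≤n = <⇒≤ t<n

      -- A bumped z > y would form a 321 pattern with y, its bumper and x.
      second-row-below : All (_< y) (map (f ∘ proj₁) M)
      second-row-below = All.map⁺ (All.tabulate λ { {i , s} e∈ → below e∈ })
        where
        below : ∀ {i s} → (i , s) ∈ M → f i < y
        below {i} {s} e∈ with valid e∈
        ... | 1≤i , i<s , s≤t , fs<fi with <-cmp (f i) y
        ...   | tri< p _ _ = p
        ...   | tri≈ _ p _ = ⊥-elim (i₀∉ (subst (λ l → (l , s) ∈ M)
              (injective 1≤i (≤-trans (<⇒≤ (<-≤-trans i<s s≤t)) t≤n)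
                                1≤i₀ (≤-trans i₀≤t t≤n) (trans p (sym fi₀))) e∈))
        ...   | tri> _ _ y<fi with <-cmp i i₀
        ...     | tri≈ _ refl _ = ⊥-elim (i₀∉ e∈)
        ...     | tri< i<i₀ _ _ = ⊥-elim (avoids 1≤i i<i₀ (s≤s i₀≤t) t<n (subst (_< f i) (sym fi₀) y<fi) x<fi₀)
        ...     | tri> _ _ i₀<i with <-cmp (f s) y
        ...       | tri≈ _ p _ = ⊥-elim (<⇒≢ (<-trans i₀<i i<s) (injective 1≤i₀ (≤-trans i₀≤t t≤n)
                                   (≤-trans 1≤i (<⇒≤ i<s)) (≤-trans s≤t t≤n) (trans fi₀ (sym p))))
        ...       | tri> _ _ y<fs = ⊥-elim (avoids 1≤i i<s (s≤s s≤t) t<n fs<fi (<-trans x<y y<fs))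
        -- The remaining case: `y` was present when the smaller `f s` arrived and has never been
        -- bumped, so `f s` had to bump an entry `≤ y`; yet it bumped `f i > y`.
        ...       | tri< fs<y _ _ with greedy 1≤i₀ (<-trans i₀<i i<s) s≤t (subst (f s <_) (sym fi₀) fs<y)
        ...         | inj₁ (_ , e′∈ , _) = ⊥-elim (i₀∉ e′∈)
        ...         | inj₂ (i′ , e′∈ , fi′≤) with distinctBy-∈ bumping! e∈ e′∈ refl
        ...           | refl = ⊥-elim (<⇒≱ y<fi (≤-trans fi′≤ (≤-reflexive fi₀)))

      step-bump : ∃[ i ] (f i ≡ y × Bumping (suc t) (M ++ ((i , suc t) ∷ [])) × FirstRow (suc t)
            (M ++ ((i , suc t) ∷ [])) R′)
      step-bump = i₀ , fi₀ , record
        { valid    = valid′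
        ; bumped!  = ∷ʳ-AllPairs bumped! (λ { e∈ refl → i₀∉ e∈ })
        ; bumping! = ∷ʳ-AllPairs bumping! (λ e∈ e → <⇒≢ (s≤s (proj₁ (proj₂ (proj₂ (valid e∈))))) e)
        ; greedy   = greedy′
        } , record
        { sorted   = sorted′
        ; sound    = sound′
        ; complete = complete′
        }
        where
        valid′ : ∀ {i s} → (i , s) ∈ M′ → 1 ≤ i × i < s × s ≤ suc t × f s < f i
        valid′ e∈ with ∈-∷ʳ⁻ M e∈
        ... | inj₂ refl = 1≤i₀ , s≤s i₀≤t , ≤-refl , x<fi₀
        ... | inj₁ e∈M  = case valid e∈M of λ { (a , b , c , d) → a , b , m≤n⇒m≤1+n c , d }
        greedy′ : ∀ {i s} → 1 ≤ i → i < s → s ≤ suc t → f s < f i →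
                  (∃[ s′ ] ((i , s′) ∈ M′ × s′ < s)) ⊎ (∃[ i′ ] ((i′ , s) ∈ M′ × f i′ ≤ f i))
        greedy′ {i} 1≤i i<s s≤ fs<fi with m≤n⇒m<n∨m≡n s≤
        ... | inj₁ s< = case greedy 1≤i i<s (s≤s⁻¹ s<) fs<fi of λ
          { (inj₁ (s′ , a , b)) → inj₁ (s′ , ∈-++⁺ˡ a , b)
          ; (inj₂ (i′ , a , b)) → inj₂ (i′ , ∈-++⁺ˡ a , b) }
        ... | inj₂ refl with complete 1≤i (s≤s⁻¹ i<s)
        ...   | inj₁ (s′ , e∈) = inj₁ (s′ , ∈-++⁺ˡ e∈ , s≤s (proj₁ (proj₂ (proj₂ (valid e∈)))))
        ...   | inj₂ fi∈ with gap fi∈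
        ...     | inj₁ fi≤x = ⊥-elim (<⇒≱ fs<fi fi≤x)
        ...     | inj₂ y≤fi = inj₂ (i₀ , ∷ʳ-∈ M , subst (_≤ f i) (sym fi₀) y≤fi)
        sound′ : ∀ {v} → v ∈ R′ → ∃[ i ] (1 ≤ i × i ≤ suc t × f i ≡ v × (∀ s → (i , s) ∉ M′))
        sound′ v∈ with sound-R′ v∈
        ... | inj₁ refl = suc t , z<s , ≤-refl , refl , λ s e∈ → case valid′ e∈ of λ { (_ , a , b , _) → <⇒≱ a b }
        ... | inj₂ (v∈R , v≢y) with sound v∈R
        ...   | i , a , b , refl , d = i , a , m≤n⇒m≤1+n b , refl ,
          λ s e∈ → case ∈-∷ʳ⁻ M e∈ of λ { (inj₁ e∈M) → d s e∈M ; (inj₂ refl) → v≢y fi₀ }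
        complete′ : ∀ {i} → 1 ≤ i → i ≤ suc t → (∃[ s ] (i , s) ∈ M′) ⊎ f i ∈ R′
        complete′ 1≤i i≤ with m≤n⇒m<n∨m≡n i≤
        ... | inj₂ refl = inj₂ x∈
        ... | inj₁ i<   with complete 1≤i (s≤s⁻¹ i<)
        ...   | inj₁ (s , e∈) = inj₁ (s , ∈-++⁺ˡ e∈)
        ...   | inj₂ fi∈ with complete-R′ fi∈
        ...     | inj₂ fi∈R′ = inj₂ fi∈R′
        ...     | inj₁ e = inj₁ (suc t , subst (λ l → (l , suc t) ∈ M′)
                    (injective 1≤i₀ (≤-trans i₀≤t t≤n) 1≤i (≤-trans (s≤s⁻¹ i<) t≤n) (trans fi₀ (sym e))) (∷ʳ-∈ M))

  -- The second rows are the history in chronological order: bumped values in `P`, bumping positions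
  -- in `Q`. This is faithful because bumped values arrive in increasing order and are appended.
  data Tableaux : (P Q : List (List ℕ)) (R : List ℕ) (M : List (ℕ × ℕ)) → Set where
    no-row   : Tableaux [] [] [] []
    one-row  : ∀ {R U} → Tableaux (R ∷ []) (U ∷ []) R []
    two-rows : ∀ {R U M} → Tableaux (R ∷ map (f ∘ proj₁) M ∷ []) (U ∷ map proj₂ M ∷ []) R M

  Invariant : ℕ → List (List ℕ) → List (List ℕ) → Set
  Invariant t P Q = ∃[ R ] ∃[ M ] (Tableaux P Q R M × Bumping t M × FirstRow t M R)

  insert-step : ∀ {t P Q} → t < n → Invariant t P Q →
                Invariant (suc t) (proj₁ (insertT (f (suc t)) P))
                      (addAt (suc t) (proj₂ (insertT (f (suc t)) P)) Q)
  insert-step {t} t<n (R , M , no-row , B , F) =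
    _ , _ , one-row , Step.step-append t<n B F []
  insert-step {t} t<n (R , M , one-row , B , F)
    with rowInsert (f (suc t)) R | rowInsert-spec (f (suc t)) R (FirstRow.sorted F) (Step.fresh t<n B F)
  ... | _ , nothing | appends p = _ , _ , one-row , Step.step-append t<n B F p
  ... | _ , just y  | bumps a b c d e g h with Step.step-bump t<n B F a b c d e g h
  ...   | i , refl , B′ , F′ = _ , _ , two-rows , B′ , F′
  insert-step {t} t<n (R , M , two-rows , B , F)
    with rowInsert (f (suc t)) R | rowInsert-spec (f (suc t)) R (FirstRow.sorted F) (Step.fresh t<n B F)
  ... | _ , nothing | appends p = _ , _ , two-rows , Step.step-append t<n B F p
  ... | _ , just y  | bumps a b c d e g h with Step.step-bump t<n B F a b c d e g h
  ...   | i , refl , B′ , F′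
    rewrite rowInsert-append (f i) (map (f ∘ proj₁) M) (Step.second-row-below t<n B F a b c d e g h) =
    _ , _ , subst₂ (λ S T → Tableaux (_ ∷ S ∷ []) (_ ∷ T ∷ []) _ (M ++ ((i , suc t) ∷ [])))
              (map-++ (f ∘ proj₁) M _) (map-++ proj₂ M _) two-rows , B′ , F′

  rskFrom-invariant : ∀ xs {t P Q} → (∀ i → at xs (suc i) ≡ f (suc i + t)) → t + length xs ≡ n → Invariant t P Q →
    Invariant n (proj₁ (rskFrom (suc t) xs (P , Q))) (proj₂ (rskFrom (suc t) xs (P , Q)))
  rskFrom-invariant [] {t} h e inv = subst (λ t → Invariant t _ _) (trans (sym (+-identityʳ t)) e) inv
  rskFrom-invariant (x ∷ xs) {t} {P} {Q} h e inv with h 0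
  ... | refl = rskFrom-invariant xs {suc t} (λ i → trans (h (suc i)) (cong f (sym (+-suc (suc i) t)))) e′
        (insert-step t<n inv)
    where
    e′ : suc t + length xs ≡ n
    e′ = trans (sym (+-suc t (length xs))) e
    t<n : t < n
    t<n = ≤-trans (m≤m+n (suc t) (length xs)) (≤-reflexive e′)

-- Crossings of a permutation avoiding 321

∑-* : ∀ n c f → ∑ n (λ k → c * f k) ≡ c * ∑ n f
∑-* zero    c f = sym (*-zeroʳ c)
∑-* (suc n) c f = trans (cong (_+ c * f (suc n)) (∑-* n c f)) (sym (*-distribˡ-+ c (∑ n f) (f (suc n))))

∑-δ : ∀ n x → 1 ≤ x → ∑ n (λ k → ⟦ k ≡ᵇ x ⟧) ≡ ⟦ x <ᵇ suc n ⟧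
∑-δ n x 1≤x with x <ᵇ suc n | compare< x (suc n)
... | true  | lt p = trans (∑-single n x 1≤x (s≤s⁻¹ p) (λ k _ _ i≢j → cong ⟦_⟧ (≢⇒false i≢j)))
      (cong ⟦_⟧ (≡⇒true {x} refl))
... | false | ge p = ∑-0 n (λ k _ q → cong ⟦_⟧ (≢⇒false (<⇒≢ (≤-<-trans q p))))

elem⇒∈ : ∀ x xs → elem x xs ≡ true → x ∈ xs
elem⇒∈ x (y ∷ ys) e with x ≡ᵇ y | compare≡ x y
... | true  | eq p = here p
... | false | _    = there (elem⇒∈ x ys e)

∈⇒elem : ∀ x xs → x ∈ xs → elem x xs ≡ true
∈⇒elem x (y ∷ ys) x∈ with x ≡ᵇ y | compare≡ x y
∈⇒elem x (y ∷ ys) x∈         | true  | _    = refl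
∈⇒elem x (y ∷ ys) (here p)   | false | ne q = ⊥-elim (q p)
∈⇒elem x (y ∷ ys) (there x∈) | false | _    = ∈⇒elem x ys x∈

∉⇒elem : ∀ x xs → x ∉ xs → elem x xs ≡ false
∉⇒elem x xs x∉ with elem x xs in e
... | true  = ⊥-elim (x∉ (elem⇒∈ x xs e))
... | false = refl

module _ {A : Set} where

  ∑L-term : ∀ (f : A → ℕ) {x xs} → x ∈ xs → f x ≤ ∑L f xs
  ∑L-term f (here refl) = m≤m+n _ _
  ∑L-term f (there x∈)  = ≤-trans (∑L-term f x∈) (m≤n+m _ _)

  ∑L-0 : ∀ (f : A → ℕ) xs → (∀ {x} → x ∈ xs → f x ≡ 0) → ∑L f xs ≡ 0
  ∑L-0 f []       h = refl
  ∑L-0 f (x ∷ xs) h = cong₂ _+_ (h (here refl)) (∑L-0 f xs (h ∘ there))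

  -- Distinct keys turn membership into multiplicity one. This reads `p k` and `q k` as numbers of
  -- history entries.
  ∑-elem : ∀ (g : A → ℕ) xs n → DistinctBy g xs → (∀ {x} → x ∈ xs → 1 ≤ g x) →
           ∑ n (λ k → ⟦ elem k (map g xs) ⟧) ≡ ∑L (λ x → ⟦ g x <ᵇ suc n ⟧) xs
  ∑-elem g []       n _        _  = ∑-0 n (λ _ _ _ → refl)
  ∑-elem g (x ∷ xs) n (p ∷ ps) ≥1 = begin
    ∑ n (λ k → ⟦ (k ≡ᵇ g x) ∨ elem k (map g xs) ⟧)        ≡⟨ ∑-cong n (λ k _ _ → split k) ⟩
    ∑ n (λ k → ⟦ k ≡ᵇ g x ⟧ + ⟦ elem k (map g xs) ⟧)      ≡⟨ ∑-+ n _ _ ⟩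
    ∑ n (λ k → ⟦ k ≡ᵇ g x ⟧) + ∑ n (λ k → ⟦ elem k (map g xs) ⟧)
      ≡⟨ cong₂ _+_ (∑-δ n (g x) (≥1 (here refl))) (∑-elem g xs n ps (≥1 ∘ there)) ⟩
    ⟦ g x <ᵇ suc n ⟧ + ∑L (λ y → ⟦ g y <ᵇ suc n ⟧) xs     ∎
    where
    open ≡-Reasoning
    split : ∀ k → ⟦ (k ≡ᵇ g x) ∨ elem k (map g xs) ⟧ ≡ ⟦ k ≡ᵇ g x ⟧ + ⟦ elem k (map g xs) ⟧
    split k with k ≡ᵇ g x | compare≡ k (g x)
    ... | false | _ = refl
    ... | true  | eq refl = cong (λ b → 1 + ⟦ b ⟧) (sym (∉⇒elem (g x) (map g xs)
            (λ gx∈ → case ∈-map⁻ g gx∈ of λ { (y , y∈ , e) → All.lookup p y∈ e })))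

  module _ (n : ℕ) (g : A → ℕ) (φ : A → Bool) (ψ : ℕ → Bool) {xs : List A}
           (in-range : ∀ {x} → x ∈ xs → 1 ≤ g x × g x ≤ n) where
    private
      fibre : ℕ → ℕ
      fibre k = ∑L (λ x → ⟦ φ x ∧ (g x ≡ᵇ k) ⟧) xs

      ∑-fibre : ∑L (λ x → ⟦ φ x ⟧) xs ≡ ∑ n fibre
      ∑-fibre = sym (trans (∑L-∑ n (λ x k → ⟦ φ x ∧ (g x ≡ᵇ k) ⟧) xs) (∑L-cong xs λ {x} x∈ →
        trans (∑-single n (g x) (proj₁ (in-range x∈)) (proj₂ (in-range x∈))
                 (λ k _ _ i≢j → cong ⟦_⟧ (trans (cong (φ x ∧_) (≢⇒false (i≢j ∘ sym))) (∧-zeroʳ (φ x)))))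
              (cong ⟦_⟧ (absorb x))))
        where
        absorb : ∀ x → (φ x ∧ (g x ≡ᵇ g x)) ≡ φ x
        absorb x rewrite ≡⇒true {g x} refl with φ x
        ... | true  = refl
        ... | false = refl

      fibre≤1 : ∀ k ys → DistinctBy g ys → ∑L (λ x → ⟦ φ x ∧ (g x ≡ᵇ k) ⟧) ys ≤ 1
      fibre≤1 k []       _        = z≤n
      fibre≤1 k (y ∷ ys) (p ∷ ps) with φ y ∧ (g y ≡ᵇ k) in e
      ... | false = fibre≤1 k ys ps
      ... | true  = s≤s (≤-reflexive (∑L-0 _ ys (λ {x} x∈ → cong ⟦_⟧ (trans
                      (cong (φ x ∧_) (≢⇒false λ q → All.lookup p x∈ (trans (true⇒≡ (proj₂ (∧-true e))) (sym q))))
                      (∧-zeroʳ (φ x))))))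

    -- Grouping the entries by key leaves a termwise comparison: a fibre of `g` holds at most one
    -- marked entry, and none where `ψ` fails.
    ∑L-injection : DistinctBy g xs → (∀ {x} → x ∈ xs → φ x ≡ true → ψ (g x) ≡ true) →
                   ∑L (λ x → ⟦ φ x ⟧) xs ≤ ∑ n (λ k → ⟦ ψ k ⟧)
    ∑L-injection dist h = ≤-trans (≤-reflexive ∑-fibre) (∑-mono n λ k _ _ → bound k)
      where
      bound : ∀ k → fibre k ≤ ⟦ ψ k ⟧
      bound k with ψ k in e
      ... | true  = fibre≤1 k xs dist
      ... | false = ≤-reflexive (∑L-0 _ xs (λ {x} x∈ → cong ⟦_⟧ (vanish x x∈)))
        where
        vanish : ∀ x → x ∈ xs → (φ x ∧ (g x ≡ᵇ k)) ≡ false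
        vanish x x∈ with φ x in e₁ | g x ≡ᵇ k | compare≡ (g x) k
        ... | false | _     | _       = refl
        ... | true  | false | _       = refl
        ... | true  | true  | eq refl = trans (sym (h x∈ e₁)) e

    ∑L-surjection : (∀ k → 1 ≤ k → k ≤ n → ψ k ≡ true → ∃[ x ] (x ∈ xs × φ x ≡ true × g x ≡ k)) →
                    ∑ n (λ k → ⟦ ψ k ⟧) ≤ ∑L (λ x → ⟦ φ x ⟧) xs
    ∑L-surjection h = ≤-trans (∑-mono n bound) (≤-reflexive (sym ∑-fibre))
      where
      bound : ∀ k → 1 ≤ k → k ≤ n → ⟦ ψ k ⟧ ≤ fibre k
      bound k 1≤k k≤n with ψ k in e
      ... | false = z≤n
      ... | true with h k 1≤k k≤n e
      ...   | x , x∈ , φx , refl = ≤-trans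
              (≤-reflexive (sym (cong₂ (λ b c → ⟦ b ∧ c ⟧) φx (≡⇒true {g x} refl))))
              (∑L-term (λ y → ⟦ φ y ∧ (g y ≡ᵇ g x) ⟧) x∈)

module Statistics {n : ℕ} {f : ℕ → ℕ} (av : Avoiding321 n f) where
  open Avoiding321 av
  open Permutation av

  ≤∨> : ∀ {i j} → 1 ≤ i → i < j → j ≤ n → f i < f j ⊎ f j < f i
  ≤∨> {i} {j} a b c with <-cmp (f i) (f j)
  ... | tri< p _ _ = inj₁ p
  ... | tri> _ _ p = inj₂ p
  ... | tri≈ _ p _ = ⊥-elim (<⇒≢ b (injective a (<⇒≤ (<-≤-trans b c)) (≤-trans a (<⇒≤ b)) c p))

  upper lower : ℕ → ℕ → Bool
  upper i j = (i <ᵇ j) ∧ (j <ᵇ f i) ∧ (f i <ᵇ f j)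
  lower i j = (f i <ᵇ f j) ∧ (f j <ᵇ suc i) ∧ (i <ᵇ j)

  crossing-split : ∀ i j → ⟦ upper i j ∨ lower i j ⟧ ≡ ⟦ upper i j ⟧ + ⟦ lower i j ⟧
  crossing-split i j with upper i j in e₁ | lower i j in e₂
  ... | false | _     = refl
  ... | true  | false = refl
  ... | true  | true  with ∧-true {i <ᵇ j} e₁ | ∧-true {f i <ᵇ f j} e₂
  ...   | _ , e₃ | e₄ , e₅ with ∧-true {j <ᵇ f i} e₃ | ∧-true {f j <ᵇ suc i} e₅
  ...     | j<fi , _ | fj≤i , i<j = ⊥-elim (<-irrefl refl (<-trans (<-trans (true⇒< {i} i<j) (true⇒< {j} j<fi))
              (<-≤-trans (true⇒< {f i} e₄) (s≤s⁻¹ (true⇒< {f j} fj≤i)))))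

  -- Over an excedance `j`, every arc from some `i < j` to a value above `j` makes an upper
  -- crossing: `f i > f j` would be an inversion and `j` would recede. The arc of `j` is itself
  -- counted on the right, hence the diagonal term.
  upper-count : ∀ i j → 1 ≤ i → i ≤ n → 1 ≤ j → j ≤ n →
    ⟦ upper i j ⟧ + ⟦ (i ≡ᵇ j) ∧ (j <ᵇ f j) ⟧ ≡ ⟦ j <ᵇ f j ⟧ * ⟦ (i <ᵇ suc j) ∧ (j <ᵇ f i) ⟧
  upper-count i j 1≤i i≤n 1≤j j≤n with <-cmp i j
  ... | tri≈ _ refl _ rewrite ≥⇒false {i} {i} ≤-refl | ≡⇒true {i} refl | <⇒true {i} {suc i} ≤-refl with i <ᵇ f i
  ...   | true  = refl
  ...   | false = refl
  upper-count i j 1≤i i≤n 1≤j j≤n | tri> _ i≢j j<i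
    rewrite ≥⇒false {i} {j} (<⇒≤ j<i) | ≢⇒false i≢j | ≥⇒false {i} {suc j} j<i = sym (*-zeroʳ ⟦ j <ᵇ f j ⟧)
  upper-count i j 1≤i i≤n 1≤j j≤n | tri< i<j i≢j _
    rewrite <⇒true i<j | ≢⇒false i≢j | <⇒true {i} {suc j} (m≤n⇒m≤1+n i<j)
    with j <ᵇ f i | compare< j (f i) | f i <ᵇ f j | compare< (f i) (f j) | j <ᵇ f j | compare< j (f j)
  ... | true  | _    | true  | _    | true  | _    = refl
  ... | false | _    | _     | _    | true  | _    = refl
  ... | false | _    | _     | _    | false | _    = refl
  ... | true  | _    | false | _    | false | _    = refl
  ... | true  | lt p | true  | lt q | false | ge s = ⊥-elim (<⇒≱ (<-trans p q) s)
  ... | true  | lt p | false | ge q | true  | lt s with ≤∨> 1≤i i<j j≤n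
  ...   | inj₁ w = ⊥-elim (<⇒≱ w q)
  ...   | inj₂ w = ⊥-elim (<⇒≱ s (<⇒≤ (inversion-recedes 1≤i i<j j≤n w)))

  -- When `f i ≤ i`, every `j > i` with `f j ≤ i` makes a lower crossing, since `f j < f i` would
  -- force `i` to be an excedance.
  lower-count : ∀ i j → 1 ≤ i → i ≤ n → 1 ≤ j → j ≤ n →
    ⟦ lower i j ⟧ ≡ ⟦ f i <ᵇ suc i ⟧ * ⟦ (i <ᵇ j) ∧ (f j <ᵇ suc i) ⟧
  lower-count i j 1≤i i≤n 1≤j j≤n with i <ᵇ j | compare< i j
  ... | false | _ with f i <ᵇ f j | f j <ᵇ suc i
  ...   | true  | true  = sym (*-zeroʳ ⟦ f i <ᵇ suc i ⟧)
  ...   | true  | false = sym (*-zeroʳ ⟦ f i <ᵇ suc i ⟧)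
  ...   | false | _     = sym (*-zeroʳ ⟦ f i <ᵇ suc i ⟧)
  lower-count i j 1≤i i≤n 1≤j j≤n | true | lt i<j
    with f i <ᵇ f j | compare< (f i) (f j) | f j <ᵇ suc i | compare< (f j) (suc i) | f i <ᵇ suc i | compare<
          (f i) (suc i)
  ... | true  | _    | true  | _    | true  | _    = refl
  ... | true  | _    | false | _    | true  | _    = refl
  ... | true  | _    | false | _    | false | _    = refl
  ... | false | _    | false | _    | true  | _    = refl
  ... | false | _    | _     | _    | false | _    = refl
  ... | true  | lt p | true  | lt q | false | ge s = ⊥-elim (<⇒≱ (<-trans p q) s)
  ... | false | ge p | true  | lt q | true  | lt s with ≤∨> 1≤i i<j j≤n
  ...   | inj₁ w = ⊥-elim (<⇒≱ w p)
  ...   | inj₂ w = ⊥-elim (<⇒≱ (inversion-exceeds 1≤i i<j j≤n w) (s≤s⁻¹ s))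

  exceeds : ℕ → ℕ
  exceeds j = ⟦ j <ᵇ f j ⟧

  upper-sum : ∀ j → 1 ≤ j → j ≤ n → ∑ n (λ i → ⟦ upper i j ⟧) + exceeds j ≡ exceeds j * rising j
  upper-sum j 1≤j j≤n = begin
    ∑ n (λ i → ⟦ upper i j ⟧) + exceeds j
      ≡⟨ cong (∑ n (λ i → ⟦ upper i j ⟧) +_) (sym diagonal) ⟩
    ∑ n (λ i → ⟦ upper i j ⟧) + ∑ n (λ i → ⟦ (i ≡ᵇ j) ∧ (j <ᵇ f j) ⟧)
      ≡⟨ ∑-+ n _ _ ⟨
    ∑ n (λ i → ⟦ upper i j ⟧ + ⟦ (i ≡ᵇ j) ∧ (j <ᵇ f j) ⟧)
      ≡⟨ ∑-cong n (λ i a b → upper-count i j a b 1≤j j≤n) ⟩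
    ∑ n (λ i → exceeds j * ⟦ (i <ᵇ suc j) ∧ (j <ᵇ f i) ⟧)
      ≡⟨ ∑-* n (exceeds j) _ ⟩
    exceeds j * rising j ∎
    where
    open ≡-Reasoning
    diagonal : ∑ n (λ i → ⟦ (i ≡ᵇ j) ∧ (j <ᵇ f j) ⟧) ≡ exceeds j
    diagonal = trans (∑-single n j 1≤j j≤n (λ k _ _ i≢j → cong (λ b → ⟦ b ∧ (j <ᵇ f j) ⟧) (≢⇒false i≢j)))
                     (cong (λ b → ⟦ b ∧ (j <ᵇ f j) ⟧) (≡⇒true {j} refl))

  -- Each cut `k` is charged once. If `k` is an excedance, `rising k` counts the upper crossings
  -- with second index `k` and `k` itself; otherwise `rising k = falling k` counts the lower
  -- crossings with first index `k`.
  crossings+excedances : ∑ n (λ i → ∑ n (λ j → ⟦ upper i j ∨ lower i j ⟧)) + ∑ n exceeds ≡ ∑ n rising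
  crossings+excedances = begin
    ∑ n (λ i → ∑ n (λ j → ⟦ upper i j ∨ lower i j ⟧)) + ∑ n exceeds
      ≡⟨ cong (_+ ∑ n exceeds) (trans (∑-cong n (λ i _ _ → trans (∑-cong n (λ j _ _ → crossing-split i j))
            (∑-+ n _ _))) (∑-+ n _ _)) ⟩
    ∑ n (λ i → ∑ n (λ j → ⟦ upper i j ⟧)) + ∑ n (λ i → ∑ n (λ j → ⟦ lower i j ⟧)) + ∑ n exceeds
      ≡⟨ cong₂ (λ a b → a + b + ∑ n exceeds) (∑-swap n n _) (∑-cong n lower-sum) ⟩
    ∑ n (λ j → ∑ n (λ i → ⟦ upper i j ⟧)) + ∑ n (λ i → ⟦ f i <ᵇ suc i ⟧ * rising i) + ∑ n exceeds
      ≡⟨ rotate (∑ n (λ j → ∑ n (λ i → ⟦ upper i j ⟧))) _ (∑ n exceeds) ⟩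
    (∑ n (λ j → ∑ n (λ i → ⟦ upper i j ⟧)) + ∑ n exceeds) + ∑ n (λ i → ⟦ f i <ᵇ suc i ⟧ * rising i)
      ≡⟨ cong (_+ ∑ n (λ i → ⟦ f i <ᵇ suc i ⟧ * rising i)) (trans (sym (∑-+ n _ _)) (∑-cong n upper-sum)) ⟩
    ∑ n (λ j → exceeds j * rising j) + ∑ n (λ i → ⟦ f i <ᵇ suc i ⟧ * rising i)
      ≡⟨ trans (sym (∑-+ n _ _)) (∑-cong n (λ i _ _ → complementary i)) ⟩
    ∑ n rising ∎
    where
    open ≡-Reasoning
    rotate : ∀ a b c → a + b + c ≡ a + c + b
    rotate = solve-∀
    lower-sum : ∀ i → 1 ≤ i → i ≤ n → ∑ n (λ j → ⟦ lower i j ⟧) ≡ ⟦ f i <ᵇ suc i ⟧ * rising i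
    lower-sum i 1≤i i≤n = trans (∑-cong n (λ j a b → lower-count i j 1≤i i≤n a b))
      (trans (∑-* n ⟦ f i <ᵇ suc i ⟧ _) (cong (⟦ f i <ᵇ suc i ⟧ *_) (sym (rising≡falling i i≤n))))
    complementary : ∀ i → exceeds i * rising i + ⟦ f i <ᵇ suc i ⟧ * rising i ≡ rising i
    complementary i with i <ᵇ f i | compare< i (f i) | f i <ᵇ suc i | compare< (f i) (suc i)
    ... | true  | _    | false | _    = trans (+-identityʳ _) (+-identityʳ _)
    ... | false | _    | true  | _    = +-identityʳ _
    ... | true  | lt p | true  | lt q = ⊥-elim (<⇒≱ p (s≤s⁻¹ q))
    ... | false | ge p | false | ge q = ⊥-elim (<⇒≱ q p)

  -- The indicator that `v` is an excedance value, as a sum over positions so that the inverse of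
  -- `f` need not be named.
  exceeded : ℕ → ℕ
  exceeded v = ∑ n (λ i → ⟦ (f i ≡ᵇ v) ∧ (i <ᵇ v) ⟧)

  exceeded-at : ∀ {i} → 1 ≤ i → i ≤ n → exceeded (f i) ≡ exceeds i
  exceeded-at {i} 1≤i i≤n = trans
    (∑-single n i 1≤i i≤n (λ k a b i≢j → cong (λ c → ⟦ c ∧ (k <ᵇ f i) ⟧) (≢⇒false (i≢j ∘ injective a b 1≤i i≤n))))
    (cong (λ c → ⟦ c ∧ (i <ᵇ f i) ⟧) (≡⇒true {f i} refl))

  ∑-exceeded : ∑ n exceeded ≡ ∑ n exceeds
  ∑-exceeded = trans (sym (reindex exceeded)) (∑-cong n (λ i → exceeded-at))

  -- Moving the cut past `suc k` loses the rising arc that ends there and gains the one that starts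
  -- there.
  rising-suc : ∀ k → suc k ≤ n → rising (suc k) + exceeded (suc k) ≡ rising k + exceeds (suc k)
  rising-suc k k<n = begin
    rising (suc k) + exceeded (suc k)
      ≡⟨ ∑-+ n _ _ ⟨
    ∑ n (λ i → ⟦ (i <ᵇ suc (suc k)) ∧ (suc k <ᵇ f i) ⟧ + ⟦ (f i ≡ᵇ suc k) ∧ (i <ᵇ suc k) ⟧)
      ≡⟨ ∑-cong n (λ i _ _ → termwise i) ⟩
    ∑ n (λ i → ⟦ (i <ᵇ suc k) ∧ (k <ᵇ f i) ⟧ + ⟦ (i ≡ᵇ suc k) ∧ (suc k <ᵇ f i) ⟧)
      ≡⟨ ∑-+ n _ _ ⟩
    rising k + ∑ n (λ i → ⟦ (i ≡ᵇ suc k) ∧ (suc k <ᵇ f i) ⟧)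
      ≡⟨ cong (rising k +_) (trans (∑-single n (suc k) z<s k<n
           (λ i _ _ i≢j → cong (λ b → ⟦ b ∧ (suc k <ᵇ f i) ⟧) (≢⇒false i≢j)))
           (cong (λ b → ⟦ b ∧ (suc k <ᵇ f (suc k)) ⟧) (≡⇒true {k} refl))) ⟩
    rising k + exceeds (suc k) ∎
    where
    open ≡-Reasoning
    termwise : ∀ i → ⟦ (i <ᵇ suc (suc k)) ∧ (suc k <ᵇ f i) ⟧ + ⟦ (f i ≡ᵇ suc k) ∧ (i <ᵇ suc k) ⟧
                   ≡ ⟦ (i <ᵇ suc k) ∧ (k <ᵇ f i) ⟧ + ⟦ (i ≡ᵇ suc k) ∧ (suc k <ᵇ f i) ⟧
    termwise i with <-cmp i (suc k)
    ... | tri≈ _ refl _ rewrite <⇒true {k} {suc k} ≤-refl | ≥⇒false {k} {k} ≤-refl | ≡⇒true {k} refl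
                              | ∧-zeroʳ (f (suc k) ≡ᵇ suc k) = +-identityʳ _
    ... | tri> _ i≢j k<i rewrite ≥⇒false {i} {suc (suc k)} k<i | ≥⇒false {i} {suc k} (<⇒≤ k<i) | ≢⇒false i≢j
                              | ∧-zeroʳ (f i ≡ᵇ suc k) = refl
    ... | tri< i<k i≢j _ rewrite <⇒true {i} {suc (suc k)} (m≤n⇒m≤1+n i<k) | <⇒true i<k | ≢⇒false i≢j
          with <-cmp (f i) (suc k)
    ...   | tri≈ _ e _ rewrite e | ≥⇒false {k} {k} ≤-refl | ≡⇒true {k} refl | <⇒true {k} {suc k} ≤-refl = refl
    ...   | tri< p q _ rewrite ≢⇒false q | ≥⇒false {suc k} {f i} (<⇒≤ p) | ≥⇒false {k} {f i} (s≤s⁻¹ p) = refl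
    ...   | tri> _ q p rewrite ≢⇒false q | <⇒true p | <⇒true {k} {f i} (<⇒≤ p) = refl

  rising-n : rising n ≡ 0
  rising-n = ∑-0 n (λ i a b → trans (cong (λ c → ⟦ (i <ᵇ suc n) ∧ c ⟧) (≥⇒false (f-≤n a b)))
        (cong ⟦_⟧ (∧-zeroʳ (i <ᵇ suc n))))

-- One step k ↦ k+1 of a profile: P and Q tell whether k+1 is a bumped value, a bumping position;
-- e, v, x tell whether it is an excedance position, an excedance value, a fixed point;
-- p, q, r count the bumped values ≤ k, the bumping positions ≤ k, and the arcs i ≤ k < f i.
data Step (P Q e v x p q r : ℕ) : Set where
  passive  : v ≡ P → Q + e ≡ 1 → x ≡ 0 → Step P Q e v x p q r
  value    : v ≡ 1 → P ≡ 0 → Q + e ≡ 1 → x ≡ 0 → 1 ≤ r → p ≡ q + r → Step P Q e v x p q r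
  position : v ≡ P → Q ≡ 0 → e ≡ 0 → x ≡ 0 → 1 ≤ r → q ≡ p + r → Step P Q e v x p q r
  fixed    : v ≡ 0 → P ≡ 0 → Q ≡ 0 → e ≡ 0 → x ≡ 1 → r ≡ 0 → Step P Q e v x p q r

-- The interface between `σ` and the path: below, `P` and `Q` are identified with the pops of the
-- two half-paths, and everything about strands is derived from these six fields.
record Profile (n : ℕ) (P Q e v x r : ℕ → ℕ) : Set where
  field
    r-zero : r 0 ≡ 0
    r-end  : r n ≡ 0
    r-suc  : ∀ k → k < n → r (suc k) + v (suc k) ≡ r k + e (suc k)
    p≤q+r  : ∀ k → k ≤ n → ∑ k P ≤ ∑ k Q + r k
    q≤p+r  : ∀ k → k ≤ n → ∑ k Q ≤ ∑ k P + r k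
    step   : ∀ k → k < n → Step (P (suc k)) (Q (suc k)) (e (suc k)) (v (suc k)) (x (suc k)) (∑ k P) (∑ k Q) (r k)

-- The profile of a bumping history.

module HistoryProfile {n : ℕ} {f : ℕ → ℕ} (av : Avoiding321 n f) {M : List (ℕ × ℕ)}
                      (B : Insertion.Bumping av n M) where
  open Avoiding321 av
  open Permutation av
  open Insertion av
  open Statistics av
  open Bumping B

  bumped bumping fixes : ℕ → ℕ
  bumped  k = ⟦ elem k (map (f ∘ proj₁) M) ⟧
  bumping k = ⟦ elem k (map proj₂ M) ⟧
  fixes   k = ⟦ f k ≡ᵇ k ⟧

  private
    1≤bumped : ∀ {i s} → (i , s) ∈ M → 1 ≤ i
    1≤bumped e∈ = proj₁ (valid e∈)
    earlier : ∀ {i s} → (i , s) ∈ M → i < s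
    earlier e∈ = proj₁ (proj₂ (valid e∈))
    s≤n : ∀ {i s} → (i , s) ∈ M → s ≤ n
    s≤n e∈ = proj₁ (proj₂ (proj₂ (valid e∈)))
    larger : ∀ {i s} → (i , s) ∈ M → f s < f i
    larger e∈ = proj₂ (proj₂ (proj₂ (valid e∈)))
    bumped≤n : ∀ {i s} → (i , s) ∈ M → i ≤ n
    bumped≤n e∈ = <⇒≤ (<-≤-trans (earlier e∈) (s≤n e∈))
    1≤bumping : ∀ {i s} → (i , s) ∈ M → 1 ≤ s
    1≤bumping e∈ = ≤-trans (1≤bumped e∈) (<⇒≤ (earlier e∈))
    rises : ∀ {i s} → (i , s) ∈ M → i < f i
    rises e∈ = inversion-exceeds (1≤bumped e∈) (earlier e∈) (s≤n e∈) (larger e∈)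
    falls : ∀ {i s} → (i , s) ∈ M → f s < s
    falls e∈ = inversion-recedes (1≤bumped e∈) (earlier e∈) (s≤n e∈) (larger e∈)

    values! : ∀ {M′} → (∀ {e} → e ∈ M′ → e ∈ M) → DistinctBy proj₁ M′ → DistinctBy (f ∘ proj₁) M′
    values! sub []       = []
    values! sub (p ∷ ps) = All.tabulate (λ e∈ q → All.lookup p e∈ (injective
        (1≤bumped (sub (here refl))) (bumped≤n (sub (here refl)))
        (1≤bumped (sub (there e∈))) (bumped≤n (sub (there e∈))) q))
      ∷ values! (sub ∘ there) ps

  lateᵇ earlyᵇ : ℕ → ℕ × ℕ → Bool
  lateᵇ  k e = (f (proj₁ e) <ᵇ suc k) ∧ (k <ᵇ proj₂ e)
  earlyᵇ k e = (proj₂ e <ᵇ suc k) ∧ (k <ᵇ f (proj₁ e))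

  late early : ℕ → ℕ
  late  k = ∑L (λ e → ⟦ lateᵇ k e ⟧) M
  early k = ∑L (λ e → ⟦ earlyᵇ k e ⟧) M

  -- An entry whose value and bumping position lie on the same side of the cut `k` does not affect
  -- `p k − q k`; only `late k − early k` remains.
  balance : ∀ k → ∑ k bumped + early k ≡ ∑ k bumping + late k
  balance k = begin
    ∑ k bumped + early k
      ≡⟨ cong (_+ early k) (∑-elem (f ∘ proj₁) M k (values! (λ e∈ → e∈) bumped!)
            (λ e∈ → f-≥1 (1≤bumped e∈) (bumped≤n e∈))) ⟩
    ∑L (λ e → ⟦ f (proj₁ e) <ᵇ suc k ⟧) M + early k
      ≡⟨ ∑L-+ _ _ M ⟨
    ∑L (λ e → ⟦ f (proj₁ e) <ᵇ suc k ⟧ + ⟦ earlyᵇ k e ⟧) M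
      ≡⟨ ∑L-cong M (λ {e} _ → termwise (f (proj₁ e)) (proj₂ e)) ⟩
    ∑L (λ e → ⟦ proj₂ e <ᵇ suc k ⟧ + ⟦ lateᵇ k e ⟧) M
      ≡⟨ ∑L-+ _ _ M ⟩
    ∑L (λ e → ⟦ proj₂ e <ᵇ suc k ⟧) M + late k
      ≡⟨ cong (_+ late k) (∑-elem proj₂ M k bumping! 1≤bumping) ⟨
    ∑ k bumping + late k ∎
    where
    open ≡-Reasoning
    termwise : ∀ a b → ⟦ a <ᵇ suc k ⟧ + ⟦ (b <ᵇ suc k) ∧ (k <ᵇ a) ⟧ ≡ ⟦ b <ᵇ suc k ⟧ + ⟦ (a <ᵇ suc k) ∧ (k <ᵇ b) ⟧
    termwise a b with a <ᵇ suc k | compare< a (suc k) | k <ᵇ a | compare< k a | b <ᵇ suc k | compare< b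
          (suc k) | k <ᵇ b | compare< k b
    ... | true  | lt p | true  | lt q | _     | _    | _     | _    = ⊥-elim (<⇒≱ q (s≤s⁻¹ p))
    ... | false | ge p | false | ge q | _     | _    | _     | _    = ⊥-elim (<⇒≱ p q)
    ... | _     | _    | _     | _    | true  | lt p | true  | lt q = ⊥-elim (<⇒≱ q (s≤s⁻¹ p))
    ... | _     | _    | _     | _    | false | ge p | false | ge q = ⊥-elim (<⇒≱ p q)
    ... | true  | _    | false | _    | true  | _    | false | _    = refl
    ... | true  | _    | false | _    | false | _    | true  | _    = refl
    ... | false | _    | true  | _    | true  | _    | false | _    = refl
    ... | false | _    | true  | _    | false | _    | true  | _    = refl

  -- The bumper `s` of a late entry has `f s < f i ≤ k < s`, a falling arc; dually, an early entry
  -- has `i < s ≤ k < f i`, a rising one.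
  late≤rising : ∀ k → k ≤ n → late k ≤ rising k
  late≤rising k k≤n = ≤-trans
    (∑L-injection n proj₂ (lateᵇ k) (λ j → (k <ᵇ j) ∧ (f j <ᵇ suc k)) (λ e∈ → 1≤bumping e∈ , s≤n e∈) bumping!
      (λ {e} e∈ h → case ∧-true {f (proj₁ e) <ᵇ suc k} h of λ
        { (a , b) → cong₂ _∧_ b (<⇒true (<-trans (larger e∈) (true⇒< {f (proj₁ e)} {suc k} a))) }))
    (≤-reflexive (sym (rising≡falling k k≤n)))

  early≤rising : ∀ k → early k ≤ rising k
  early≤rising k = ∑L-injection n proj₁ (earlyᵇ k) (λ i → (i <ᵇ suc k) ∧ (k <ᵇ f i))
        (λ e∈ → 1≤bumped e∈ , bumped≤n e∈) bumped!
      (λ {e} e∈ h → case ∧-true {proj₂ e <ᵇ suc k} h of λ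
        { (a , b) → cong₂ _∧_ (<⇒true (<-trans (earlier e∈) (true⇒< {proj₂ e} {suc k} a))) b })

  -- As `f i` is never bumped, each falling arc `j` at the cut must by `greedy` bump something below
  -- `suc k`, so all falling arcs are late. There is no early entry `(i′ , s)`: if `i < s`, then `s`
  -- would bump an entry `≤ f i` instead; if `s < i`, then `i` would recede by its inversion with
  -- `i′`; and `s = i` contradicts `falls`.
  value-step : ∀ {k i} → k ≤ n → 1 ≤ i → i ≤ k → f i ≡ suc k → (∀ s → (i , s) ∉ M) → ∑ k bumped ≡ ∑ k
        bumping + rising k
  value-step {k} {i} k≤n 1≤i i≤k fi≡ i∉ = begin
    ∑ k bumped            ≡⟨ sym (+-identityʳ _) ⟩
    ∑ k bumped + 0        ≡⟨ cong (∑ k bumped +_) (sym no-early) ⟩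
    ∑ k bumped + early k  ≡⟨ balance k ⟩
    ∑ k bumping + late k  ≡⟨ cong (∑ k bumping +_) (≤-antisym (late≤rising k k≤n) rising≤late) ⟩
    ∑ k bumping + rising k ∎
    where
    open ≡-Reasoning
    i≤n = ≤-trans i≤k k≤n
    rising≤late : rising k ≤ late k
    rising≤late = ≤-trans (≤-reflexive (rising≡falling k k≤n))
      (∑L-surjection n proj₂ (lateᵇ k) (λ j → (k <ᵇ j) ∧ (f j <ᵇ suc k)) (λ e∈ → 1≤bumping e∈ , s≤n e∈)
            late-witness)
      where
      late-witness : ∀ j → 1 ≤ j → j ≤ n → ((k <ᵇ j) ∧ (f j <ᵇ suc k)) ≡ true → ∃[ e ]
            (e ∈ M × lateᵇ k e ≡ true × proj₂ e ≡ j)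
      late-witness j 1≤j j≤n h with ∧-true {k <ᵇ j} h
      ... | a , b with greedy 1≤i (≤-<-trans i≤k (true⇒< {k} a)) j≤n
            (<-≤-trans (true⇒< {f j} b) (≤-reflexive (sym fi≡)))
      ...   | inj₁ (s , e∈ , _) = ⊥-elim (i∉ s e∈)
      ...   | inj₂ (i′ , e∈ , le) = (i′ , j) , e∈ , cong₂ _∧_
            (<⇒true (≤∧≢⇒< (≤-trans le (≤-reflexive fi≡)) unequal)) a , refl
        where
        unequal : f i′ ≢ suc k
        unequal q with injective (1≤bumped e∈) (bumped≤n e∈) 1≤i i≤n (trans q (sym fi≡))
        ... | refl = i∉ j e∈
    no-early : early k ≡ 0
    no-early = ∑L-0 _ M (λ {e} e∈ → cong ⟦_⟧ (vanish e e∈))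
      where
      vanish : ∀ e → e ∈ M → earlyᵇ k e ≡ false
      vanish (i′ , s) e∈ with earlyᵇ k (i′ , s) in h
      ... | false = refl
      ... | true with ∧-true {s <ᵇ suc k} h
      ...   | a , b with s≤s⁻¹ (true⇒< {s} a) | true⇒< {k} b | <-cmp i s
      ...     | s≤k | k<fi′ | tri≈ _ refl _ = ⊥-elim (i∉′ fs<)
        where
        fs< : f i < i
        fs< = falls e∈
        i∉′ : ¬ f i < i
        i∉′ p = <⇒≱ p (≤-trans i≤k (≤-trans (n≤1+n k) (≤-reflexive (sym fi≡))))
      ...     | s≤k | k<fi′ | tri< i<s _ _ with greedy 1≤i i<s (≤-trans s≤k k≤n)
                   (<-≤-trans (falls e∈) (≤-trans s≤k (≤-trans (n≤1+n k) (≤-reflexive (sym fi≡)))))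
      ...       | inj₁ (s′ , e′∈ , _) = ⊥-elim (i∉ s′ e′∈)
      ...       | inj₂ (i″ , e′∈ , le) with distinctBy-∈ bumping! e∈ e′∈ refl
      ...         | refl = ⊥-elim (i∉ s (subst (λ l → (l , s) ∈ M)
                     (injective (1≤bumped e∈) (bumped≤n e∈) 1≤i i≤n
                           (≤-antisym le (≤-trans (≤-reflexive fi≡) k<fi′))) e∈))
      vanish (i′ , s) e∈ | true | a , b | s≤k | k<fi′ | tri> _ _ s<i = ⊥-elim
            (<⇒≱ fi<i (≤-trans i≤k (≤-trans (n≤1+n k) (≤-reflexive (sym fi≡)))))
        where
        i′≢i : f i′ ≢ suc k
        i′≢i q with injective (1≤bumped e∈) (bumped≤n e∈) 1≤i i≤n (trans q (sym fi≡))
        ... | refl = i∉ s e∈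
        fi<i : f i < i
        fi<i = inversion-recedes (1≤bumped e∈) (<-trans (earlier e∈) s<i) i≤n
                 (≤-<-trans (≤-reflexive fi≡) (≤∧≢⇒< k<fi′ (i′≢i ∘ sym)))

  -- As `suc k` bumps nothing, every rising arc at the cut has by `greedy` been bumped before, so
  -- all rising arcs are early. A late entry `(i , s)` has `s > suc k`: if `f (suc k) < f i`, it
  -- would have been bumped before `suc k`; otherwise `suc k` is inverted with `s` and would be an
  -- excedance.
  position-step : ∀ {k} → suc k ≤ n → f (suc k) ≤ k → (∀ i → (i , suc k) ∉ M) → ∑ k bumping ≡ ∑ k bumped +
        rising k
  position-step {k} k<n fK≤k K∉ = begin
    ∑ k bumping            ≡⟨ sym (+-identityʳ _) ⟩
    ∑ k bumping + 0        ≡⟨ cong (∑ k bumping +_) (sym no-late) ⟩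
    ∑ k bumping + late k   ≡⟨ sym (balance k) ⟩
    ∑ k bumped + early k   ≡⟨ cong (∑ k bumped +_) (≤-antisym (early≤rising k) rising≤early) ⟩
    ∑ k bumped + rising k  ∎
    where
    open ≡-Reasoning
    rising≤early : rising k ≤ early k
    rising≤early = ∑L-surjection n proj₁ (earlyᵇ k) (λ i → (i <ᵇ suc k) ∧ (k <ᵇ f i))
          (λ e∈ → 1≤bumped e∈ , bumped≤n e∈) early-witness
      where
      early-witness : ∀ i → 1 ≤ i → i ≤ n → ((i <ᵇ suc k) ∧ (k <ᵇ f i)) ≡ true → ∃[ e ]
            (e ∈ M × earlyᵇ k e ≡ true × proj₁ e ≡ i)
      early-witness i 1≤i i≤n h with ∧-true {i <ᵇ suc k} h
      ... | a , b with greedy 1≤i (true⇒< {i} a) k<n (≤-<-trans fK≤k (true⇒< {k} b))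
      ...   | inj₁ (s , e∈ , s<K) = (i , s) , e∈ , cong₂ _∧_ (<⇒true s<K) b , refl
      ...   | inj₂ (i′ , e∈ , _) = ⊥-elim (K∉ i′ e∈)
    no-late : late k ≡ 0
    no-late = ∑L-0 _ M (λ {e} e∈ → cong ⟦_⟧ (vanish e e∈))
      where
      vanish : ∀ e → e ∈ M → lateᵇ k e ≡ false
      vanish (i , s) e∈ with lateᵇ k (i , s) in h
      ... | false = refl
      ... | true with ∧-true {f i <ᵇ suc k} h
      ...   | a , b with s≤s⁻¹ (true⇒< {f i} {suc k} a) | true⇒< {k} {s} b | m≤n⇒m<n∨m≡n (true⇒< {k} {s} b)
      ...     | fi≤k | k<s | inj₂ refl = ⊥-elim (K∉ i e∈)
      ...     | fi≤k | k<s | inj₁ K<s with ≤∨> (1≤bumped e∈) (<-≤-trans (rises e∈) (≤-trans fi≤k (n≤1+n k))) k<n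
      ...       | inj₁ fi<fK = ⊥-elim (<⇒≱ (inversion-exceeds z<s K<s (s≤n e∈) (<-trans (larger e∈) fi<fK))
            (≤-trans fK≤k (n≤1+n k)))
      ...       | inj₂ fK<fi with greedy (1≤bumped e∈) (<-≤-trans (rises e∈) (≤-trans fi≤k (n≤1+n k))) k<n fK<fi
      ...         | inj₂ (i′ , e′∈ , _) = ⊥-elim (K∉ i′ e′∈)
      ...         | inj₁ (s′ , e′∈ , s′<K) with distinctBy-∈ bumped! e∈ e′∈ refl
      ...           | refl = ⊥-elim (<⇒≱ s′<K k<s)

  private
    rising-zero : rising 0 ≡ 0
    rising-zero = ∑-0 n (λ { (suc i) _ _ → refl })

    p≤ : ∀ k → k ≤ n → ∑ k bumped ≤ ∑ k bumping + rising k
    p≤ k k≤n = ≤-trans (m≤m+n _ (early k)) (≤-trans (≤-reflexive (balance k))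
          (+-monoʳ-≤ (∑ k bumping) (late≤rising k k≤n)))

    q≤ : ∀ k → k ≤ n → ∑ k bumping ≤ ∑ k bumped + rising k
    q≤ k k≤n = ≤-trans (m≤m+n _ (late k)) (≤-trans (≤-reflexive (sym (balance k)))
          (+-monoʳ-≤ (∑ k bumped) (early≤rising k)))

    not-bumping : ∀ {K} → (∀ i → (i , K) ∉ M) → bumping K ≡ 0
    not-bumping {K} K∉ = cong ⟦_⟧ (∉⇒elem K (map proj₂ M)
          (λ K∈ → case ∈-map⁻ proj₂ K∈ of λ { ((i , _) , e∈ , refl) → K∉ i e∈ }))

    bumping-dec : ∀ K → (bumping K ≡ 1 × ∃[ i ] (i , K) ∈ M) ⊎ (bumping K ≡ 0 × (∀ i → (i , K) ∉ M))
    bumping-dec K with elem K (map proj₂ M) in h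
    ... | true  = case ∈-map⁻ proj₂ (elem⇒∈ K _ h) of λ { ((i , _) , e∈ , refl) → inj₁ (refl , i , e∈) }
    ... | false = inj₂ (refl , λ i e∈ → case trans (sym h) (∈⇒elem K _ (∈-map⁺ proj₂ e∈)) of λ ())

    bumped-dec : ∀ {i} → 1 ≤ i → i ≤ n →
      (bumped (f i) ≡ 1 × ∃[ s ] (i , s) ∈ M) ⊎ (bumped (f i) ≡ 0 × (∀ s → (i , s) ∉ M))
    bumped-dec {i} 1≤i i≤n with elem (f i) (map (f ∘ proj₁) M) in h
    ... | true  = case ∈-map⁻ (f ∘ proj₁) (elem⇒∈ (f i) _ h) of λ { ((i′ , s) , e∈ , q) →
          inj₁ (refl , s , subst (λ l → (l , s) ∈ M) (sym (injective 1≤i i≤n (1≤bumped e∈) (bumped≤n e∈) q)) e∈) }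
    ... | false = inj₂ (refl , λ s e∈ → case trans (sym h) (∈⇒elem (f i) _ (∈-map⁺ (f ∘ proj₁) e∈)) of λ ())

    -- An arc passing over the fixed point would form an inversion with it, and the fixed point
    -- would recede.
    fixed-rising : ∀ k → k < n → f (suc k) ≡ suc k → rising k ≡ 0
    fixed-rising k k<n fK with rising k in h
    ... | zero  = refl
    ... | suc _ with rising-witness {k} (subst (0 <_) (sym h) z<s)
    ...   | i , 1≤i , i≤n , i≤k , k<fi = ⊥-elim (<⇒≢
          (inversion-recedes 1≤i (s≤s i≤k) k<n (≤∧≢⇒< (≤-trans (≤-reflexive fK) k<fi)
              (λ q → <⇒≢ (s≤s i≤k) (sym (injective z<s k<n 1≤i i≤n q))))) fK)

    Goal : ℕ → ℕ → Set
    Goal k K = Step (bumped K) (bumping K) (exceeds K) (exceeded K) (fixes K) (∑ k bumped) (∑ k bumping)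
          (rising k)

    -- The part of a `Step` that concerns `suc k` as a value, settled separately from its role as a
    -- position.
    data ValueSide (k : ℕ) : Set where
      tame : exceeded (suc k) ≡ bumped (suc k) → ValueSide k
      wild : exceeded (suc k) ≡ 1 → bumped (suc k) ≡ 0 → 1 ≤ rising k → ∑ k bumped ≡ ∑ k bumping + rising
            k → ValueSide k

    value-side : ∀ k → k < n → ValueSide k
    value-side k k<n with surjective {suc k} z<s k<n
    ... | i , 1≤i , i≤n , fi≡K with bumped-dec 1≤i i≤n | exceeded-at 1≤i i≤n | <-≤-connex i (f i)
    ...   | inj₁ (a , s , e∈) | b | _ = tame (subst (λ K → exceeded K ≡ bumped K) fi≡K
              (trans b (trans (cong ⟦_⟧ (<⇒true (rises e∈))) (sym a))))
    ...   | inj₂ (a , _) | b | inj₂ fi≤i = tame (subst (λ K → exceeded K ≡ bumped K) fi≡K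
              (trans b (trans (cong ⟦_⟧ (≥⇒false fi≤i)) (sym a))))
    ...   | inj₂ (a , i∉) | b | inj₁ i<fi = wild
              (subst (λ K → exceeded K ≡ 1) fi≡K (trans b (cong ⟦_⟧ (<⇒true i<fi))))
              (subst (λ K → bumped K ≡ 0) fi≡K a)
              (rising-pos 1≤i i≤n i≤k (≤-reflexive (sym fi≡K)))
              (value-step (<⇒≤ k<n) 1≤i i≤k fi≡K i∉)
      where
      i≤k : i ≤ k
      i≤k = s≤s⁻¹ (≤-trans i<fi (≤-reflexive fi≡K))

    one-sided : ∀ {k} → bumping (suc k) + exceeds (suc k) ≡ 1 → fixes (suc k) ≡ 0 → ValueSide k → Goal k (suc k)
    one-sided a b (tame c)       = passive c a b
    one-sided a b (wild c d g h) = value c d a b g h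

    step′ : ∀ k → k < n → Goal k (suc k)
    step′ k k<n with <-cmp (f (suc k)) (suc k)
    ... | tri> K≮ K≢ K< = one-sided (cong₂ _+_ (not-bumping (λ i e∈ → K≮ (falls e∈))) (cong ⟦_⟧ (<⇒true K<)))
                                   (cong ⟦_⟧ (≢⇒false K≢)) (value-side k k<n)
    ... | tri≈ K≮ fK _ = fixed v≡0 P≡0 (not-bumping (λ i e∈ → K≮ (falls e∈)))
                             (cong ⟦_⟧ (≥⇒false (≤-reflexive fK))) (cong ⟦_⟧ (≡⇒true fK)) (fixed-rising k k<n fK)
      where
      v≡0 : exceeded (suc k) ≡ 0
      v≡0 = subst (λ K → exceeded K ≡ 0) fK (trans (exceeded-at {suc k} z<s k<n)
            (cong ⟦_⟧ (≥⇒false (≤-reflexive fK))))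
      P≡0 : bumped (suc k) ≡ 0
      P≡0 with bumped-dec {suc k} z<s k<n
      ... | inj₂ (a , _)      = subst (λ K → bumped K ≡ 0) fK a
      ... | inj₁ (_ , _ , e∈) = ⊥-elim (<⇒≢ (rises e∈) (sym fK))
    ... | tri< fK< K≢ _ with bumping-dec (suc k)
    ...   | inj₁ (a , _) = one-sided (cong₂ _+_ a (cong ⟦_⟧ (≥⇒false (<⇒≤ fK<)))) (cong ⟦_⟧ (≢⇒false K≢))
          (value-side k k<n)
    ...   | inj₂ (a , K∉) with value-side k k<n
    ...     | tame c = position c a (cong ⟦_⟧ (≥⇒false (<⇒≤ fK<))) (cong ⟦_⟧ (≢⇒false K≢)) 1≤r
          (position-step k<n (s≤s⁻¹ fK<) K∉)
      where
      1≤r : 1 ≤ rising k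
      1≤r = subst (1 ≤_) (sym (rising≡falling k (<⇒≤ k<n))) (falling-pos {suc k} z<s k<n ≤-refl (s≤s⁻¹ fK<))
    -- A never bumped excedance value cannot coincide with a receding position that bumps nothing:
    -- `p = q + r` and `q = p + r` contradict `r ≥ 1`.
    ...     | wild c d g h = ⊥-elim (<⇒≱ {∑ k bumping}
          (≤-trans (≤-trans (≤-reflexive (+-comm 1 _)) (+-monoʳ-≤ (∑ k bumping) g)) (≤-reflexive (sym h)))
                (≤-trans (m≤m+n _ (rising k)) (≤-reflexive (sym (position-step k<n (s≤s⁻¹ fK<) K∉)))))

  profile : Profile n bumped bumping exceeds exceeded fixes rising
  profile = record
    { r-zero = rising-zero
    ; r-end  = rising-n
    ; r-suc  = rising-suc
    ; p≤q+r  = p≤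
    ; q≤p+r  = q≤
    ; step   = step′
    }

-- Half-paths

count≤ : ℕ → List ℕ → ℕ
count≤ x xs = ∑L (λ i → ⟦ i <ᵇ suc x ⟧) xs

count≤-all : ∀ {x xs} → All (_≤ x) xs → count≤ x xs ≡ length xs
count≤-all []       = refl
count≤-all (p ∷ ps) = cong₂ _+_ (cong ⟦_⟧ (<⇒true (s≤s p))) (count≤-all ps)

count≤-length : ∀ x xs → count≤ x xs ≤ length xs
count≤-length x []       = z≤n
count≤-length x (i ∷ xs) with i <ᵇ suc x
... | true  = s≤s (count≤-length x xs)
... | false = m≤n⇒m≤1+n (count≤-length x xs)

onTop : (ℕ → ℕ) → List ℕ → ℕ
onTop f []      = 0
onTop f (i ∷ _) = f i

-- A word w 1 w 2 w 3 … of pushes (true) and pops (false), run as a stack of positions.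
module Word (w : ℕ → Bool) where

  up down : ℕ → ℕ
  up zero      = 0
  up (suc k)   = ⟦ w (suc k) ⟧ + up k
  down zero    = 0
  down (suc k) = ⟦ not (w (suc k)) ⟧ + down k

  stack : ℕ → List ℕ
  stack zero    = []
  stack (suc k) = if w (suc k) then suc k ∷ stack k else drop 1 (stack k)

  closings : (ℕ → ℕ → ℕ) → ℕ → ℕ
  closings F zero    = 0
  closings F (suc k) = (if w (suc k) then 0 else onTop (F k) (stack k)) + closings F k

  -- The number of pairs of nested arcs, counted at the closing of the outer arc.
  nested : ℕ → ℕ
  nested = closings (λ k i → up k ∸ up i)

  module _ {k : ℕ} (e : w (suc k) ≡ true) where
    up-push : up (suc k) ≡ suc (up k)
    up-push = cong (λ c → ⟦ c ⟧ + up k) e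
    down-push : down (suc k) ≡ down k
    down-push = cong (λ c → ⟦ not c ⟧ + down k) e
    stack-push : stack (suc k) ≡ suc k ∷ stack k
    stack-push = cong (λ c → if c then suc k ∷ stack k else drop 1 (stack k)) e
    closings-push : ∀ F → closings F (suc k) ≡ closings F k
    closings-push F = cong (λ c → (if c then 0 else onTop (F k) (stack k)) + closings F k) e

  module _ {k : ℕ} (e : w (suc k) ≡ false) where
    up-pop : up (suc k) ≡ up k
    up-pop = cong (λ c → ⟦ c ⟧ + up k) e
    down-pop : down (suc k) ≡ suc (down k)
    down-pop = cong (λ c → ⟦ not c ⟧ + down k) e
    stack-pop : stack (suc k) ≡ drop 1 (stack k)
    stack-pop = cong (λ c → if c then suc k ∷ stack k else drop 1 (stack k)) e
    closings-pop : ∀ F → closings F (suc k) ≡ onTop (F k) (stack k) + closings F k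
    closings-pop F = cong (λ c → (if c then 0 else onTop (F k) (stack k)) + closings F k) e

  up+down : ∀ k → up k + down k ≡ k
  up+down zero = refl
  up+down (suc k) with w (suc k)
  ... | true  = cong suc (up+down k)
  ... | false = trans (+-suc (up k) (down k)) (cong suc (up+down k))

  down-∑ : ∀ k → down k ≡ ∑ k (λ i → ⟦ not (w i) ⟧)
  down-∑ zero    = refl
  down-∑ (suc k) = trans (+-comm ⟦ not (w (suc k)) ⟧ (down k)) (cong (_+ ⟦ not (w (suc k)) ⟧) (down-∑ k))

  up-mono : ∀ {i k} → i ≤ k → up i ≤ up k
  up-mono {k = zero}  z≤n = z≤n
  up-mono {i} {suc k} i≤ with m≤n⇒m<n∨m≡n i≤
  ... | inj₂ refl = ≤-refl
  ... | inj₁ i<   = ≤-trans (up-mono (s≤s⁻¹ i<)) (m≤n+m (up k) _)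

  closings-cong : ∀ {F G} n → (∀ k i → k < n → w (suc k) ≡ false → i ∈ stack k → F k i ≡ G k i) →
                  closings F n ≡ closings G n
  closings-cong zero    h = refl
  closings-cong (suc k) h with w (suc k) in e | closings-cong k (λ k i k< → h k i (m≤n⇒m≤1+n k<))
  ... | true  | ih = ih
  ... | false | ih with stack k in f
  ...   | []     = ih
  ...   | i ∷ xs = cong₂ _+_ (h k i ≤-refl e (subst (i ∈_) (sym f) (here refl))) ih

  closings-0 : ∀ n → closings (λ _ _ → 0) n ≡ 0
  closings-0 zero    = refl
  closings-0 (suc k) with w (suc k)
  ... | true  = closings-0 k
  ... | false with stack k
  ...   | []    = closings-0 k
  ...   | _ ∷ _ = closings-0 k

  Ballot : ℕ → Set
  Ballot n = ∀ k → k ≤ n → down k ≤ up k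

  -- The equation in `push` records the height at which `i` was pushed: `up i − down i` is the stack
  -- length just after `i`, and `up i + down i = i`.
  data Stack (k : ℕ) : List ℕ → Set where
    []   : Stack k []
    push : ∀ {i xs} → 1 ≤ i → i ≤ k → All (_< i) xs → w i ≡ true → up i + up i ≡ i + suc (length xs) →
           Stack k xs → Stack k (i ∷ xs)

  weaken : ∀ {k k′ xs} → k ≤ k′ → Stack k xs → Stack k′ xs
  weaken k≤ []                  = []
  weaken k≤ (push a b c d e s)  = push a (≤-trans b k≤) c d e (weaken k≤ s)

  Stack-≤ : ∀ {k xs} → Stack k xs → All (_≤ k) xs
  Stack-≤ []                 = []
  Stack-≤ (push a b c d e s) = b ∷ Stack-≤ s

  Stack-∈ : ∀ {k xs i} → Stack k xs → i ∈ xs → 1 ≤ i × i ≤ k × w i ≡ true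
  Stack-∈ (push a b c d e s) (here refl) = a , b , d
  Stack-∈ (push a b c d e s) (there i∈)  = Stack-∈ s i∈

  module _ {n : ℕ} (ballot : Ballot n) where

    height : ∀ k → k ≤ n → length (stack k) + down k ≡ up k
    height zero    k≤n = refl
    height (suc k) k≤n with w (suc k) | height k (<⇒≤ k≤n) | ballot (suc k) k≤n
    ... | true  | h | _ = cong suc h
    ... | false | h | d≤u with stack k
    ...   | []     = ⊥-elim (<⇒≱ d≤u (≤-reflexive (sym h)))
    ...   | _ ∷ xs = trans (+-suc (length xs) (down k)) h

    stack-pop-nonempty : ∀ {k} → k < n → w (suc k) ≡ false → stack k ≢ []
    stack-pop-nonempty {k} k<n e f = <⇒≱ (≤-trans (≤-reflexive (sym (down-pop e))) (ballot (suc k) k<n))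
      (≤-reflexive (trans (up-pop e) (trans (sym (height k (<⇒≤ k<n))) (cong (λ xs → length xs + down k) f))))

    height₂ : ∀ k → k ≤ n → length (stack k) + (down k + down k) ≡ k
    height₂ k k≤n = trans (sym (+-assoc (length (stack k)) (down k) (down k)))
                          (trans (cong (_+ down k) (height k k≤n)) (up+down k))

    height-up : ∀ k → k ≤ n → up k + up k ≡ k + length (stack k)
    height-up k k≤n = height-double (up k) (down k) k (length (stack k)) (height k k≤n) (up+down k)

    closings-1 : ∀ k → k ≤ n → closings (λ _ _ → 1) k ≡ down k
    closings-1 zero    k≤n = refl
    closings-1 (suc k) k≤n with w (suc k) | closings-1 k (<⇒≤ k≤n) | height k (<⇒≤ k≤n) | ballot (suc k) k≤n
    ... | true  | ih | _ | _   = ih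
    ... | false | ih | h | d≤u with stack k
    ...   | []     = ⊥-elim (<⇒≱ d≤u (≤-reflexive (sym h)))
    ...   | _ ∷ xs = cong suc ih

    stack-Stack : ∀ k → k ≤ n → Stack k (stack k)
    stack-Stack zero    k≤n = []
    stack-Stack (suc k) k≤n with w (suc k) in e | height-up (suc k) k≤n
    ... | true  | h = push z<s ≤-refl (All.map s≤s (Stack-≤ s)) e
                        (trans (cong (λ b → (⟦ b ⟧ + up k) + (⟦ b ⟧ + up k)) e) h) (weaken (n≤1+n k) s)
      where s = stack-Stack k (<⇒≤ k≤n)
    ... | false | _ with stack k | stack-Stack k (<⇒≤ k≤n)
    ...   | []     | []                 = []
    ...   | i ∷ xs | push _ _ _ _ _ s   = weaken (n≤1+n k) s

    private
      lengthen : ∀ {k xs} → All (_≤ k) xs → ∑L (λ i → suc (suc k) ∸ i) xs ≡ length xs + ∑L (λ i → suc k ∸ i) xs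
      lengthen []                      = refl
      lengthen {k} {i ∷ xs} (i≤k ∷ ps) = trans (cong₂ _+_ (+-∸-assoc 1 (m≤n⇒m≤1+n i≤k)) (lengthen ps))
        (cong suc (trans (sym (+-assoc (suc k ∸ i) (length xs) _))
              (trans (cong (_+ ∑L (λ i → suc k ∸ i) xs) (+-comm (suc k ∸ i) (length xs)))
                    (+-assoc (length xs) (suc k ∸ i) _))))

    -- An arc from i to j contributes j ∸ i to the sum of the heights and encloses (j ∸ i ∸ 1) / 2 arcs.
    ∑-height : ∀ k → k ≤ n →
      ∑ k (λ j → length (stack j)) ≡ (nested k + nested k) + down k + ∑L (λ i → suc k ∸ i) (stack k)
    ∑-height zero    k≤n = refl
    ∑-height (suc k) k≤n with w (suc k) | ∑-height k (<⇒≤ k≤n) | height k (<⇒≤ k≤n) | ballot (suc k) k≤n |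
          height-up k (<⇒≤ k≤n) | stack-Stack k (<⇒≤ k≤n)
    ... | true  | ih | _ | _ | _ | s = trans
      (push-heights (nested k) (down k) (∑L (λ i → suc k ∸ i) (stack k)) (length (stack k)) ih)
      (sym (cong₂ (λ a b → (nested k + nested k) + down k + (a + b)) (m+n∸n≡m 1 k) (lengthen (Stack-≤ s))))
    ... | false | ih | h | d≤u | h₂ | s with stack k
    ...   | []     = ⊥-elim (<⇒≱ d≤u (≤-reflexive (sym h)))
    ∑-height (suc k) k≤n | false | ih | h | d≤u | h₂ | push {i} {xs} _ i≤k _ _ e s | .(i ∷ xs) = trans
      (pop-heights (nested k) (down k) (∑L (λ i → suc k ∸ i) xs) (length xs) (up k ∸ up i) ih
         (arc-length (suc (length xs)) i≤k (up-mono i≤k) e h₂))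
      (cong ((up k ∸ up i + nested k) + (up k ∸ up i + nested k) + suc (down k) +_) (sym (lengthen (Stack-≤ s))))

  -- The top is the largest entry. If it exceeds `x`, the count is unchanged; otherwise all entries
  -- are `≤ x` and the count is the length.
  count≤-drop : ∀ {k xs} x → Stack k xs → count≤ x (drop 1 xs) ≡ count≤ x xs ⊓ length (drop 1 xs)
  count≤-drop x [] = refl
  count≤-drop x (push {i} {xs} _ _ xs<i _ _ _) with i <ᵇ suc x | compare< i (suc x)
  ... | true  | lt p = trans (count≤-all all≤x) (sym
        (trans (cong (λ c → suc c ⊓ length xs) (count≤-all all≤x)) (m≥n⇒m⊓n≡n (n≤1+n (length xs)))))
    where all≤x = All.map (λ q → ≤-trans (<⇒≤ q) (s≤s⁻¹ p)) xs<i
  ... | false | _    = sym (m≤n⇒m⊓n≡m (count≤-length x xs))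

  module _ {n : ℕ} (ballot : Ballot n) where

    -- The entries `≤ k` surviving until `N` number the least height between `k` and `N`; the
    -- recursion lowers `k` by one and so takes in one more height.
    count≤-height : ∀ k N → k < N → N ≤ n → count≤ k (stack N) ≡ length (stack k) ⊓ count≤ (suc k) (stack N)
    count≤-height k (suc N) k<N N≤n with m≤n⇒m<n∨m≡n k<N
    ... | inj₂ refl with w (suc k)
    ...   | true  rewrite ≥⇒false {k} {k} ≤-refl | <⇒true {k} {suc k} ≤-refl | count≤-all
          (Stack-≤ (stack-Stack ballot k (<⇒≤ N≤n)))
                        | count≤-all (Stack-≤ (weaken (n≤1+n k) (stack-Stack ballot k (<⇒≤ N≤n)))) =
            sym (m≤n⇒m⊓n≡m (n≤1+n (length (stack k))))
    ...   | false rewrite count≤-drop k (stack-Stack ballot k (<⇒≤ N≤n)) | count≤-drop (suc k)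
          (stack-Stack ballot k (<⇒≤ N≤n))
                        | count≤-all (Stack-≤ (stack-Stack ballot k (<⇒≤ N≤n)))
                        | count≤-all (Stack-≤ (weaken (n≤1+n k) (stack-Stack ballot k (<⇒≤ N≤n)))) =
            trans (cong (_⊓ length (drop 1 (stack k))) (sym (⊓-idem (length (stack k)))))
                  (⊓-assoc (length (stack k)) _ _)
    count≤-height k (suc N) k<N N≤n | inj₁ k<N′ with w (suc N) | count≤-height k N (s≤s⁻¹ k<N′) (<⇒≤ N≤n)
    ... | true  | ih rewrite ≥⇒false {N} {k} (<⇒≤ (s≤s⁻¹ k<N′)) | ≥⇒false {N} {suc k} (s≤s⁻¹ k<N′) = ih
    ... | false | ih rewrite count≤-drop k (stack-Stack ballot N (<⇒≤ N≤n)) | count≤-drop (suc k)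
          (stack-Stack ballot N (<⇒≤ N≤n)) | ih =
      ⊓-assoc (length (stack k)) _ _

    count≤-end : count≤ n (stack n) ≡ length (stack n)
    count≤-end = count≤-all (Stack-≤ (stack-Stack ballot n ≤-refl))

-- Both stacks decrease from the top and have equal length, so each condition selects a bottom
-- segment of the zipped list; the shorter segment decides.
count-zip : ∀ (w w′ : ℕ → Bool) {k k′ xs ys} x y → length xs ≡ length ys → Word.Stack w k xs → Word.Stack w′
      k′ ys →
  ∑L (λ e → ⟦ (proj₁ e <ᵇ suc x) ∧ (proj₂ e <ᵇ suc y) ⟧) (zip xs ys) ≡ count≤ x xs ⊓ count≤ y ys
count-zip w w′ x y e Word.[] Word.[] = refl
count-zip w w′ x y e (Word.push {i} {xs} _ _ xs<i _ _ s) (Word.push {j} {ys} _ _ ys<j _ _ s′)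
  with i <ᵇ suc x | compare< i (suc x) | j <ᵇ suc y | compare< j (suc y) | count-zip w w′ x y
        (suc-injective e) s s′
... | true  | _    | true  | _    | ih = cong suc ih
... | false | _    | false | _    | ih = ih
... | true  | lt p | false | _    | ih = trans ih (trans (m≥n⇒m⊓n≡n b≤a) (sym (m≥n⇒m⊓n≡n (m≤n⇒m≤1+n b≤a))))
  where
  b≤a : count≤ y ys ≤ count≤ x xs
  b≤a = ≤-trans (count≤-length y ys) (≤-reflexive (trans (sym (suc-injective e))
          (sym (count≤-all (All.map (λ q → ≤-trans (<⇒≤ q) (s≤s⁻¹ p)) xs<i)))))
... | false | _    | true  | lt p | ih = trans ih (trans (m≤n⇒m⊓n≡m a≤b) (sym (m≤n⇒m⊓n≡m (m≤n⇒m≤1+n a≤b))))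
  where
  a≤b : count≤ x xs ≤ count≤ y ys
  a≤b = ≤-trans (count≤-length x xs) (≤-reflexive (trans (suc-injective e)
          (sym (count≤-all (All.map (λ q → ≤-trans (<⇒≤ q) (s≤s⁻¹ p)) ys<j)))))

-- The downward induction step, on minima of heights.

-- A step seen through s = p + q + r; the indices are 1 for a never bumped excedance value, a fixed point.
data Kind (s s′ p q r : ℕ) : ℕ → ℕ → Set where
  passive  : s′ ≡ suc s → Kind s s′ p q r 0 0
  value    : s′ ≡ s → 1 ≤ r → p ≡ q + r → Kind s s′ p q r 1 0
  position : s′ ≡ s → 1 ≤ r → q ≡ p + r → Kind s s′ p q r 0 0
  fixed    : s′ ≡ s → p ≡ q → r ≡ 0 → Kind s s′ p q r 0 1

kind : ∀ {P Q e v x p q r r′} → p ≤ q + r → q ≤ p + r → r′ + v ≡ r + e → Step P Q e v x p q r →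
       ∃[ V ] (v ≡ P + V × Kind (p + q + r) ((p + P) + (q + Q) + r′) p q r V x)
kind {P = P} {p = p} {q} _ _ h (passive a b refl) = 0 , trans a (sym (+-identityʳ P)) , passive
      (step-passive {p = p} {q} a b h)
kind {p = p} {q} _ _ h (value a refl b refl c d) = 1 , a , value (step-active {p = p} {q} (trans a (sym b)) h) c d
kind {P = P} {p = p} {q} _ _ h (position refl refl refl refl c d) =
  0 , sym (+-identityʳ P) , position (step-active {p = p} {q} (sym (+-identityʳ P)) h) c d
kind {p = p} {q} p≤ q≤ h (fixed refl refl refl refl refl refl) =
  0 , refl , fixed (step-active {p = p} {q} refl h)
        (≤-antisym (≤-trans p≤ (≤-reflexive (+-identityʳ _))) (≤-trans q≤ (≤-reflexive (+-identityʳ _)))) refl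

kind-≤ : ∀ {s s′ p q r V x} → Kind s s′ p q r V x → s′ ≤ suc s
kind-≤ (passive refl)      = ≤-refl
kind-≤ (value refl _ _)    = n≤1+n _
kind-≤ (position refl _ _) = n≤1+n _
kind-≤ (fixed refl _ _)    = n≤1+n _

-- With `a`, `b` counting unmatched positions `≤ k` and `a′`, `b′` those `≤ k + 1`, each minimum
-- counts strands in a rectangle. `low` is the induction claim; `mixed` says that `V` strands have
-- first end `k + 1` and second end `≤ k`; `square`, a mixed second difference, that `x` strands
-- join `k + 1` to itself.
record Minima (a b a′ b′ k s V x : ℕ) : Set where
  field
    low    : (a ⊓ b) + s ≡ k
    mixed  : a′ ⊓ b ≡ a ⊓ b + V
    square : a′ ⊓ b′ + a ⊓ b ≡ a′ ⊓ b + a ⊓ b′ + x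

-- Let `ν = k − (p + q + r)`; the heights `h` and `g` are at least `ν`. At a passive step `a′ ⊓ b′`
-- is already `ν` and all four minima agree. At the others it is `ν + 1`: `value` has `h = ν < g`,
-- `position` has `g = ν < h`, and `fixed` has `h = g = ν`.
minima : ∀ {a b a′ b′ h g k p q r s′ V x} → a ≡ h ⊓ a′ → b ≡ g ⊓ b′ → (a′ ⊓ b′) + s′ ≡ suc k →
         h + (p + p) ≡ k → g + (q + q) ≡ k → p ≤ q + r → q ≤ p + r → p + q + r ≤ k →
         Kind (p + q + r) s′ p q r V x → Minima a b a′ b′ k (p + q + r) V x
minima {a} {b} {a′} {b′} {h} {g} {k} {p} {q} {r} a≡ b≡ top h₁ g₁ p≤ q≤ s≤k kd
  with k ∸ (p + q + r) | m∸n+n≡m s≤k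
... | ν | refl = go {top = top} kd
  where
  g₂ : g + (q + q) ≡ ν + (q + p + r)
  g₂ = swap-pq {ν = ν} p q r g₁
  ν≤h : ν ≤ h
  ν≤h = gap {p = p} {q} {r} h₁ p≤
  ν≤g : ν ≤ g
  ν≤g = gap {p = q} {p} {r} g₂ q≤
  a≤a′ : a ≤ a′
  a≤a′ = ≤-trans (≤-reflexive a≡) (m⊓n≤n h a′)
  b≤b′ : b ≤ b′
  b≤b′ = ≤-trans (≤-reflexive b≡) (m⊓n≤n g b′)
  h-tight : h ≡ ν → ν ≤ a′ → a ≡ ν
  h-tight refl le = trans a≡ (m≤n⇒m⊓n≡m le)
  g-tight : g ≡ ν → ν ≤ b′ → b ≡ ν
  g-tight refl le = trans b≡ (m≤n⇒m⊓n≡m le)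
  below-a′ : ∀ {c} → a′ ⊓ b′ ≡ c → c ≤ a′
  below-a′ refl = m⊓n≤m a′ b′
  below-b′ : ∀ {c} → a′ ⊓ b′ ≡ c → c ≤ b′
  below-b′ refl = m⊓n≤n a′ b′
  result : ∀ {m m₁ m₂ m′ V x} → a ⊓ b ≡ m → a′ ⊓ b ≡ m₁ → a ⊓ b′ ≡ m₂ → a′ ⊓ b′ ≡ m′ →
           m ≡ ν → m₁ ≡ m + V → m′ + m ≡ m₁ + m₂ + x → Minima a b a′ b′ (ν + (p + q + r)) (p + q + r) V x
  result refl refl refl refl e₁ e₂ e₃ = record { low = cong (_+ (p + q + r)) e₁ ; mixed = e₂ ; square = e₃ }
  ν+0 : ν ≡ ν + 0
  ν+0 = sym (+-identityʳ ν)
  go : ∀ {s′ V x} → {top : (a′ ⊓ b′) + s′ ≡ suc (ν + (p + q + r))} → Kind (p + q + r) s′ p q r V x →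
       Minima a b a′ b′ (ν + (p + q + r)) (p + q + r) V x
  go {top = top} (passive refl) =
    result m (≤-antisym (≤-trans (⊓-mono-≤ (≤-refl {a′}) b≤b′) (≤-reflexive m′)) (⊓-glb ν≤a′ ν≤b))
             (≤-antisym (≤-trans (⊓-mono-≤ a≤a′ (≤-refl {b′})) (≤-reflexive m′)) (⊓-glb ν≤a ν≤b′)) m′ refl
                   ν+0 (+-comm 0 _)
    where
    m′ : a′ ⊓ b′ ≡ ν
    m′ = +-cancelʳ-≡ (p + q + r) _ _ (suc-injective (trans (sym (+-suc (a′ ⊓ b′) _)) top))
    ν≤a′ = below-a′ m′
    ν≤b′ = below-b′ m′
    ν≤a : ν ≤ a
    ν≤a = ≤-trans (⊓-glb ν≤h ν≤a′) (≤-reflexive (sym a≡))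
    ν≤b : ν ≤ b
    ν≤b = ≤-trans (⊓-glb ν≤g ν≤b′) (≤-reflexive (sym b≡))
    m : a ⊓ b ≡ ν
    m = ≤-antisym (≤-trans (⊓-mono-≤ a≤a′ b≤b′) (≤-reflexive m′)) (⊓-glb ν≤a ν≤b)
  go {top = top} (value refl 1≤r p≡) =
    result (trans (cong (_⊓ b) a≡ν) (m≤n⇒m⊓n≡m (<⇒≤ ν<b)))
           (≤-antisym (≤-trans (⊓-mono-≤ (≤-refl {a′}) b≤b′) (≤-reflexive m′)) (⊓-glb (below-a′ m′) ν<b))
           (trans (cong (_⊓ b′) a≡ν) (m≤n⇒m⊓n≡m (<⇒≤ (below-b′ m′)))) m′ refl (+-comm 1 ν) ν+0′
    where
    m′ : a′ ⊓ b′ ≡ suc ν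
    m′ = +-cancelʳ-≡ (p + q + r) _ _ top
    a≡ν : a ≡ ν
    a≡ν = h-tight (tight {p = p} {q} {r} h₁ p≡) (<⇒≤ (below-a′ m′))
    ν<b : ν < b
    ν<b = ≤-trans (⊓-glb (strict {p = p} {q} {r} g₁ p≡ 1≤r) (below-b′ m′)) (≤-reflexive (sym b≡))
    ν+0′ : suc ν + ν ≡ suc ν + ν + 0
    ν+0′ = sym (+-identityʳ _)
  go {top = top} (position refl 1≤r q≡) =
    result (trans (cong (a ⊓_) b≡ν) (m≥n⇒m⊓n≡n (<⇒≤ ν<a)))
           (trans (cong (a′ ⊓_) b≡ν) (m≥n⇒m⊓n≡n (<⇒≤ (below-a′ m′))))
           (≤-antisym (≤-trans (⊓-mono-≤ a≤a′ (≤-refl {b′})) (≤-reflexive m′)) (⊓-glb ν<a (below-b′ m′)))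
           m′ refl ν+0 (trans (+-comm (suc ν) ν) (sym (+-identityʳ _)))
    where
    m′ : a′ ⊓ b′ ≡ suc ν
    m′ = +-cancelʳ-≡ (p + q + r) _ _ top
    b≡ν : b ≡ ν
    b≡ν = g-tight (tight {p = q} {p} {r} g₂ q≡) (<⇒≤ (below-b′ m′))
    ν<a : ν < a
    ν<a = ≤-trans (⊓-glb (strict {p = q} {p} {r} (swap-pq {ν = ν} p q r h₁) q≡ 1≤r) (below-a′ m′))
          (≤-reflexive (sym a≡))
  go {top = top} (fixed refl p≡q r≡0) =
    result (trans (cong₂ _⊓_ a≡ν b≡ν) (⊓-idem ν))
           (trans (cong (a′ ⊓_) b≡ν) (m≥n⇒m⊓n≡n (<⇒≤ (below-a′ m′))))
           (trans (cong (_⊓ b′) a≡ν) (m≤n⇒m⊓n≡m (<⇒≤ (below-b′ m′))))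
           m′ refl ν+0 (+-comm 1 (ν + ν))
    where
    m′ : a′ ⊓ b′ ≡ suc ν
    m′ = +-cancelʳ-≡ (p + q + r) _ _ top
    a≡ν : a ≡ ν
    a≡ν = h-tight (tight {p = p} {q} {r} h₁ (trans p≡q (sym (trans (cong (q +_) r≡0) (+-identityʳ q)))))
          (<⇒≤ (below-a′ m′))
    b≡ν : b ≡ ν
    b≡ν = g-tight (tight {p = q} {p} {r} g₂ (trans (sym p≡q)
          (sym (trans (cong (p +_) r≡0) (+-identityʳ p))))) (<⇒≤ (below-b′ m′))

-- Through strands

∑-≥ : ∀ n c → 1 ≤ c → ∑ n (λ k → ⟦ c <ᵇ suc k ⟧) ≡ suc n ∸ c
∑-≥ zero    (suc c) _   = sym (0∸n≡0 c)
∑-≥ (suc n) c       1≤c with c <ᵇ suc (suc n) | compare< c (suc (suc n))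
... | true  | lt p = trans (cong (_+ 1) (∑-≥ n c 1≤c)) (trans (+-comm _ 1) (sym (+-∸-assoc 1 (s≤s⁻¹ p))))
... | false | ge p = trans (+-identityʳ _) (trans (∑-≥ n c 1≤c)
      (trans (m≤n⇒m∸n≡0 (≤-trans (n≤1+n _) p)) (sym (m≤n⇒m∸n≡0 p))))

⊔-<ᵇ : ∀ i j k → ⟦ (i <ᵇ suc k) ∧ (j <ᵇ suc k) ⟧ ≡ ⟦ (i ⊔ j) <ᵇ suc k ⟧
⊔-<ᵇ i j k with i <ᵇ suc k | compare< i (suc k) | j <ᵇ suc k | compare< j (suc k)
... | true  | lt p | true  | lt q = cong ⟦_⟧ (sym (<⇒true (⊔-pres-<m p q)))
... | true  | _    | false | ge q = cong ⟦_⟧ (sym (≥⇒false (≤-trans q (m≤n⊔m i j))))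
... | false | ge p | _     | _    = cong ⟦_⟧ (sym (≥⇒false (≤-trans p (m≤m⊔n i j))))

∑L-zip : ∀ (φ ψ : ℕ → ℕ) xs ys → length xs ≡ length ys →
         ∑L φ xs + ∑L ψ ys ≡ ∑L (λ e → φ (proj₁ e) + ψ (proj₂ e)) (zip xs ys)
∑L-zip φ ψ []       []       e = refl
∑L-zip φ ψ (x ∷ xs) (y ∷ ys) e =
  trans (+-interchange (φ x) (∑L φ xs) (ψ y) (∑L ψ ys)) (cong (φ x + ψ y +_) (∑L-zip φ ψ xs ys (suc-injective e)))

record Facing (n : ℕ) (u v : ℕ → ℕ) (e : ℕ × ℕ) : Set where
  constructor facing
  field
    1≤i  : 1 ≤ proj₁ e
    i≤n  : proj₁ e ≤ n
    1≤j  : 1 ≤ proj₂ e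
    j≤n  : proj₂ e ≤ n
    rank : u (proj₁ e) + u (proj₁ e) + proj₂ e ≡ v (proj₂ e) + v (proj₂ e) + proj₁ e

Stack-zip : ∀ {w w′ n xs ys e} → length xs ≡ length ys → Word.Stack w n xs → Word.Stack w′ n ys →
            e ∈ zip xs ys → Facing n (Word.up w) (Word.up w′) e
Stack-zip {w} {w′} l (Word.push {i} {xs} a b _ _ c s) (Word.push {j} {ys} a′ b′ _ _ c′ s′) (here refl) =
  facing a b a′ b′ (rank-zip {i} {j} {Word.up w i} {Word.up w′ j} c
    (trans c′ (cong (j +_) (sym l))))
Stack-zip l (Word.push _ _ _ _ _ s) (Word.push _ _ _ _ _ s′) (there e∈) = Stack-zip (suc-injective l) s s′ e∈

module Match {n : ℕ} {P Q e v x r : ℕ → ℕ} (profile : Profile n P Q e v x r) (w w′ : ℕ → Bool)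
             (P≡ : ∀ k → 1 ≤ k → k ≤ n → P k ≡ ⟦ not (w k) ⟧)
             (Q≡ : ∀ k → 1 ≤ k → k ≤ n → Q k ≡ ⟦ not (w′ k) ⟧) where
  open Profile profile
  module 𝒫 = Word w
  module 𝒬 = Word w′

  p q s : ℕ → ℕ
  p k = ∑ k P
  q k = ∑ k Q
  s k = p k + q k + r k

  p≡down : ∀ k → k ≤ n → p k ≡ 𝒫.down k
  p≡down k k≤n = trans (∑-cong k (λ i a b → P≡ i a (≤-trans b k≤n))) (sym (𝒫.down-∑ k))

  q≡down : ∀ k → k ≤ n → q k ≡ 𝒬.down k
  q≡down k k≤n = trans (∑-cong k (λ i a b → Q≡ i a (≤-trans b k≤n))) (sym (𝒬.down-∑ k))

  kindᵏ : ∀ k → k < n → ∃[ V ] (v (suc k) ≡ P (suc k) + V × Kind (s k) (s (suc k)) (p k) (q k) (r k) V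
        (x (suc k)))
  kindᵏ k k<n = kind (p≤q+r k (<⇒≤ k<n)) (q≤p+r k (<⇒≤ k<n)) (r-suc k k<n) (step k k<n)

  s≤ : ∀ k → k ≤ n → s k ≤ k
  s≤ zero    k≤n = ≤-reflexive r-zero
  s≤ (suc k) k<n = ≤-trans (kind-≤ (proj₂ (proj₂ (kindᵏ k k<n)))) (s≤s (s≤ k (<⇒≤ k<n)))

  private
    half-≤ : ∀ k a b c d u → k ≤ n → a ≡ d → a ≤ b + c → a + b + c ≤ k → u + d ≡ k → d ≤ u
    half-≤ k a b c d u k≤n refl h₁ h₂ h₃ = +-cancelʳ-≤ a a u
      (≤-trans (+-monoʳ-≤ a h₁) (≤-trans (≤-reflexive (sym (+-assoc a b c))) (≤-trans h₂ (≤-reflexive (sym h₃)))))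

  -- From `p ≤ q + r` and `s k ≤ k` one gets `2 p k ≤ s k ≤ k`. So the greedy bounds are also what
  -- keeps both half-paths above the axis.
  ballotP : 𝒫.Ballot n
  ballotP k k≤n = half-≤ k (p k) (q k) (r k) _ _ k≤n (p≡down k k≤n) (p≤q+r k k≤n) (s≤ k k≤n) (𝒫.up+down k)

  ballotQ : 𝒬.Ballot n
  ballotQ k k≤n = half-≤ k (q k) (p k) (r k) _ _ k≤n (q≡down k k≤n) (q≤p+r k k≤n)
    (≤-trans (≤-reflexive (cong (_+ r k) (+-comm (q k) (p k)))) (s≤ k k≤n)) (𝒬.up+down k)

  p≡q : p n ≡ q n
  p≡q = ≤-antisym (≤-trans (p≤q+r n ≤-refl) (≤-reflexive (trans (cong (q n +_) r-end) (+-identityʳ _))))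
                  (≤-trans (q≤p+r n ≤-refl) (≤-reflexive (trans (cong (p n +_) r-end) (+-identityʳ _))))

  down≡ : 𝒫.down n ≡ 𝒬.down n
  down≡ = trans (sym (p≡down n ≤-refl)) (trans p≡q (q≡down n ≤-refl))

  heightP : ∀ k → k ≤ n → length (𝒫.stack k) + (p k + p k) ≡ k
  heightP k k≤n = trans (cong (λ d → length (𝒫.stack k) + (d + d)) (p≡down k k≤n)) (𝒫.height₂ ballotP k k≤n)

  heightQ : ∀ k → k ≤ n → length (𝒬.stack k) + (q k + q k) ≡ k
  heightQ k k≤n = trans (cong (λ d → length (𝒬.stack k) + (d + d)) (q≡down k k≤n)) (𝒬.height₂ ballotQ k k≤n)

  openP openQ : List ℕ
  openP = 𝒫.stack n
  openQ = 𝒬.stack n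

  open≡ : length openP ≡ length openQ
  open≡ = +-cancelʳ-≡ (p n + p n) _ _ (trans (heightP n ≤-refl)
          (trans (sym (heightQ n ≤-refl)) (cong (λ d → length openQ + (d + d)) (sym p≡q))))

  strands : List (ℕ × ℕ)
  strands = zip openP openQ

  a b : ℕ → ℕ
  a k = count≤ k openP
  b k = count≤ k openQ

  -- The downward induction is structural in `d = n − k`. It starts at `k = n`, where `r n = 0` and
  -- `p n = q n` and all strands count.
  minimaᵏ-low : ∀ d k → k + d ≡ n → (a k ⊓ b k) + s k ≡ k
  minimaᵏ : ∀ d k → k + suc d ≡ n → ∃[ V ] (v (suc k) ≡ P (suc k) + V × Minima (a k) (b k) (a (suc k))
        (b (suc k)) k (s k) V (x (suc k)))

  minimaᵏ-low zero k e with trans (sym (+-identityʳ k)) e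
  ... | refl = begin
    (a n ⊓ b n) + s n                  ≡⟨ cong₂ (λ c d → (c ⊓ d) + s n) (𝒫.count≤-end ballotP)
          (trans (𝒬.count≤-end ballotQ) (sym open≡)) ⟩
    (length openP ⊓ length openP) + s n        ≡⟨ cong₂ (λ c d → c + (p n + q n + d))
          (⊓-idem (length openP)) r-end ⟩
    length openP + (p n + q n + 0)         ≡⟨ cong (length openP +_)
          (trans (+-identityʳ _) (cong (p n +_) (sym p≡q))) ⟩
    length openP + (p n + p n)             ≡⟨ heightP n ≤-refl ⟩
    n                                  ∎
    where open ≡-Reasoning
  minimaᵏ-low (suc d) k e = Minima.low (proj₂ (proj₂ (minimaᵏ d k e)))

  minimaᵏ d k e with kindᵏ k k<n
    where
    k<n : k < n
    k<n = ≤-trans (m≤m+n (suc k) d) (≤-reflexive (trans (sym (+-suc k d)) e))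
  ... | V , v≡ , kd = V , v≡ , minima
    (𝒫.count≤-height ballotP k n k<n ≤-refl)
    (𝒬.count≤-height ballotQ k n k<n ≤-refl)
    (minimaᵏ-low d (suc k) (trans (sym (+-suc k d)) e))
    (heightP k (<⇒≤ k<n)) (heightQ k (<⇒≤ k<n)) (p≤q+r k (<⇒≤ k<n)) (q≤p+r k (<⇒≤ k<n)) (s≤ k (<⇒≤ k<n)) kd
    where
    k<n : k < n
    k<n = ≤-trans (m≤m+n (suc k) d) (≤-reflexive (trans (sym (+-suc k d)) e))

  low : ∀ k → k ≤ n → (a k ⊓ b k) + s k ≡ k
  low k k≤n = minimaᵏ-low (n ∸ k) k (m+[n∸m]≡n k≤n)

  through : ℕ → ℕ → ℕ
  through y z = ∑L (λ e → ⟦ (proj₁ e <ᵇ suc y) ∧ (proj₂ e <ᵇ suc z) ⟧) strands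

  through≡ : ∀ y z → through y z ≡ a y ⊓ b z
  through≡ y z = count-zip w w′ y z open≡ (𝒫.stack-Stack ballotP n ≤-refl) (𝒬.stack-Stack ballotQ n ≤-refl)

  facing-strand : ∀ {e} → e ∈ strands → Facing n 𝒫.up 𝒬.up e
  facing-strand = Stack-zip open≡ (𝒫.stack-Stack ballotP n ≤-refl) (𝒬.stack-Stack ballotQ n ≤-refl)

  descents levels : ℕ → ℕ
  descents k = ∑L (λ e → ⟦ (proj₁ e ≡ᵇ k) ∧ (proj₂ e <ᵇ k) ⟧) strands
  levels   k = ∑L (λ e → ⟦ (proj₁ e ≡ᵇ k) ∧ (proj₂ e ≡ᵇ k) ⟧) strands

  through-mixed : ∀ k → through (suc k) k ≡ through k k + descents (suc k)
  through-mixed k = trans (∑L-cong strands (λ {e} _ → termwise (proj₁ e) (proj₂ e))) (∑L-+ _ _ strands)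
    where
    termwise : ∀ i j → ⟦ (i <ᵇ suc (suc k)) ∧ (j <ᵇ suc k) ⟧ ≡ ⟦ (i <ᵇ suc k) ∧ (j <ᵇ suc k) ⟧ + ⟦
          (i ≡ᵇ suc k) ∧ (j <ᵇ suc k) ⟧
    termwise i j with <-cmp i (suc k)
    ... | tri< l i≢ _ rewrite <⇒true {i} {suc (suc k)} (m≤n⇒m≤1+n l) | <⇒true l | ≢⇒false i≢ = sym (+-identityʳ _)
    ... | tri≈ _ refl _ rewrite <⇒true {k} {suc k} ≤-refl | ≥⇒false {k} {k} ≤-refl | ≡⇒true {k} refl = refl
    ... | tri> _ i≢ g rewrite ≥⇒false {i} {suc (suc k)} g | ≥⇒false {i} {suc k} (<⇒≤ g) | ≢⇒false i≢ = refl

  through-square : ∀ k → through (suc k) (suc k) + through k k ≡ through (suc k) k + through k (suc k) +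
        levels (suc k)
  through-square k = trans (sym (∑L-+ _ _ strands))
        (trans (∑L-cong strands (λ {e} _ → termwise (proj₁ e) (proj₂ e)))
    (trans (∑L-+ _ _ strands) (cong (_+ levels (suc k)) (∑L-+ _ _ strands))))
    where
    data Split (i : ℕ) : Bool → Bool → Bool → Set where
      old  : Split i true true false
      new  : Split i true false true
      late : Split i false false false
    split : ∀ i → Split i (i <ᵇ suc (suc k)) (i <ᵇ suc k) (i ≡ᵇ suc k)
    split i with <-cmp i (suc k)
    ... | tri< l i≢ _ rewrite <⇒true {i} {suc (suc k)} (m≤n⇒m≤1+n l) | <⇒true l | ≢⇒false i≢ = old
    ... | tri≈ _ refl _ rewrite <⇒true {k} {suc k} ≤-refl | ≥⇒false {k} {k} ≤-refl | ≡⇒true {k} refl = new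
    ... | tri> _ i≢ g rewrite ≥⇒false {i} {suc (suc k)} g | ≥⇒false {i} {suc k} (<⇒≤ g) | ≢⇒false i≢ = late
    termwise : ∀ i j → ⟦ (i <ᵇ suc (suc k)) ∧ (j <ᵇ suc (suc k)) ⟧ + ⟦ (i <ᵇ suc k) ∧ (j <ᵇ suc k) ⟧
      ≡ ⟦ (i <ᵇ suc (suc k)) ∧ (j <ᵇ suc k) ⟧ + ⟦ (i <ᵇ suc k) ∧ (j <ᵇ suc (suc k)) ⟧ + ⟦ (i ≡ᵇ suc k) ∧
            (j ≡ᵇ suc k) ⟧
    termwise i j with i <ᵇ suc (suc k) | i <ᵇ suc k | i ≡ᵇ suc k | split i | j <ᵇ suc (suc k) | j <ᵇ suc k |
          j ≡ᵇ suc k | split j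
    ... | _ | _ | _ | old  | _ | _ | _ | old  = refl
    ... | _ | _ | _ | old  | _ | _ | _ | new  = refl
    ... | _ | _ | _ | old  | _ | _ | _ | late = refl
    ... | _ | _ | _ | new  | _ | _ | _ | old  = refl
    ... | _ | _ | _ | new  | _ | _ | _ | new  = refl
    ... | _ | _ | _ | new  | _ | _ | _ | late = refl
    ... | _ | _ | _ | late | _ | _ | _ | _    = refl

  -- The correspondence is position by position, not merely in number: the differences found in
  -- `Minima` are matched with those of the strand counts `through`.
  step-counts : ∀ k → k < n → v (suc k) ≡ P (suc k) + descents (suc k) × x (suc k) ≡ levels (suc k)
  step-counts k k<n with minimaᵏ (n ∸ suc k) k (trans (+-suc k _) (m+[n∸m]≡n k<n))
  ... | V , v≡ , M = trans v≡ (cong (P (suc k) +_) V≡) , sym x≡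
    where
    V≡ : V ≡ descents (suc k)
    V≡ = +-cancelˡ-≡ (a k ⊓ b k) _ _ (trans (sym (Minima.mixed M)) (trans (sym (through≡ (suc k) k))
           (trans (through-mixed k) (cong (_+ descents (suc k)) (through≡ k k)))))
    x≡ : levels (suc k) ≡ x (suc k)
    x≡ = +-cancelˡ-≡ (through (suc k) k + through k (suc k)) _ _ (trans (sym (through-square k))
           (trans (cong₂ _+_ (through≡ (suc k) (suc k)) (through≡ k k)) (trans (Minima.square M)
             (cong₂ (λ y z → y + z + x (suc k)) (sym (through≡ (suc k) k)) (sym (through≡ k (suc k)))))))

  excedance-values : ∑ n v ≡ 𝒬.down n + ∑L (λ e → ⟦ 𝒬.up (proj₂ e) <ᵇ 𝒫.up (proj₁ e) ⟧) strands
  excedance-values = begin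
    ∑ n v                              ≡⟨ ∑-cong n (λ { (suc k) _ k<n → proj₁ (step-counts k k<n) }) ⟩
    ∑ n (λ k → P k + descents k)       ≡⟨ ∑-+ n P descents ⟩
    p n + ∑ n descents                 ≡⟨ cong₂ _+_ (trans p≡q (q≡down n ≤-refl)) (∑L-∑ n _ strands) ⟩
    𝒬.down n + ∑L (λ e → ∑ n (λ k → ⟦ (proj₁ e ≡ᵇ k) ∧ (proj₂ e <ᵇ k) ⟧)) strands
      ≡⟨ cong (𝒬.down n +_) (∑L-cong strands (λ e∈ → termwise (facing-strand e∈))) ⟩
    𝒬.down n + ∑L (λ e → ⟦ 𝒬.up (proj₂ e) <ᵇ 𝒫.up (proj₁ e) ⟧) strands ∎
    where
    open ≡-Reasoning
    termwise : ∀ {e} → Facing n 𝒫.up 𝒬.up e →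
      ∑ n (λ k → ⟦ (proj₁ e ≡ᵇ k) ∧ (proj₂ e <ᵇ k) ⟧) ≡ ⟦ 𝒬.up (proj₂ e) <ᵇ 𝒫.up (proj₁ e) ⟧
    termwise {i , j} (facing 1≤i i≤n _ _ rank) = trans
      (∑-single n i 1≤i i≤n (λ k _ _ k≢i → cong (λ c → ⟦ c ∧ (j <ᵇ k) ⟧) (≢⇒false (k≢i ∘ sym))))
      (trans (cong (λ c → ⟦ c ∧ (j <ᵇ i) ⟧) (≡⇒true {i} refl)) (cong ⟦_⟧ same-order))
      where
      same-order : (j <ᵇ i) ≡ (𝒬.up j <ᵇ 𝒫.up i)
      same-order with <-cmp (𝒬.up j) (𝒫.up i)
      ... | tri< l _ _ = trans (<⇒true (rank-< {i} {j} rank l)) (sym (<⇒true l))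
      ... | tri≈ _ l _ = trans (≥⇒false (≤-reflexive (rank-≡ {i} {j} rank (sym l))))
            (sym (≥⇒false (≤-reflexive (sym l))))
      ... | tri> _ _ l = trans (≥⇒false (<⇒≤ (rank-< {j} {i} (sym rank) l))) (sym (≥⇒false (<⇒≤ l)))

  fixed-points : ∑ n x ≡ ∑L (λ e → ⟦ 𝒫.up (proj₁ e) ≡ᵇ 𝒬.up (proj₂ e) ⟧) strands
  fixed-points = begin
    ∑ n x        ≡⟨ ∑-cong n (λ { (suc k) _ k<n → proj₂ (step-counts k k<n) }) ⟩
    ∑ n levels   ≡⟨ ∑L-∑ n _ strands ⟩
    ∑L (λ e → ∑ n (λ k → ⟦ (proj₁ e ≡ᵇ k) ∧ (proj₂ e ≡ᵇ k) ⟧)) strands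
      ≡⟨ ∑L-cong strands (λ e∈ → termwise (facing-strand e∈)) ⟩
    ∑L (λ e → ⟦ 𝒫.up (proj₁ e) ≡ᵇ 𝒬.up (proj₂ e) ⟧) strands ∎
    where
    open ≡-Reasoning
    termwise : ∀ {e} → Facing n 𝒫.up 𝒬.up e →
      ∑ n (λ k → ⟦ (proj₁ e ≡ᵇ k) ∧ (proj₂ e ≡ᵇ k) ⟧) ≡ ⟦ 𝒫.up (proj₁ e) ≡ᵇ 𝒬.up (proj₂ e) ⟧
    termwise {i , j} (facing 1≤i i≤n _ _ rank) = trans
      (∑-single n i 1≤i i≤n (λ k _ _ k≢i → cong (λ c → ⟦ c ∧ (j ≡ᵇ k) ⟧) (≢⇒false (k≢i ∘ sym))))
      (trans (cong (λ c → ⟦ c ∧ (j ≡ᵇ i) ⟧) (≡⇒true {i} refl)) (cong ⟦_⟧ same-order))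
      where
      same-order : (j ≡ᵇ i) ≡ (𝒫.up i ≡ᵇ 𝒬.up j)
      same-order with <-cmp (𝒬.up j) (𝒫.up i)
      ... | tri≈ _ l _ = trans (≡⇒true (sym (rank-≡ {i} {j} rank (sym l)))) (sym (≡⇒true (sym l)))
      ... | tri< l l≢ _ = trans (≢⇒false (<⇒≢ (rank-< {i} {j} rank l))) (sym (≢⇒false (l≢ ∘ sym)))
      ... | tri> _ l≢ l = trans (≢⇒false (<⇒≢ (rank-< {j} {i} (sym rank) l) ∘ sym)) (sym (≢⇒false (l≢ ∘ sym)))

  -- This is `|i − j| / 2`, by the rank equation, written without division.
  spread : ℕ × ℕ → ℕ
  spread (i , j) = 𝒬.up j ∸ 𝒫.up i + (𝒫.up i ∸ 𝒬.up j)

  -- The heights of both stacks are summed twice: cut by cut through `heights-balance`, and arc by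
  -- arc through `∑-height`. The strand counts `M` of the first cancel against the part of the open
  -- arcs beyond the later end of their strand; what remains is halved.
  total : ∑ n r ≡ 𝒫.nested n + 𝒬.nested n + 𝒬.down n + ∑L spread strands
  total = halve (+-cancelʳ-≡ (M + M) _ _ (begin
    ∑ n r + ∑ n r + (M + M)
      ≡⟨ heights-sum ⟨
    ∑ n (λ k → length (𝒫.stack k)) + ∑ n (λ k → length (𝒬.stack k))
      ≡⟨ cong₂ _+_ (𝒫.∑-height ballotP n ≤-refl) (𝒬.∑-height ballotQ n ≤-refl) ⟩
    (𝒫.nested n + 𝒫.nested n + 𝒫.down n + ∑L (λ i → suc n ∸ i) openP)
      + (𝒬.nested n + 𝒬.nested n + 𝒬.down n + ∑L (λ j → suc n ∸ j) openQ)
      ≡⟨ regroup {σ = ∑L spread strands} {M} (𝒫.nested n) (𝒬.nested n) (∑L (λ i → suc n ∸ i) openP)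
            (∑L (λ j → suc n ∸ j) openQ) down≡ strand-sum ⟩
    _ ∎))
    where
    open ≡-Reasoning
    M = ∑ n (λ k → through k k)
    heights-sum : ∑ n (λ k → length (𝒫.stack k)) + ∑ n (λ k → length (𝒬.stack k)) ≡ ∑ n r + ∑ n r + (M + M)
    heights-sum = begin
      ∑ n (λ k → length (𝒫.stack k)) + ∑ n (λ k → length (𝒬.stack k))   ≡⟨ ∑-+ n _ _ ⟨
      ∑ n (λ k → length (𝒫.stack k) + length (𝒬.stack k))
        ≡⟨ ∑-cong n (λ k _ k≤n → heights-balance {length (𝒫.stack k)} {length (𝒬.stack k)} {through k k}
              (p k) (q k) (r k) (heightP k k≤n) (heightQ k k≤n)
                         (trans (cong (_+ s k) (through≡ k k)) (low k k≤n))) ⟩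
      ∑ n (λ k → (r k + r k) + (through k k + through k k))              ≡⟨ ∑-+ n _ _ ⟩
      ∑ n (λ k → r k + r k) + ∑ n (λ k → through k k + through k k)      ≡⟨ cong₂ _+_ (∑-+ n _ _) (∑-+ n _ _) ⟩
      ∑ n r + ∑ n r + (M + M)                                            ∎
    M≡ : M ≡ ∑L (λ e → suc n ∸ (proj₁ e ⊔ proj₂ e)) strands
    M≡ = trans (∑L-∑ n _ strands) (∑L-cong strands (λ { {i , j} e∈ → trans (∑-cong n (λ k _ _ → ⊔-<ᵇ i j k))
           (∑-≥ n (i ⊔ j) (≤-trans (Facing.1≤i (facing-strand e∈)) (m≤m⊔n i j))) }))
    strand-sum : ∑L (λ i → suc n ∸ i) openP + ∑L (λ j → suc n ∸ j) openQ ≡ ∑L spread strands + ∑L spread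
          strands + (M + M)
    strand-sum = begin
      ∑L (λ i → suc n ∸ i) openP + ∑L (λ j → suc n ∸ j) openQ     ≡⟨ ∑L-zip _ _ openP openQ open≡ ⟩
      ∑L (λ e → (suc n ∸ proj₁ e) + (suc n ∸ proj₂ e)) strands
        ≡⟨ ∑L-cong strands (λ { {i , j} e∈ → distances {n} {i} {j} {𝒫.up i} {𝒬.up j}
              (Facing.i≤n (facing-strand e∈)) (Facing.j≤n (facing-strand e∈))
                    (Facing.rank (facing-strand e∈)) }) ⟩
      ∑L (λ e → (spread e + spread e) + ((suc n ∸ (proj₁ e ⊔ proj₂ e)) + (suc n ∸ (proj₁ e ⊔ proj₂ e)))) strands
        ≡⟨ ∑L-+ _ _ strands ⟩
      ∑L (λ e → spread e + spread e) strands + ∑L (λ e → (suc n ∸ (proj₁ e ⊔ proj₂ e)) +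
            (suc n ∸ (proj₁ e ⊔ proj₂ e))) strands
        ≡⟨ cong₂ _+_ (∑L-+ _ _ strands) (trans (∑L-+ _ _ strands) (cong₂ _+_ (sym M≡) (sym M≡))) ⟩
      ∑L spread strands + ∑L spread strands + (M + M) ∎

-- Matching of the up- and down-steps

-- matchFrom with the stack remembering, besides the label of each open up-step, the number b₀ of
-- down-steps before it; h weighs the match of label L, b₀ with the down-step v, after a up-steps.
run : (h : ℕ → ℕ → ℕ → ℕ → ℕ) → ℕ → ℕ → ℕ → List (ℕ × ℕ) → List Bool → ℕ
run h n a b st              []          = 0
run h n a b st              (true ∷ w)  = run h n (suc a) b ((n ∸ a , b) ∷ st) w
run h n a b []              (false ∷ w) = run h n a (suc b) [] w
run h n a b ((L , b₀) ∷ st) (false ∷ w) = h L b₀ a (suc b) + run h n a (suc b) st w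

∑L-matchFrom : ∀ (φ : ℕ × ℕ → ℕ) n a b st acc w →
  ∑L φ (matchFrom n a b (map proj₁ st) acc w) ≡ ∑L φ acc + run (λ L _ _ v → φ (L , v)) n a b st w
∑L-matchFrom φ n a b st             acc []          = sym (+-identityʳ _)
∑L-matchFrom φ n a b st             acc (true ∷ w)  = ∑L-matchFrom φ n (suc a) b ((n ∸ a , b) ∷ st) acc w
∑L-matchFrom φ n a b []             acc (false ∷ w) = ∑L-matchFrom φ n a (suc b) [] acc w
∑L-matchFrom φ n a b ((L , _) ∷ st) acc (false ∷ w) = trans (∑L-matchFrom φ n a (suc b) st ((L , suc b) ∷ acc) w)
  (rotate (φ (L , suc b)) (∑L φ acc) _)
  where
  rotate : ∀ x y z → x + y + z ≡ y + (x + z)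
  rotate x y z = trans (cong (_+ z) (+-comm x y)) (+-assoc y x z)

-- Guarantees that `matchFrom` meets an open label at each down-step and that `n ∸ a` is positive at
-- each up-step.
data Fits (n : ℕ) : ℕ → ℕ → List Bool → Set where
  end  : Fits n n 0 []
  rise : ∀ {a h w} → a < n → Fits n (suc a) (suc h) w → Fits n a h (true ∷ w)
  fall : ∀ {a h w} → Fits n a h w → Fits n a (suc h) (false ∷ w)

labels : ℕ → ℕ → List ℕ
labels n zero    = []
labels n (suc a) = (n ∸ a) ∷ labels n a

values : ℕ → List ℕ
values zero    = []
values (suc b) = suc b ∷ values b

∑L-values : ∀ ψ b → ∑L ψ (values b) ≡ ∑ b ψ
∑L-values ψ zero    = refl
∑L-values ψ (suc b) = trans (+-comm (ψ (suc b)) _) (cong (_+ ψ (suc b)) (∑L-values ψ b))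

values-≤ : ∀ {v} b → v ∈ values b → v ≤ b
values-≤ (suc b) (here refl) = ≤-refl
values-≤ (suc b) (there v∈)  = m≤n⇒m≤1+n (values-≤ b v∈)

∑-> : ∀ n c → ∑ n (λ k → ⟦ c <ᵇ k ⟧) ≡ n ∸ c
∑-> zero    c = sym (0∸n≡0 c)
∑-> (suc n) c with c <ᵇ suc n | compare< c (suc n)
... | true  | lt p = trans (cong (_+ 1) (∑-> n c)) (trans (+-comm _ 1) (sym (+-∸-assoc 1 (s≤s⁻¹ p))))
... | false | ge p = trans (+-identityʳ _) (trans (∑-> n c)
      (trans (m≤n⇒m∸n≡0 (≤-trans (n≤1+n n) p)) (sym (m≤n⇒m∸n≡0 p))))

∑-above : ∀ b c d → ∑ b (λ x → ⟦ (d <ᵇ x) ∧ (c <ᵇ x) ⟧) ≡ b ∸ (c ⊔ d)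
∑-above b c d = trans (∑-cong b (λ x _ _ → both x)) (∑-> b (c ⊔ d))
  where
  both : ∀ x → ⟦ (d <ᵇ x) ∧ (c <ᵇ x) ⟧ ≡ ⟦ (c ⊔ d) <ᵇ x ⟧
  both x with d <ᵇ x | compare< d x | c <ᵇ x | compare< c x
  ... | true  | lt p | true  | lt q = cong ⟦_⟧ (sym (<⇒true (⊔-pres-<m q p)))
  ... | true  | _    | false | ge q = cong ⟦_⟧ (sym (≥⇒false (≤-trans q (m≤m⊔n c d))))
  ... | false | ge p | _     | _    = cong ⟦_⟧ (sym (≥⇒false (≤-trans p (m≤n⊔m c d))))

∑L-labels : ∀ n a b L → a ≤ n → L ≤ n →
  ∑L (λ i → ⟦ (b <ᵇ i) ∧ (i <ᵇ L) ⟧) (labels n a) ≡ L ∸ (suc b ⊔ suc (n ∸ a))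
∑L-labels n zero    b L a≤n L≤n = sym (m≤n⇒m∸n≡0 (≤-trans (m≤n⇒m≤1+n L≤n) (m≤n⊔m (suc b) (suc n))))
∑L-labels n (suc a) b L a<n L≤n = begin
  ⟦ (b <ᵇ n ∸ a) ∧ (n ∸ a <ᵇ L) ⟧ + ∑L (λ i → ⟦ (b <ᵇ i) ∧ (i <ᵇ L) ⟧) (labels n a)
    ≡⟨ cong (⟦ (b <ᵇ n ∸ a) ∧ (n ∸ a <ᵇ L) ⟧ +_) (∑L-labels n a b L (<⇒≤ a<n) L≤n) ⟩
  ⟦ (b <ᵇ n ∸ a) ∧ (n ∸ a <ᵇ L) ⟧ + (L ∸ (suc b ⊔ suc (n ∸ a)))
    ≡⟨ widen (n ∸ a) ⟩
  L ∸ (suc b ⊔ (n ∸ a))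
    ≡⟨ cong (λ y → L ∸ (suc b ⊔ y)) (+-∸-assoc 1 a<n) ⟩
  L ∸ (suc b ⊔ suc (n ∸ suc a)) ∎
  where
  open ≡-Reasoning
  widen : ∀ y → ⟦ (b <ᵇ y) ∧ (y <ᵇ L) ⟧ + (L ∸ (suc b ⊔ suc y)) ≡ L ∸ (suc b ⊔ y)
  widen y with b <ᵇ y | compare< b y | y <ᵇ L | compare< y L
  ... | true  | lt p | true  | lt q rewrite m≤n⇒m⊔n≡n p | m≤n⇒m⊔n≡n (<⇒≤ p) = sym (+-∸-assoc 1 q)
  ... | true  | lt p | false | ge q rewrite m≤n⇒m⊔n≡n p | m≤n⇒m⊔n≡n (<⇒≤ p) = trans
        (m≤n⇒m∸n≡0 (m≤n⇒m≤1+n q)) (sym (m≤n⇒m∸n≡0 q))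
  ... | false | ge p | _     | _    rewrite m≥n⇒m⊔n≡m p | m≥n⇒m⊔n≡m (m≤n⇒m≤1+n p) = refl

crosses : ℕ × ℕ → ℕ × ℕ → Bool
crosses (i , x) (j , y) = ((i <ᵇ j) ∧ (j <ᵇ x) ∧ (x <ᵇ y)) ∨ ((x <ᵇ y) ∧ (y ≤ᵇ' i) ∧ (i <ᵇ j))

crossings : List (ℕ × ℕ) → ℕ
crossings es = ∑L (λ e → ∑L (λ e′ → ⟦ crosses e e′ ⟧) es) es

-- With all labels ≥ n ∸ a + 1 in use, the matches nested in (L , v) are those with label < L,
-- or equivalently with value > b₀; both their labels and their values are consecutive.
crossing-weight : ℕ → ℕ → ℕ → ℕ → ℕ → ℕ
crossing-weight n L b₀ a v = (L ∸ (v ⊔ suc (n ∸ a))) + (pred v ∸ (L ⊔ b₀))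

record Matching (n a b : ℕ) (st acc : List (ℕ × ℕ)) : Set where
  field
    a≤n         : a ≤ n
    keys        : map proj₁ acc ++ map proj₁ st ↭ labels n a
    vals        : map proj₂ acc ≡ values b
    -- Two views of nesting inside an open arc: opened after it, hence with smaller label, and
    -- closed after its opening, hence with value above `b₀`.
    order       : ∀ {e g} → e ∈ acc → g ∈ st → (proj₁ e <ᵇ proj₁ g) ≡ (proj₂ g <ᵇ proj₂ e)
    increasing  : AllPairs (λ g g′ → proj₁ g < proj₁ g′) st
    used        : ∀ {e} → e ∈ acc → n ∸ a < proj₁ e
    bounds      : ∀ {g} → g ∈ st → n ∸ a < proj₁ g × proj₁ g ≤ n × proj₂ g ≤ b

  val-≤ : ∀ {e} → e ∈ acc → proj₂ e ≤ b
  val-≤ e∈ = values-≤ b (subst (_ ∈_) vals (∈-map⁺ proj₂ e∈))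

module _ {n : ℕ} where
  open Matching

  Matching-start : Matching n 0 0 [] []
  Matching-start = record { a≤n = z≤n ; keys = ↭-refl ; vals = refl ; order = λ () ; increasing = []
                          ; used = λ () ; bounds = λ () }

  Matching-rise : ∀ {a b st acc} → a < n → Matching n a b st acc → Matching n (suc a) b ((n ∸ a , b) ∷ st) acc
  Matching-rise {a} {b} {st} {acc} a<n M = record
    { a≤n        = a<n
    ; keys       = ↭-trans (shift (n ∸ a) (map proj₁ acc) (map proj₁ st)) (Perm.prep (n ∸ a) (keys M))
    ; vals       = vals M
    ; order      = λ { e∈ (here refl) → trans (≥⇒false (<⇒≤ (used M e∈))) (sym (≥⇒false (val-≤ M e∈)))
                     ; e∈ (there g∈)  → order M e∈ g∈ }
    ; increasing = All.tabulate (λ g∈ → proj₁ (bounds M g∈)) ∷ increasing M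
    ; used       = λ e∈ → <-trans below (used M e∈)
    ; bounds     = λ { (here refl) → below , m∸n≤m n a , ≤-refl
                     ; (there g∈)  → case bounds M g∈ of λ { (p , q , r) → <-trans below p , q , r } }
    }
    where
    below : n ∸ suc a < n ∸ a
    below = ≤-reflexive (sym (+-∸-assoc 1 a<n))

  Matching-fall : ∀ {a b L b₀ st acc} → Matching n a b ((L , b₀) ∷ st) acc → Matching n a (suc b) st
        ((L , suc b) ∷ acc)
  Matching-fall {a} {b} {L} {b₀} {st} {acc} M = record
    { a≤n        = a≤n M
    ; keys       = ↭-trans (↭-sym (shift L (map proj₁ acc) (map proj₁ st))) (keys M)
    ; vals       = cong (suc b ∷_) (vals M)
    ; order      = λ { (here refl) g∈ → trans (<⇒true (L< g∈))
          (sym (<⇒true (s≤s (proj₂ (proj₂ (bounds M (there g∈)))))))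
                     ; (there e∈) g∈ → order M e∈ (there g∈) }
    ; increasing = rest
    ; used       = λ { (here refl) → proj₁ (bounds M (here refl)) ; (there e∈) → used M e∈ }
    ; bounds     = λ g∈ → case bounds M (there g∈) of λ { (p , q , r) → p , q , m≤n⇒m≤1+n r }
    }
    where
    rest : AllPairs (λ g g′ → proj₁ g < proj₁ g′) st
    rest with increasing M
    ... | _ ∷ r = r
    L< : ∀ {g} → g ∈ st → L < proj₁ g
    L< g∈ with increasing M
    ... | p ∷ _ = All.lookup p g∈

  -- Both disjuncts of `crosses` ask the second match for the larger value, so the match with the
  -- largest value can only come second.
  crossings-∷ : ∀ {e acc} → (∀ {e′} → e′ ∈ acc → proj₂ e′ ≤ proj₂ e) →
                crossings (e ∷ acc) ≡ crossings acc + ∑L (λ e′ → ⟦ crosses e′ e ⟧) acc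
  crossings-∷ {e} {acc} top = begin
    ⟦ crosses e e ⟧ + ∑L (λ e′ → ⟦ crosses e e′ ⟧) acc + ∑L
          (λ e′ → ⟦ crosses e′ e ⟧ + ∑L (λ e″ → ⟦ crosses e′ e″ ⟧) acc) acc
      ≡⟨ cong₂ _+_ (cong₂ _+_ (none {e} {e} ≤-refl) (∑L-0 _ acc (λ {e′} e′∈ → none {e} {e′} (top e′∈))))
            (∑L-+ _ _ acc) ⟩
    ∑L (λ e′ → ⟦ crosses e′ e ⟧) acc + crossings acc
      ≡⟨ +-comm (∑L (λ e′ → ⟦ crosses e′ e ⟧) acc) (crossings acc) ⟩
    crossings acc + ∑L (λ e′ → ⟦ crosses e′ e ⟧) acc ∎
    where
    open ≡-Reasoning
    none : ∀ {e e′} → proj₂ e′ ≤ proj₂ e → ⟦ crosses e e′ ⟧ ≡ 0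
    none {i , x} {j , y} le rewrite ≥⇒false {x} {y} le | ∧-zeroʳ (j <ᵇ x) | ∧-zeroʳ (i <ᵇ j) = refl

  -- As `x ≤ b`, a lower crossing of `(i , x)` with the new match is `b < i < L`, and an upper one
  -- is `i < L < x`, where `order` trades `i < L` for `b₀ < x`. Each condition then concerns labels
  -- alone or values alone.
  crossings-fall : ∀ {a b L b₀ st acc} → Matching n a b ((L , b₀) ∷ st) acc →
    crossings ((L , suc b) ∷ acc) ≡ crossings acc + crossing-weight n L b₀ a (suc b)
  crossings-fall {a} {b} {L} {b₀} {st} {acc} M =
    trans (crossings-∷ (λ e∈ → m≤n⇒m≤1+n (val-≤ M e∈))) (cong (crossings acc +_) (begin
      ∑L (λ e → ⟦ crosses e (L , suc b) ⟧) acc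
        ≡⟨ ∑L-cong acc (λ {e} e∈ → split (proj₁ e) (proj₂ e) (val-≤ M e∈) (order M e∈ (here refl))) ⟩
      ∑L (λ e → ⟦ (b <ᵇ proj₁ e) ∧ (proj₁ e <ᵇ L) ⟧ + ⟦ (b₀ <ᵇ proj₂ e) ∧ (L <ᵇ proj₂ e) ⟧) acc
        ≡⟨ ∑L-+ _ _ acc ⟩
      ∑L (λ e → ⟦ (b <ᵇ proj₁ e) ∧ (proj₁ e <ᵇ L) ⟧) acc + ∑L (λ e → ⟦ (b₀ <ᵇ proj₂ e) ∧ (L <ᵇ proj₂ e) ⟧) acc
        ≡⟨ cong₂ _+_ lower-sum upper-sum ⟩
      crossing-weight n L b₀ a (suc b) ∎))
    where
    open ≡-Reasoning
    split : ∀ i x → x ≤ b → (i <ᵇ L) ≡ (b₀ <ᵇ x) →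
      ⟦ crosses (i , x) (L , suc b) ⟧ ≡ ⟦ (b <ᵇ i) ∧ (i <ᵇ L) ⟧ + ⟦ (b₀ <ᵇ x) ∧ (L <ᵇ x) ⟧
    split i x x≤b o rewrite <⇒true {x} {suc b} (s≤s x≤b) | sym o
      with i <ᵇ L | compare< i L | L <ᵇ x | compare< L x | b <ᵇ i | compare< b i
    ... | true  | lt p | true  | lt q | true  | lt s = ⊥-elim (<⇒≱ (<-trans s (<-trans p q)) x≤b)
    ... | true  | _    | true  | _    | false | _    = refl
    ... | true  | _    | false | _    | true  | _    = refl
    ... | true  | _    | false | _    | false | _    = refl
    ... | false | _    | _     | _    | true  | _    = refl
    ... | false | _    | _     | _    | false | _    = refl
    upper-sum : ∑L (λ e → ⟦ (b₀ <ᵇ proj₂ e) ∧ (L <ᵇ proj₂ e) ⟧) acc ≡ b ∸ (L ⊔ b₀)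
    upper-sum = trans (sym (∑L-map (λ x → ⟦ (b₀ <ᵇ x) ∧ (L <ᵇ x) ⟧) proj₂ acc))
      (trans (cong (∑L _) (vals M)) (trans (∑L-values _ b) (∑-above b L b₀)))
    φ : ℕ → ℕ
    φ i = ⟦ (b <ᵇ i) ∧ (i <ᵇ L) ⟧
    -- Open labels are at least `L` and may be added for free; with those of `acc` they fill an
    -- interval, where counting is a subtraction.
    open-0 : ∑L φ (map proj₁ ((L , b₀) ∷ st)) ≡ 0
    open-0 = trans (∑L-map φ proj₁ ((L , b₀) ∷ st)) (∑L-0 _ ((L , b₀) ∷ st) λ {g} g∈ →
      trans (cong (λ c → ⟦ (b <ᵇ proj₁ g) ∧ c ⟧) (≥⇒false (L≤ g∈))) (cong ⟦_⟧ (∧-zeroʳ (b <ᵇ proj₁ g))))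
      where
      L≤ : ∀ {g} → g ∈ (L , b₀) ∷ st → L ≤ proj₁ g
      L≤ (here refl) = ≤-refl
      L≤ (there g∈) with increasing M
      ... | p ∷ _ = <⇒≤ (All.lookup p g∈)
    lower-sum : ∑L (φ ∘ proj₁) acc ≡ L ∸ (suc b ⊔ suc (n ∸ a))
    lower-sum = begin
      ∑L (φ ∘ proj₁) acc                                            ≡⟨ ∑L-map φ proj₁ acc ⟨
      ∑L φ (map proj₁ acc)                                          ≡⟨ +-identityʳ _ ⟨
      ∑L φ (map proj₁ acc) + 0
            ≡⟨ cong (∑L φ (map proj₁ acc) +_) (sym open-0) ⟩
      ∑L φ (map proj₁ acc) + ∑L φ (map proj₁ ((L , b₀) ∷ st))       ≡⟨ ∑L-++ φ (map proj₁ acc) _ ⟨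
      ∑L φ (map proj₁ acc ++ map proj₁ ((L , b₀) ∷ st))             ≡⟨ ∑L-↭ φ (keys M) ⟩
      ∑L φ (labels n a)
            ≡⟨ ∑L-labels n a b L (a≤n M) (proj₁ (proj₂ (bounds M (here refl)))) ⟩
      L ∸ (suc b ⊔ suc (n ∸ a))                                     ∎

  matchFrom-crossings : ∀ {a b st acc w} → Fits n a (length st) w → Matching n a b st acc →
    crossings (matchFrom n a b (map proj₁ st) acc w) ≡ crossings acc + run (crossing-weight n) n a b st w
    × map proj₁ (matchFrom n a b (map proj₁ st) acc w) ↭ labels n n
  matchFrom-crossings {st = []} {acc} end M = sym (+-identityʳ _) ,
    subst (_↭ labels n n) (++-identityʳ (map proj₁ acc)) (keys M)
  matchFrom-crossings {a} {b} {st} (rise a<n F) M = matchFrom-crossings {st = (n ∸ a , b) ∷ st} F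
        (Matching-rise a<n M)
  matchFrom-crossings {a} {b} {(L , b₀) ∷ st} {acc} {false ∷ w} (fall F) M with matchFrom-crossings
        {st = st} F (Matching-fall M)
  ... | c , k = trans c (trans (cong (_+ run (crossing-weight n) n a (suc b) st w) (crossings-fall M))
        (+-assoc (crossings acc) _ _)) , k

-- The permutation read off its list of matches.

at-applyUpTo : ∀ (g : ℕ → ℕ) n i → i < n → at (applyUpTo g n) (suc i) ≡ g i
at-applyUpTo g (suc n) zero    i<n = refl
at-applyUpTo g (suc n) (suc i) i<n = at-applyUpTo (g ∘ suc) n i (s≤s⁻¹ i<n)

at-map-range : ∀ (g : ℕ → ℕ) n i → 1 ≤ i → i ≤ n → at (map g (range n)) i ≡ g i
at-map-range g n (suc i) _ i<n = trans
  (cong (λ xs → at xs (suc i)) (trans (cong (map g) (map-applyUpTo id suc n)) (map-applyUpTo suc g n)))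
  (at-applyUpTo (g ∘ suc) n i i<n)

module Assignment {n : ℕ} (es : List (ℕ × ℕ))
                  (keys : ∀ (φ : ℕ → ℕ) → ∑L (φ ∘ proj₁) es ≡ ∑ n φ)
                  (keys≤ : ∀ {e} → e ∈ es → 1 ≤ proj₁ e × proj₁ e ≤ n) where

  private
    assoc-unique : ∀ xs {k v} → (k , v) ∈ xs → ∑L (λ e → ⟦ proj₁ e ≡ᵇ k ⟧) xs ≤ 1 → assoc k xs ≡ v
    assoc-unique ((k′ , v′) ∷ xs) {k} (here refl) once rewrite ≡⇒true {k} refl = refl
    assoc-unique ((k′ , v′) ∷ xs) {k} {v} (there e∈) once with k ≡ᵇ k′ | compare≡ k k′
    ... | false | ne k≢ = assoc-unique xs e∈ (≤-trans (m≤n+m _ _) once)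
    ... | true  | eq refl rewrite ≡⇒true {k} refl = ⊥-elim (<⇒≱ (s≤s (≤-trans
            (≤-reflexive (sym (cong ⟦_⟧ (≡⇒true {k} refl)))) (∑L-term (λ e → ⟦ proj₁ e ≡ᵇ k ⟧) e∈))) once)

  assoc-∈ : ∀ {k v} → (k , v) ∈ es → assoc k es ≡ v
  assoc-∈ {k} e∈ = assoc-unique es e∈ (≤-reflexive (trans (keys (λ i → ⟦ i ≡ᵇ k ⟧))
    (trans (∑-single n k (proj₁ (keys≤ e∈)) (proj₂ (keys≤ e∈)) (λ i _ _ i≢k → cong ⟦_⟧ (≢⇒false i≢k)))
          (cong ⟦_⟧ (≡⇒true {k} refl)))))

  τ : List ℕ
  τ = map (λ i → assoc i es) (range n)

  length-τ : length τ ≡ n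
  length-τ = trans (length-map _ (range n)) (length-range n)

  -- The list `es` is the graph of `τ`: each position occurs once as a key, so lookup returns its
  -- partner. All three statistics are sums over this graph.
  ∑-τ : ∀ (F : ℕ × ℕ → ℕ) → ∑ n (λ i → F (i , at τ i)) ≡ ∑L F es
  ∑-τ F = begin
    ∑ n (λ i → F (i , at τ i))         ≡⟨ ∑-cong n
          (λ i a b → cong (λ x → F (i , x)) (at-map-range (λ k → assoc k es) n i a b)) ⟩
    ∑ n (λ i → F (i , assoc i es))     ≡⟨ keys (λ i → F (i , assoc i es)) ⟨
    ∑L (λ e → F (proj₁ e , assoc (proj₁ e) es)) es
      ≡⟨ ∑L-cong es (λ { {k , v} e∈ → cong (λ x → F (k , x)) (assoc-∈ e∈) }) ⟩
    ∑L F es                            ∎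
    where open ≡-Reasoning

  fp-τ : fp τ ≡ ∑L (λ e → ⟦ proj₂ e ≡ᵇ proj₁ e ⟧) es
  fp-τ = trans (cong (λ m → count (λ i → at τ i ≡ᵇ i) (range m)) length-τ)
        (trans (count-range (λ i → at τ i ≡ᵇ i) n) (∑-τ (λ e → ⟦ proj₂ e ≡ᵇ proj₁ e ⟧)))

  exc-τ : exc τ ≡ ∑L (λ e → ⟦ proj₁ e <ᵇ proj₂ e ⟧) es
  exc-τ = trans (cong (λ m → count (λ i → i <ᵇ at τ i) (range m)) length-τ)
         (trans (count-range (λ i → i <ᵇ at τ i) n) (∑-τ (λ e → ⟦ proj₁ e <ᵇ proj₂ e ⟧)))

  crs-τ : crs τ ≡ crossings es
  crs-τ = begin
    crs τ
          ≡⟨ cong (λ m → count (isCrossing τ) (pairs m)) length-τ ⟩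
    count (isCrossing τ) (pairs n)                                  ≡⟨ count-pairs (isCrossing τ) n ⟩
    ∑ n (λ i → ∑ n (λ j → ⟦ crosses (i , at τ i) (j , at τ j) ⟧))
          ≡⟨ ∑-cong n (λ i _ _ → ∑-τ (λ e → ⟦ crosses (i , at τ i) e ⟧)) ⟩
    ∑ n (λ i → ∑L (λ e → ⟦ crosses (i , at τ i) e ⟧) es)
          ≡⟨ ∑-τ (λ e → ∑L (λ e′ → ⟦ crosses e e′ ⟧) es) ⟩
    crossings es                                                    ∎
    where open ≡-Reasoning

∑L-labels-all : ∀ (φ : ℕ → ℕ) n → ∑L φ (labels n n) ≡ ∑ n φ
∑L-labels-all φ n = trans (sym (trans (cong (λ m → ∑L φ (labels n n) + ∑ m φ) (n∸n≡0 n)) (+-identityʳ _)))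
      (go n ≤-refl)
  where
  go : ∀ a → a ≤ n → ∑L φ (labels n a) + ∑ (n ∸ a) φ ≡ ∑ n φ
  go zero    a≤n = refl
  go (suc a) a<n = trans (sym (rotate (φ (n ∸ a)) (∑L φ (labels n a)) (∑ (n ∸ suc a) φ)))
        (trans (cong (∑L φ (labels n a) +_) last) (go a (<⇒≤ a<n)))
    where
    last : ∑ (n ∸ suc a) φ + φ (n ∸ a) ≡ ∑ (n ∸ a) φ
    last rewrite +-∸-assoc 1 a<n = refl
    rotate : ∀ x y z → y + (z + x) ≡ x + y + z
    rotate x y z = trans (sym (+-assoc y z x)) (trans (+-comm (y + z) x) (sym (+-assoc x y z)))

labels-bounds : ∀ {n x} a → a ≤ n → x ∈ labels n a → 1 ≤ x × x ≤ n
labels-bounds {n} (suc a) a<n (here refl) = m<n⇒0<n∸m a<n , m∸n≤m n a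
labels-bounds     (suc a) a<n (there x∈)  = labels-bounds a (<⇒≤ a<n) x∈

∑L-zip-map : ∀ {A B C : Set} (F : A × C → ℕ) (g : B → A) xs ys → ∑L F (zip (map g xs) ys) ≡ ∑L (F ∘ map₁ g)
      (zip xs ys)
∑L-zip-map F g []       ys       = refl
∑L-zip-map F g (x ∷ xs) []       = refl
∑L-zip-map F g (x ∷ xs) (y ∷ ys) = cong (F (g x , y) +_) (∑L-zip-map F g xs ys)

reverse-range-suc : ∀ k → reverse (range (suc k)) ≡ suc k ∷ reverse (range k)
reverse-range-suc k = trans (cong reverse (range-suc k)) (reverse-++ (range k) (suc k ∷ []))

map-range-suc : ∀ (w : ℕ → Bool) k rest → map w (range (suc k)) ++ rest ≡ map w (range k) ++ (w (suc k) ∷ rest)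
map-range-suc w k rest = trans (cong (_++ rest) (trans (cong (map w) (range-suc k))
      (map-++ w (range k) (suc k ∷ []))))
                               (++-assoc (map w (range k)) (w (suc k) ∷ []) rest)

-- The matching run along the two half-paths.

module Path (h : ℕ → ℕ → ℕ → ℕ → ℕ) (n : ℕ) where

  module Left (w : ℕ → Bool) where
    open Word w

    -- The push at `i` is up-step number `up i`; counting labels down from `n` gives it
    -- `n + 1 − up i`.
    entry : ℕ → ℕ × ℕ
    entry i = suc n ∸ up i , down i

    closing : ℕ → ℕ → ℕ
    closing k i = h (suc n ∸ up i) (down i) (up k) (suc (down k))

    run-left : ∀ k rest → run h n 0 0 [] (map w (range k) ++ rest)
                          ≡ closings closing k + run h n (up k) (down k) (map entry (stack k)) rest
    run-left zero    rest = refl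
    run-left (suc k) rest = trans (cong (run h n 0 0 []) (map-range-suc w k rest))
                                  (trans (run-left k (w (suc k) ∷ rest)) (last (w (suc k)) refl))
      where
      last : ∀ c → w (suc k) ≡ c → closings closing k + run h n (up k) (down k) (map entry (stack k)) (c ∷ rest)
             ≡ closings closing (suc k) + run h n (up (suc k)) (down (suc k)) (map entry (stack (suc k))) rest
      last true e rewrite closings-push e closing | stack-push e | up-push e | down-push e = refl
      last false e rewrite closings-pop e closing | stack-pop e | up-pop e | down-pop e with stack k
      ... | []     = refl
      ... | i ∷ xs = trans (sym (+-assoc (closings closing k) _ _))
                           (cong (_+ run h n (up k) (suc (down k)) (map entry xs) rest)
                                 (+-comm (closings closing k) _))

    fits-left : Ballot n → ∀ k rest → k ≤ n → Fits n (up k) (length (stack k)) rest → Fits n 0 0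
          (map w (range k) ++ rest)
    fits-left ballot zero    rest k≤n F = F
    fits-left ballot (suc k) rest k<n F = subst (Fits n 0 0) (sym (map-range-suc w k rest))
                                            (fits-left ballot k (w (suc k) ∷ rest) (<⇒≤ k<n)
                                                  (next (w (suc k)) refl))
      where
      next : ∀ c → w (suc k) ≡ c → Fits n (up k) (length (stack k)) (c ∷ rest)
      next true  e = rise (≤-<-trans (≤-trans (m≤m+n (up k) (down k)) (≤-reflexive (up+down k))) k<n)
                          (subst₂ (λ a xs → Fits n a (length xs) rest) (up-push e) (stack-push e) F)
      next false e with stack k in f | subst₂ (λ a xs → Fits n a (length xs) rest) (up-pop e) (stack-pop e) F
      ... | []     | _  = ⊥-elim (stack-pop-nonempty ballot k<n e f)
      ... | _ ∷ xs | F′ = fall F′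

  module Right (w : ℕ → Bool) (u : ℕ → Bool) (u≡ : ∀ k → u k ≡ not (w k)) where
    open Word w

    suffix : ℕ → List Bool
    suffix k = map u (reverse (range k))

    suffix-suc : ∀ k → suffix (suc k) ≡ not (w (suc k)) ∷ suffix k
    suffix-suc k = trans (cong (map u) (reverse-range-suc k)) (cong (_∷ suffix k) (u≡ (suc k)))

    -- The right half is read against its word, so counts become complements. At `j` there remain
    -- `down j` up-steps, and `up j` down-steps including the present one, whose label is therefore
    -- `n + 1 − up j`.
    closed : (ℕ × ℕ) × ℕ → ℕ
    closed ((L , b₀) , j) = h L b₀ (n ∸ down j) (suc n ∸ up j)

    closing : ℕ → ℕ → ℕ
    closing k j = closed ((down (suc k) , n ∸ up (suc k)) , j)

    private
      complement : ∀ {x y m} → x + y ≡ m → x ≡ m ∸ y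
      complement {x} {y} refl = sym (m+n∸n≡m x y)

    module _ (ballot : Ballot n) where

      -- The stack of the reversed word foretells, top first, which down-steps will close the labels
      -- now open. An up-step of the path at `suc k` is a pop of the word, and the entry it pops is
      -- its future partner.
      run-right : ∀ k {a b} st → k ≤ n → a + down k ≡ n → b + up k ≡ n → length st ≡ length (stack k) →
        run h n a b st (suffix k) ≡ ∑L closed (zip st (stack k)) + closings closing k
      run-right zero            []  k≤n ea eb l = refl
      run-right (suc k) {a} {b} st₀ k<n ea eb l₀ =
        trans (cong (run h n a b st₀) (suffix-suc k)) (next st₀ l₀ (w (suc k)) refl)
        where
        v≡ : suc b ≡ suc n ∸ up (suc k)
        v≡ = complement (cong suc eb)
        label≡ : n ∸ a ≡ down (suc k)
        label≡ = sym (complement (trans (+-comm (down (suc k)) a) ea))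
        next : ∀ st → length st ≡ length (stack (suc k)) → ∀ c → w (suc k) ≡ c →
               run h n a b st (not c ∷ suffix k) ≡ ∑L closed (zip st (stack (suc k))) + closings closing (suc k)
        next [] l true e = case trans l (cong length (stack-push e)) of λ ()
        next ((L , b₀) ∷ st) l true e = trans
          (cong₂ _+_ (cong₂ (h L b₀) (complement ea) v≡)
                     (run-right k st (<⇒≤ k<n) (trans (cong (a +_) (sym (down-push e))) ea)
                       (trans (sym (+-suc b (up k))) (trans (cong (b +_) (sym (up-push e))) eb))
                       (suc-injective (trans l (cong length (stack-push e))))))
          (trans (sym (+-assoc (closed ((L , b₀) , suc k)) (∑L closed (zip st (stack k))) (closings closing k)))
                 (sym (cong₂ (λ xs c → ∑L closed (zip ((L , b₀) ∷ st) xs) + c) (stack-push e)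
                       (closings-push e closing))))
        next st l false e = unfold (stack k) refl
          (run-right k ((n ∸ a , b) ∷ st) (<⇒≤ k<n)
             (trans (sym (+-suc a (down k))) (trans (cong (a +_) (sym (down-pop e))) ea))
             (trans (cong (b +_) (sym (up-pop e))) eb))
          where
          unfold : ∀ ys → stack k ≡ ys →
            (suc (length st) ≡ length (stack k) →
             run h n (suc a) b ((n ∸ a , b) ∷ st) (suffix k) ≡ ∑L closed (zip ((n ∸ a , b) ∷ st) (stack k))
                   + closings closing k) →
            run h n (suc a) b ((n ∸ a , b) ∷ st) (suffix k) ≡ ∑L closed (zip st (stack (suc k))) + closings
                  closing (suc k)
          unfold []       f ih = ⊥-elim (stack-pop-nonempty ballot k<n e f)
          unfold (j ∷ xs) f ih = trans (ih (trans (cong suc (trans l (cong length pop))) (cong length (sym f))))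
            (trans (cong₂ (λ g ys → ∑L closed (zip (g ∷ st) ys) + closings closing k)
                  (cong₂ _,_ label≡ (complement eb)) f)
            (trans (exchange (closing k j) (∑L closed (zip st xs)) (closings closing k))
            (sym (cong₂ (λ ys c → ∑L closed (zip st ys) + c) pop (trans (closings-pop e closing)
                   (cong (λ ys → onTop (closing k) ys + closings closing k) f))))))
            where
            pop : stack (suc k) ≡ xs
            pop = trans (stack-pop e) (cong (drop 1) f)
            exchange : ∀ x y z → x + y + z ≡ y + (x + z)
            exchange x y z = trans (cong (_+ z) (+-comm x y)) (+-assoc y x z)

      fits-right : ∀ k {a} → k ≤ n → a + down k ≡ n → Fits n a (length (stack k)) (suffix k)
      fits-right zero    {a} k≤n ea = subst (λ m → Fits n m 0 []) (trans (sym ea) (+-identityʳ a)) end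
      fits-right (suc k) {a} k<n ea = subst (Fits n a (length (stack (suc k)))) (sym (suffix-suc k))
            (next (w (suc k)) refl)
        where
        next : ∀ c → w (suc k) ≡ c → Fits n a (length (stack (suc k))) (not c ∷ suffix k)
        next true e = subst (λ xs → Fits n a (length xs) (false ∷ suffix k)) (sym (stack-push e))
          (fall (fits-right k (<⇒≤ k<n) (trans (cong (a +_) (sym (down-push e))) ea)))
        next false e = unfold (stack k) refl (fits-right k {suc a} (<⇒≤ k<n)
              (trans (sym (+-suc a (down k))) (trans (cong (a +_) (sym (down-pop e))) ea)))
          where
          a<n : a < n
          a<n = ≤-trans (≤-reflexive (+-comm 1 a))
                (≤-trans (+-monoʳ-≤ a (≤-trans (s≤s z≤n) (≤-reflexive (sym (down-pop e))))) (≤-reflexive ea))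
          unfold : ∀ ys → stack k ≡ ys → Fits n (suc a) (length (stack k)) (suffix k) → Fits n a
                (length (stack (suc k))) (true ∷ suffix k)
          unfold []       f F = ⊥-elim (stack-pop-nonempty ballot k<n e f)
          unfold (j ∷ xs) f F = subst (λ ys → Fits n a (length ys) (true ∷ suffix k))
                (sym (trans (stack-pop e) (cong (drop 1) f)))
                                  (rise a<n (subst (λ ys → Fits n (suc a) (length ys) (suffix k)) f F))

-- Statistics of the matching of a path

∸-∸-cancel : ∀ {m} a b → b ≤ m → (m ∸ a) ∸ (m ∸ b) ≡ b ∸ a
∸-∸-cancel a b b≤m with m≤n⇒∃[o]m+o≡n b≤m
... | c , refl = begin
  (b + c ∸ a) ∸ (b + c ∸ b)   ≡⟨ cong ((b + c ∸ a) ∸_) (m+n∸m≡n b c) ⟩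
  (b + c ∸ a) ∸ c             ≡⟨ ∸-+-assoc (b + c) a c ⟩
  b + c ∸ (a + c)             ≡⟨ cong₂ _∸_ (+-comm b c) (+-comm a c) ⟩
  c + b ∸ (c + a)             ≡⟨ [m+n]∸[m+o]≡n∸o c b a ⟩
  b ∸ a                       ∎
  where open ≡-Reasoning

-- The weight of a strand in `crs` falls short of its `spread` by one exactly when it is an
-- excedance; in crs + exc this identity makes up the difference.
∸-step : ∀ a b → a ∸ b ≡ (a ∸ suc b) + ⟦ b <ᵇ a ⟧
∸-step zero    zero    = refl
∸-step zero    (suc b) = refl
∸-step (suc a) zero    = +-comm 1 a
∸-step (suc a) (suc b) = ∸-step a b

excedance-weight fixed-weight : ℕ → ℕ → ℕ → ℕ → ℕ
excedance-weight L _ _ v = ⟦ L <ᵇ v ⟧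
fixed-weight     L _ _ v = ⟦ v ≡ᵇ L ⟧

module _ {n u d k i : ℕ} (u+d : u + d ≡ k) (k<n : k < n) (i≤u : i ≤ u) where
  private
    d+i<n : d + i < n
    d+i<n = ≤-<-trans (≤-trans (≤-reflexive (+-comm d i)) (≤-trans (+-monoˡ-≤ d i≤u) (≤-reflexive u+d))) k<n
    below : suc (suc d) ≤ suc n ∸ i
    below = m+n≤o⇒m≤o∸n (suc (suc d)) (s≤s d+i<n)
    u≤n : u ≤ n
    u≤n = ≤-trans (m≤m+n u d) (≤-trans (≤-reflexive u+d) (<⇒≤ k<n))

  left-excedance : ∀ b a → excedance-weight (suc n ∸ i) b a (suc d) ≡ 0
  left-excedance b a = cong ⟦_⟧ (≥⇒false (<⇒≤ below))

  left-fixed : ∀ b a → fixed-weight (suc n ∸ i) b a (suc d) ≡ 0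
  left-fixed b a = cong ⟦_⟧ (≢⇒false (<⇒≢ below))

  -- Left of the centre the value `d + 1` is at most `n + 1 − u`, the least label in use, so every
  -- nested label counts and the value part of the weight vanishes.
  left-crossing : ∀ b → crossing-weight n (suc n ∸ i) b u (suc d) ≡ u ∸ i
  left-crossing b = trans (cong₂ _+_
    (trans (cong ((suc n ∸ i) ∸_) (trans (m≤n⇒m⊔n≡n d≤) (sym (+-∸-assoc 1 u≤n))))
          (∸-∸-cancel i u (m≤n⇒m≤1+n u≤n)))
    (m≤n⇒m∸n≡0 (≤-trans (≤-trans (n≤1+n d) (<⇒≤ below)) (m≤m⊔n (suc n ∸ i) b)))) (+-identityʳ (u ∸ i))
    where
    d≤ : suc d ≤ suc (n ∸ u)
    d≤ = s≤s (m+n≤o⇒m≤o∸n d (≤-trans (≤-reflexive (trans (+-comm d u) u+d)) (<⇒≤ k<n)))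

module _ {n u d j : ℕ} (u+d : u + d ≤ n) (j≤u : j ≤ u) where
  private
    u≤n : u ≤ n
    u≤n = ≤-trans (m≤m+n u d) u+d
    suc∸ : suc n ∸ j ≡ suc (n ∸ j)
    suc∸ = +-∸-assoc 1 (≤-trans j≤u u≤n)
    d≤n∸u : d ≤ n ∸ u
    d≤n∸u = m+n≤o⇒m≤o∸n d (≤-trans (≤-reflexive (+-comm d u)) u+d)
    below : d < suc n ∸ j
    below = ≤-trans (s≤s (≤-trans d≤n∸u (∸-monoʳ-≤ n j≤u))) (≤-reflexive (sym suc∸))

  right-excedance : ∀ b a → excedance-weight d b a (suc n ∸ j) ≡ 1
  right-excedance b a = cong ⟦_⟧ (<⇒true below)

  right-fixed : ∀ b a → fixed-weight d b a (suc n ∸ j) ≡ 0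
  right-fixed b a = cong ⟦_⟧ (≢⇒false (<⇒≢ below ∘ sym))

  -- Here the label is below the value and at most `b₀ = n − u`, so the label part vanishes and
  -- every nested value counts.
  right-crossing : ∀ a → crossing-weight n d (n ∸ u) a (suc n ∸ j) ≡ u ∸ j
  right-crossing a = cong₂ _+_
    (m≤n⇒m∸n≡0 (≤-trans (<⇒≤ below) (m≤m⊔n (suc n ∸ j) _)))
    (trans (cong₂ _∸_ (cong pred suc∸) (m≤n⇒m⊔n≡n d≤n∸u)) (∸-∸-cancel j u u≤n))

module _ {n A B d d′ i j : ℕ} (A+d : A + d ≡ i) (i≤n : i ≤ n) (B+d : B + d′ ≡ j) (j≤n : j ≤ n) where
  private
    A≤n : A ≤ n
    A≤n = ≤-trans (m≤m+n A d) (≤-trans (≤-reflexive A+d) i≤n)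
    B≤n : B ≤ n
    B≤n = ≤-trans (m≤m+n B d′) (≤-trans (≤-reflexive B+d) j≤n)
    d′≤n : d′ ≤ n
    d′≤n = ≤-trans (m≤n+m d′ B) (≤-trans (≤-reflexive B+d) j≤n)
    sucB : suc n ∸ B ≡ suc (n ∸ B)
    sucB = +-∸-assoc 1 B≤n

  strand-excedance : ∀ b a → excedance-weight (suc n ∸ A) b a (suc n ∸ B) ≡ ⟦ B <ᵇ A ⟧
  strand-excedance b a = cong ⟦_⟧ flip
    where
    flip : (suc n ∸ A <ᵇ suc n ∸ B) ≡ (B <ᵇ A)
    flip with B <ᵇ A | compare< B A
    ... | true  | lt p = <⇒true (∸-monoʳ-< p (m≤n⇒m≤1+n A≤n))
    ... | false | ge p = ≥⇒false (∸-monoʳ-≤ (suc n) p)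

  strand-fixed : ∀ b a → fixed-weight (suc n ∸ A) b a (suc n ∸ B) ≡ ⟦ A ≡ᵇ B ⟧
  strand-fixed b a = cong ⟦_⟧ flip
    where
    flip : (suc n ∸ B ≡ᵇ suc n ∸ A) ≡ (A ≡ᵇ B)
    flip with A ≡ᵇ B | compare≡ A B
    ... | true  | eq refl = ≡⇒true {suc n ∸ A} refl
    ... | false | ne p    = ≢⇒false (λ q → p (sym (∸-cancelˡ-≡ (m≤n⇒m≤1+n B≤n) (m≤n⇒m≤1+n A≤n) q)))

  -- Across the centre both maxima in the weight are decided by the label `L` and the value `v`
  -- themselves, leaving `(L ∸ v) + (v ∸ 1 ∸ L)`.
  strand-crossing : crossing-weight n (suc n ∸ A) d (n ∸ d′) (suc n ∸ B) ≡ (B ∸ A) + (A ∸ suc B)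
  strand-crossing = cong₂ _+_
    (trans (cong ((suc n ∸ A) ∸_) (m≥n⇒m⊔n≡m after)) (∸-∸-cancel A B (m≤n⇒m≤1+n B≤n)))
    (trans (cong₂ _∸_ (cong pred sucB) (m≥n⇒m⊔n≡m before)) (∸-∸-cancel (suc B) A (m≤n⇒m≤1+n A≤n)))
    where
    after : suc (n ∸ (n ∸ d′)) ≤ suc n ∸ B
    after = ≤-trans (s≤s (≤-trans (≤-reflexive (m∸[m∸n]≡n d′≤n))
      (m+n≤o⇒m≤o∸n d′ (≤-trans (≤-reflexive (trans (+-comm d′ B) B+d)) j≤n)))) (≤-reflexive (sym sucB))
    before : d ≤ suc n ∸ A
    before = ≤-trans (m+n≤o⇒m≤o∸n d (≤-trans (≤-reflexive (trans (+-comm d A) A+d)) i≤n))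
      (∸-monoˡ-≤ A (n≤1+n n))

module Image {n : ℕ} (w w′ u : ℕ → Bool) (u≡ : ∀ k → u k ≡ not (w′ k))
             (ballot : Word.Ballot w n) (ballot′ : Word.Ballot w′ n)
             (down≡ : Word.down w n ≡ Word.down w′ n)
             (open≡ : length (Word.stack w n) ≡ length (Word.stack w′ n)) where
  module 𝓛 = Word w
  module 𝓡 = Word w′

  path : List Bool
  path = map w (range n) ++ map u (reverse (range n))

  matches : List (ℕ × ℕ)
  matches = matchFrom n 0 0 [] [] path

  private
    end-a : 𝓛.up n + 𝓡.down n ≡ n
    end-a = trans (cong (𝓛.up n +_) (sym down≡)) (𝓛.up+down n)
    end-b : 𝓛.down n + 𝓡.up n ≡ n
    end-b = trans (cong (_+ 𝓡.up n) down≡) (trans (+-comm (𝓡.down n) (𝓡.up n)) (𝓡.up+down n))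

    fits : Fits n 0 0 path
    fits = Path.Left.fits-left fixed-weight n w ballot n _ ≤-refl
      (subst (λ l → Fits n (𝓛.up n) l _) (sym open≡)
            (Path.Right.fits-right fixed-weight n w′ u u≡ ballot′ n ≤-refl end-a))

    final = matchFrom-crossings {st = []} fits Matching-start

    keys : ∀ (φ : ℕ → ℕ) → ∑L (φ ∘ proj₁) matches ≡ ∑ n φ
    keys φ = trans (sym (∑L-map φ proj₁ matches)) (trans (∑L-↭ φ (proj₂ final)) (∑L-labels-all φ n))

    keys≤ : ∀ {e} → e ∈ matches → 1 ≤ proj₁ e × proj₁ e ≤ n
    keys≤ e∈ = labels-bounds n ≤-refl (∈-resp-↭ (proj₂ final) (∈-map⁺ proj₁ e∈))

  open Assignment matches keys keys≤ public

  strands : List (ℕ × ℕ)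
  strands = zip (𝓛.stack n) (𝓡.stack n)

  private
    S : 𝓛.Stack n (𝓛.stack n)
    S = 𝓛.stack-Stack ballot n ≤-refl
    S′ : 𝓡.Stack n (𝓡.stack n)
    S′ = 𝓡.stack-Stack ballot′ n ≤-refl

  run-path : ∀ h {F G H} →
    (∀ k i → k < n → i ∈ 𝓛.stack k → h (suc n ∸ 𝓛.up i) (𝓛.down i) (𝓛.up k) (suc (𝓛.down k)) ≡ F k i) →
    (∀ k j → k < n → w′ (suc k) ≡ false → j ∈ 𝓡.stack k →
       h (𝓡.down (suc k)) (n ∸ 𝓡.up (suc k)) (n ∸ 𝓡.down j) (suc n ∸ 𝓡.up j) ≡ G k j) →
    (∀ i j → i ≤ n → j ≤ n → h (suc n ∸ 𝓛.up i) (𝓛.down i) (n ∸ 𝓡.down j) (suc n ∸ 𝓡.up j) ≡ H (i , j)) →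
    run h n 0 0 [] path ≡ 𝓛.closings F n + (∑L H strands + 𝓡.closings G n)
  run-path h {F} {G} {H} left right strand = begin
    run h n 0 0 [] path
      ≡⟨ run-left n (suffix n) ⟩
    𝓛.closings L.closing n + run h n (𝓛.up n) (𝓛.down n) (map entry (𝓛.stack n)) (suffix n)
      ≡⟨ cong₂ _+_ (𝓛.closings-cong n (λ k i k<n _ i∈ → left k i k<n i∈))
           (run-right ballot′ n (map entry (𝓛.stack n)) ≤-refl end-a end-b
                 (trans (length-map entry (𝓛.stack n)) open≡)) ⟩
    𝓛.closings F n + (∑L closed (zip (map entry (𝓛.stack n)) (𝓡.stack n)) + 𝓡.closings R.closing n)
      ≡⟨ cong₂ (λ a b → 𝓛.closings F n + (a + b))
           (trans (∑L-zip-map closed entry (𝓛.stack n) (𝓡.stack n))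
                  (∑L-cong strands (λ { {i , j} e∈ → strand i j (Facing.i≤n (facing-strand e∈))
                        (Facing.j≤n (facing-strand e∈)) })))
           (𝓡.closings-cong n right) ⟩
    𝓛.closings F n + (∑L H strands + 𝓡.closings G n) ∎
    where
    open ≡-Reasoning
    module L = Path.Left h n w
    module R = Path.Right h n w′ u u≡
    open L using (entry; run-left)
    open R using (suffix; closed; run-right)
    facing-strand : ∀ {e} → e ∈ strands → Facing n 𝓛.up 𝓡.up e
    facing-strand = Stack-zip open≡ S S′

  private
    left-≤ : ∀ k i → k < n → i ∈ 𝓛.stack k → 𝓛.up i ≤ 𝓛.up k
    left-≤ k i k<n i∈ = 𝓛.up-mono (proj₁ (proj₂ (𝓛.Stack-∈ (𝓛.stack-Stack ballot k (<⇒≤ k<n)) i∈)))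
    right-≤ : ∀ k j → k < n → j ∈ 𝓡.stack k → 𝓡.up j ≤ 𝓡.up (suc k)
    right-≤ k j k<n j∈ = 𝓡.up-mono (m≤n⇒m≤1+n (proj₁ (proj₂ (𝓡.Stack-∈ (𝓡.stack-Stack ballot′ k (<⇒≤ k<n)) j∈))))
    right-+ : ∀ k → k < n → 𝓡.up (suc k) + 𝓡.down (suc k) ≤ n
    right-+ k k<n = ≤-trans (≤-reflexive (𝓡.up+down (suc k))) k<n

  fp-image : fp τ ≡ ∑L (λ e → ⟦ 𝓛.up (proj₁ e) ≡ᵇ 𝓡.up (proj₂ e) ⟧) strands
  fp-image = begin
    fp τ                                               ≡⟨ fp-τ ⟩
    ∑L (λ e → ⟦ proj₂ e ≡ᵇ proj₁ e ⟧) matches          ≡⟨ ∑L-matchFrom _ n 0 0 [] [] path ⟩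
    run fixed-weight n 0 0 [] path
      ≡⟨ run-path fixed-weight (λ k i k<n i∈ → left-fixed (𝓛.up+down k) k<n (left-≤ k i k<n i∈) (𝓛.down i)
            (𝓛.up k))
                               (λ k j k<n _ j∈ → right-fixed (right-+ k k<n) (right-≤ k j k<n j∈)
                                     (n ∸ 𝓡.up (suc k)) (n ∸ 𝓡.down j))
                               (λ i j i≤n j≤n → strand-fixed {A = 𝓛.up i} {𝓡.up j} {𝓛.down i} {𝓡.down j}
                                     (𝓛.up+down i) i≤n (𝓡.up+down j) j≤n (𝓛.down i) (n ∸ 𝓡.down j)) ⟩
    𝓛.closings (λ _ _ → 0) n + (∑L (λ e → ⟦ 𝓛.up (proj₁ e) ≡ᵇ 𝓡.up (proj₂ e) ⟧) strands + 𝓡.closings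
          (λ _ _ → 0) n)
      ≡⟨ cong₂ (λ a b → a + (∑L (λ e → ⟦ 𝓛.up (proj₁ e) ≡ᵇ 𝓡.up (proj₂ e) ⟧) strands + b)) (𝓛.closings-0 n)
            (𝓡.closings-0 n) ⟩
    ∑L (λ e → ⟦ 𝓛.up (proj₁ e) ≡ᵇ 𝓡.up (proj₂ e) ⟧) strands + 0
      ≡⟨ +-identityʳ _ ⟩
    ∑L (λ e → ⟦ 𝓛.up (proj₁ e) ≡ᵇ 𝓡.up (proj₂ e) ⟧) strands ∎
    where open ≡-Reasoning

  exc-image : exc τ ≡ 𝓡.down n + ∑L (λ e → ⟦ 𝓡.up (proj₂ e) <ᵇ 𝓛.up (proj₁ e) ⟧) strands
  exc-image = begin
    exc τ                                              ≡⟨ exc-τ ⟩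
    ∑L (λ e → ⟦ proj₁ e <ᵇ proj₂ e ⟧) matches          ≡⟨ ∑L-matchFrom _ n 0 0 [] [] path ⟩
    run excedance-weight n 0 0 [] path
      ≡⟨ run-path excedance-weight (λ k i k<n i∈ → left-excedance (𝓛.up+down k) k<n (left-≤ k i k<n i∈)
            (𝓛.down i) (𝓛.up k))
                               (λ k j k<n _ j∈ → right-excedance (right-+ k k<n) (right-≤ k j k<n j∈)
                                     (n ∸ 𝓡.up (suc k)) (n ∸ 𝓡.down j))
                               (λ i j i≤n j≤n → strand-excedance {A = 𝓛.up i} {𝓡.up j} {𝓛.down i} {𝓡.down j}
                                     (𝓛.up+down i) i≤n (𝓡.up+down j) j≤n (𝓛.down i) (n ∸ 𝓡.down j)) ⟩
    𝓛.closings (λ _ _ → 0) n + (X + 𝓡.closings (λ _ _ → 1) n)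
      ≡⟨ cong₂ (λ a b → a + (X + b)) (𝓛.closings-0 n) (𝓡.closings-1 ballot′ n ≤-refl) ⟩
    X + 𝓡.down n
      ≡⟨ +-comm X (𝓡.down n) ⟩
    𝓡.down n + X ∎
    where
    open ≡-Reasoning
    X = ∑L (λ e → ⟦ 𝓡.up (proj₂ e) <ᵇ 𝓛.up (proj₁ e) ⟧) strands

  crs-image : crs τ ≡ 𝓛.nested n + (∑L (λ e → (𝓡.up (proj₂ e) ∸ 𝓛.up (proj₁ e)) +
        (𝓛.up (proj₁ e) ∸ suc (𝓡.up (proj₂ e)))) strands + 𝓡.nested n)
  crs-image = trans crs-τ (trans (proj₁ final) (run-path (crossing-weight n)
    (λ k i k<n i∈ → left-crossing (𝓛.up+down k) k<n (left-≤ k i k<n i∈) (𝓛.down i))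
    -- A right tunnel is closed at a pop of the reversed word, where `up (suc k)` equals `up k`, the
    -- form that `nested` uses.
    (λ k j k<n e j∈ → trans (right-crossing (right-+ k k<n) (right-≤ k j k<n j∈) (n ∸ 𝓡.down j))
          (cong (_∸ 𝓡.up j) (𝓡.up-pop e)))
    (λ i j i≤n j≤n → strand-crossing {A = 𝓛.up i} {𝓡.up j} {𝓛.down i} {𝓡.down j} (𝓛.up+down i) i≤n
          (𝓡.up+down j) j≤n)))

-- Comparison of the statistics of `σ` and `Θ σ`.

module _ {n : ℕ} {f : ℕ → ℕ} (av : Avoiding321 n f) where
  open Insertion av
  open Permutation av

  Invariant-start : Invariant 0 [] []
  Invariant-start = [] , [] , no-row ,
    record { valid = λ () ; bumped! = [] ; bumping! = []
           ; greedy = λ { _ i<s z≤n _ → case i<s of λ () } } ,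
    record { sorted = [] ; sound = λ () ; complete = λ { 1≤i z≤n → case 1≤i of λ () } }

  Tableaux-rows : ∀ {P Q R M} → Tableaux P Q R M →
                  row 0 P ≡ R × row 1 Q ≡ map proj₂ M
  Tableaux-rows no-row   = refl , refl
  Tableaux-rows one-row  = refl , refl
  Tableaux-rows two-rows = refl , refl

  -- Ψ tests membership in the first row of `P`, whereas the history lists what was bumped out of
  -- it; once all of `σ` is inserted the two are complementary.
  bumped≡¬first-row : ∀ {R M} → Bumping n M → FirstRow n M R →
    ∀ k → 1 ≤ k → k ≤ n → ⟦ elem k (map (f ∘ proj₁) M) ⟧ ≡ ⟦ not (elem k R) ⟧
  bumped≡¬first-row {R} {M} B F k 1≤k k≤n with surjective 1≤k k≤n
  ... | i , 1≤i , i≤n , refl with FirstRow.complete F 1≤i i≤n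
  ...   | inj₂ fi∈ = trans (cong ⟦_⟧ (∉⇒elem (f i) _ absent)) (cong (λ c → ⟦ not c ⟧) (sym (∈⇒elem (f i) R fi∈)))
    where
    absent : f i ∉ map (f ∘ proj₁) M
    absent fi∈M with FirstRow.sound F fi∈ | ∈-map⁻ (f ∘ proj₁) fi∈M
    ... | i′ , a , b , c , i′∉ | (i″ , s) , e∈ , q = i′∉ s (subst (λ l → (l , s) ∈ M)
      (injective (proj₁ (Bumping.valid B e∈)) (<⇒≤
            (<-≤-trans (proj₁ (proj₂ (Bumping.valid B e∈))) (proj₁ (proj₂ (proj₂ (Bumping.valid B e∈)))))) a b
        (trans (sym q) (sym c))) e∈)
  ...   | inj₁ (s , e∈) = trans (cong ⟦_⟧ (∈⇒elem (f i) _ (∈-map⁺ (f ∘ proj₁) e∈)))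
        (cong (λ c → ⟦ not c ⟧) (sym (∉⇒elem (f i) R absent)))
    where
    absent : f i ∉ R
    absent fi∈R with FirstRow.sound F fi∈R
    ... | i′ , a , b , c , i′∉ with injective a b 1≤i i≤n c
    ...   | refl = i′∉ s e∈

theorem3p3 : ∀ (n : ℕ) → 1 ≤ n → ∀ (σ : List ℕ) → IsPerm n σ → Avoids321 n σ →
    (fp (Θ σ) ≡ fp σ) × (exc (Θ σ) ≡ exc σ) × (crs (Θ σ) ≡ crs σ)
theorem3p3 n 1≤n σ perm avoids with trans (↭-length perm) (length-range n)
... | refl = transfer (Insertion.rskFrom-invariant av σ (λ i → cong (at σ) (sym (+-identityʳ (suc i)))) refl
      (Invariant-start av))
  where
  av : Avoiding321 (length σ) (at σ)
  av = IsPerm⇒Avoiding321 (length σ) σ perm avoids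

  transfer : Insertion.Invariant av (length σ) (proj₁ (rsk σ)) (proj₂ (rsk σ)) →
             (fp (Θ σ) ≡ fp σ) × (exc (Θ σ) ≡ exc σ) × (crs (Θ σ) ≡ crs σ)
  transfer (R , M , T , B , F) = same-fp , same-exc , same-crs
    where
    w w′ u : ℕ → Bool
    w  k = elem k (row 0 (proj₁ (rsk σ)))
    u  k = elem k (row 1 (proj₂ (rsk σ)))
    -- Read from its end, the right half has up- and down-steps exchanged, so its pushes are the
    -- positions outside the second row of `Q`.
    w′ k = not (u k)

    P≡ : ∀ k → 1 ≤ k → k ≤ length σ → ⟦ elem k (map (at σ ∘ proj₁) M) ⟧ ≡ ⟦ not (w k) ⟧
    P≡ k a b = trans (bumped≡¬first-row av B F k a b)
          (cong (λ r → ⟦ not (elem k r) ⟧) (sym (proj₁ (Tableaux-rows av T))))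

    Q≡ : ∀ k → 1 ≤ k → k ≤ length σ → ⟦ elem k (map proj₂ M) ⟧ ≡ ⟦ not (w′ k) ⟧
    Q≡ k _ _ = trans (cong (λ r → ⟦ elem k r ⟧) (sym (proj₂ (Tableaux-rows av T))))
          (cong ⟦_⟧ (sym (not-involutive (u k))))

    open Statistics av
    open Match (HistoryProfile.profile av B) w w′ P≡ Q≡
      using (ballotP; ballotQ; down≡; open≡; strands; fixed-points; excedance-values; spread; total; module
            𝒫; module 𝒬)
    open Image w w′ u (λ k → sym (not-involutive (u k))) ballotP ballotQ down≡ open≡
      using (fp-image; exc-image; crs-image)

    same-fp : fp (Θ σ) ≡ fp σ
    same-fp = trans fp-image (trans (sym fixed-points) (sym (count-range (λ i → at σ i ≡ᵇ i) (length σ))))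

    exc-σ : exc σ ≡ ∑ (length σ) exceeds
    exc-σ = count-range (λ i → i <ᵇ at σ i) (length σ)

    same-exc : exc (Θ σ) ≡ exc σ
    same-exc = trans exc-image (trans (sym excedance-values) (trans ∑-exceeded (sym exc-σ)))

    crs+exc-image : crs (Θ σ) + exc (Θ σ) ≡ ∑ (length σ) (Permutation.rising av)
    crs+exc-image = begin
      crs (Θ σ) + exc (Θ σ)
        ≡⟨ cong₂ _+_ crs-image exc-image ⟩
      𝒫.nested (length σ) + (C + 𝒬.nested (length σ)) + (𝒬.down (length σ) + X)
        ≡⟨ collect (𝒫.nested (length σ)) C (𝒬.nested (length σ)) (𝒬.down (length σ)) X ⟩
      𝒫.nested (length σ) + 𝒬.nested (length σ) + 𝒬.down (length σ) + (C + X)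
        ≡⟨ cong (𝒫.nested (length σ) + 𝒬.nested (length σ) + 𝒬.down (length σ) +_) (trans (sym (∑L-+ _ _ strands))
             (∑L-cong strands (λ { {i , j} _ → trans (+-assoc (𝒬.up j ∸ 𝒫.up i) _ _)
               (cong (𝒬.up j ∸ 𝒫.up i +_) (sym (∸-step (𝒫.up i) (𝒬.up j)))) }))) ⟩
      𝒫.nested (length σ) + 𝒬.nested (length σ) + 𝒬.down (length σ) + ∑L spread strands
        ≡⟨ total ⟨
      ∑ (length σ) (Permutation.rising av) ∎
      where
      open ≡-Reasoning
      C = ∑L (λ e → (𝒬.up (proj₂ e) ∸ 𝒫.up (proj₁ e)) + (𝒫.up (proj₁ e) ∸ suc (𝒬.up (proj₂ e)))) strands
      X = ∑L (λ e → ⟦ 𝒬.up (proj₂ e) <ᵇ 𝒫.up (proj₁ e) ⟧) strands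

    same-crs : crs (Θ σ) ≡ crs σ
    same-crs = +-cancelʳ-≡ (exc σ) _ _ (begin
      crs (Θ σ) + exc σ                                ≡⟨ cong (crs (Θ σ) +_) (sym same-exc) ⟩
      crs (Θ σ) + exc (Θ σ)                            ≡⟨ crs+exc-image ⟩
      ∑ (length σ) (Permutation.rising av)             ≡⟨ crossings+excedances ⟨
      ∑ (length σ) (λ i → ∑ (length σ) (λ j → ⟦ upper i j ∨ lower i j ⟧)) + ∑ (length σ) exceeds
        ≡⟨ cong₂ _+_ (count-pairs (isCrossing σ) (length σ)) exc-σ ⟨
      crs σ + exc σ                                    ∎)
      where open ≡-Reasoning
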